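{- Let $k\in\mathbb{Z}[i]$ be a Gaussian integer with $\operatorname{Re} k\neq 0$ and $|k|\geqslant 5\cdot 10^{37}$. If $d\in\mathbb{Z}[i]$ is such that $\{k-1,\,k+1,\,16k^3-4k,\,d\}$ is a Diophantine quadruple in $\mathbb{Z}[i]$, then $d=4k$ or $d=64k^5-48k^3+8k$.
   Context: A Diophantine quadruple in $\mathbb{Z}[i]$ is a set of four distinct nonzero Gaussian integers such that the product of any two distinct elements plus $1$ is the square of a Gaussian integer. (For every Gaussian integer $k$, $\{k-1,k+1,16k^3-4k\}$ is a Diophantine triple, since $(k-1)(k+1)+1=k^2$, $(k-1)(16k^3-4k)+1=(4k^2-2k-1)^2$, $(k+1)(16k^3-4k)+1=(4k^2+2k-1)^2$.) -}

module Defs where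

open import Data.Integer using (ℤ; +_; -_) renaming (_+_ to _+ℤ_; _*_ to _*ℤ_; _-_ to _-ℤ_)
open import Data.Product using (_×_; _,_; ∃)
open import Relation.Binary.PropositionalEquality using (_≡_)
open import Relation.Nullary using (¬_)

record ℤ[i] : Set where
  constructor _+_i
  field
    re : ℤ
    im : ℤ
open ℤ[i] public

infixl 6 _+ᵍ_ _-ᵍ_
infixl 7 _*ᵍ_

_+ᵍ_ : ℤ[i] → ℤ[i] → ℤ[i]
(a + b i) +ᵍ (c + d i) = (a +ℤ c) + (b +ℤ d) i

-ᵍ_ : ℤ[i] → ℤ[i]
-ᵍ (a + b i) = (- a) + (- b) i

_-ᵍ_ : ℤ[i] → ℤ[i] → ℤ[i]
x -ᵍ y = x +ᵍ (-ᵍ y)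

_*ᵍ_ : ℤ[i] → ℤ[i] → ℤ[i]
(a + b i) *ᵍ (c + d i) = (a *ℤ c -ℤ b *ℤ d) + (a *ℤ d +ℤ b *ℤ c) i

ι : ℤ → ℤ[i]
ι n = n + (+ 0) i

0ᵍ 1ᵍ : ℤ[i]
0ᵍ = ι (+ 0)
1ᵍ = ι (+ 1)

norm : ℤ[i] → ℤ
norm (a + b i) = a *ℤ a +ℤ b *ℤ b

IsSquare : ℤ[i] → Set
IsSquare x = ∃ λ (y : ℤ[i]) → y *ᵍ y ≡ x

DioPair : ℤ[i] → ℤ[i] → Set
DioPair x y = IsSquare (x *ᵍ y +ᵍ 1ᵍ)

DiophantineQuadruple : ℤ[i] → ℤ[i] → ℤ[i] → ℤ[i] → Set
DiophantineQuadruple a b c d =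
  (¬ a ≡ 0ᵍ × ¬ b ≡ 0ᵍ × ¬ c ≡ 0ᵍ × ¬ d ≡ 0ᵍ)
  × (¬ a ≡ b × ¬ a ≡ c × ¬ a ≡ d × ¬ b ≡ c × ¬ b ≡ d × ¬ c ≡ d)
  × (DioPair a b × DioPair a c × DioPair a d
     × DioPair b c × DioPair b d × DioPair c d)

{-# OPTIONS --safe #-}
module Submission where

-- Solving the Pellian equation (k + 1)x² − (k − 1)y² = 2 by descent shows that an extension d of {k − 1, k + 1} is a member
-- of an explicit sequence D 0 = 0, D 1 = 4k, D 2 = c = 16k³ − 4k, D 3 = 64k⁵ − 48k³ + 8k, …, with |D m| growing like |2k|^(2m−1).
-- For 4 ≤ m ≤ 31, c D m + 1 is, up to a square factor, a monic polynomial of even degree in 4k with integer coefficients; it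
-- lies too close to the square of a polynomial to be a square itself (Runge).
-- For m ≥ 32 the hypergeometric method applies. Put a = k − 1 and b = k + 1; the triple abz : ty·a : sx·b, where t² = bc + 1
-- and s² = ac + 1, is very close to √(abc) : √(abc + a) : √(abc + b). The divided differences of τ^(ν + 1/2) at the nodes
-- abc, abc + a, abc + b, each taken about ν times, are linear forms in these three square roots. Because b − a = 2 is small and
-- c has size |k|³, they can be scaled to have coefficients in ℤ[i] of size about |k|^(6ν) and values of size about |k|^(−8ν),
-- which rules out |z| > |k|^33. Since |k| is huge, factors of the form Cᵛ are harmless, and all sizes are measured by the norm N,
-- which is multiplicative and satisfies N (x + y) ≤ 2 (N x + N y).

-- Write Q = N k. With parameter ν the linear forms exclude every solution with N z between about
-- Q^(6ν + 2), from where the error of the approximation is harmless, and Q^(8ν), up to where the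
-- value of the form is small enough. Consecutive windows overlap only if 6(ν + 1) + 2 < 8ν, that is
-- from ν = 5 on, and the window of ν = 5 begins at Q^32 times a constant. Hence the exponent 33,
-- the division at index 32, and a different method for the smaller indices. The constants are
-- powers such as 4^(16ν + 13); 4^125 is the largest power of 4 below (5 · 10^37)², and this lower
-- bound for Q pays for all of them. The contradiction needs a form that does not vanish at the
-- approximating triple, because a nonzero element of ℤ[i] has norm at least 1. A single form may
-- vanish, but three neighbouring ones cannot vanish together. Square roots and infinite series do
-- not live in ℤ[i]. A series in 1/B is represented by its partial sums multiplied by B^L, and a
-- limit by inequalities valid for all large L.

module Development where

  open import Algebra.Bundles using (CommutativeRing)
  open import Algebra.Structures using (IsCommutativeRing)
  open import Algebra.Solver.Ring.AlmostCommutativeRing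
  open import Data.Empty using (⊥)
  open import Data.Integer using (ℤ; +_; -[1+_]; ∣_∣)
  import Data.Integer as ℤ
  import Data.Integer.Properties as ℤ
  import Data.Integer.Solver as ℤS
  open import Data.Maybe using (Maybe; just; nothing)
  open import Data.Nat using (ℕ; zero; suc; _+_; _*_; _^_; _∸_; _≤_; _<_; z≤n; s≤s; NonZero; >-nonZero; _≤?_; _≤ᵇ_; _⊔_)
  open import Data.Nat.Induction using (<-wellFounded)
  open import Data.Nat.Properties
  open import Data.Nat.Solver using (module +-*-Solver)
  open import Data.Nat.Tactic.RingSolver using (solve-∀)
  open import Data.Product using (_×_; _,_; ∃; proj₁; proj₂)
  open import Data.Sum using (_⊎_; inj₁; inj₂)
  open import Data.Unit using (tt)
  open import Induction.WellFounded using (Acc; acc)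
  open import Relation.Binary.PropositionalEquality hiding (J; [_])
  open import Relation.Nullary using (¬_; Dec; yes; no; contradiction)

  -- Commutative rings with a multiplicative norm

  record NormedRing : Set₁ where
    infixl 6 _⊕_
    infixl 7 _⊗_
    field
      Carrier : Set
      _⊕_ _⊗_ : Carrier → Carrier → Carrier
      neg : Carrier → Carrier
      ι : ℤ → Carrier
      isCommutativeRing : IsCommutativeRing _≡_ _⊕_ _⊗_ neg (ι (+ 0)) (ι (+ 1))
      ι-+ : ∀ m n → ι (m ℤ.+ n) ≡ ι m ⊕ ι n
      ι-* : ∀ m n → ι (m ℤ.* n) ≡ ι m ⊗ ι n
      ι-neg : ∀ m → ι (ℤ.- m) ≡ neg (ι m)
      N : Carrier → ℕ
      N-⊗ : ∀ x y → N (x ⊗ y) ≡ N x * N y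
      N-⊕ : ∀ x y → N (x ⊕ y) ≤ 2 * (N x + N y)
      N-ι : ∀ n → N (ι n) ≡ ∣ n ∣ * ∣ n ∣
      N≡0 : ∀ {x} → N x ≡ 0 → x ≡ ι (+ 0)

  module Ring (𝓡 : NormedRing) where
    open NormedRing 𝓡 public

    𝟘 𝟙 𝟚 : Carrier
    𝟘 = ι (+ 0)
    𝟙 = ι (+ 1)
    𝟚 = ι (+ 2)

    infixl 6 _⊖_
    _⊖_ : Carrier → Carrier → Carrier
    x ⊖ y = x ⊕ neg y

    commutativeRing : CommutativeRing _ _
    commutativeRing = record { isCommutativeRing = isCommutativeRing }

    open CommutativeRing commutativeRing public using ()
      renaming (+-identityˡ to ⊕-identityˡ; +-identityʳ to ⊕-identityʳ; *-identityˡ to ⊗-identityˡ;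
        *-identityʳ to ⊗-identityʳ; zeroʳ to ⊗-zeroʳ; *-comm to ⊗-comm; +-comm to ⊕-comm; -‿inverseʳ to ⊖-inverse)

    almostCommutativeRing : AlmostCommutativeRing _ _
    almostCommutativeRing = fromCommutativeRing commutativeRing

    ι-morphism : CommutativeRing.rawRing ℤ.+-*-commutativeRing -Raw-AlmostCommutative⟶ almostCommutativeRing
    ι-morphism = record
      { ⟦_⟧ = ι ; +-homo = ι-+ ; *-homo = ι-* ; -‿homo = ι-neg ; 0-homo = refl ; 1-homo = refl }

    ι-dec : ∀ m n → Maybe (ι m ≡ ι n)
    ι-dec m n with m ℤ.≟ n
    ... | yes refl = just refl
    ... | no _ = nothing

    open import Algebra.Solver.Ring (CommutativeRing.rawRing ℤ.+-*-commutativeRing)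
      almostCommutativeRing ι-morphism ι-dec public
      using (solve; _:=_; _:+_; _:*_; _:-_; :-_; con)

    infixr 8 _↑_
    _↑_ : Carrier → ℕ → Carrier
    x ↑ zero = 𝟙
    x ↑ suc n = x ⊗ x ↑ n

    ⊖≡𝟘 : ∀ {x y} → x ⊖ y ≡ 𝟘 → x ≡ y
    ⊖≡𝟘 {x} {y} h = begin
      x ≡⟨ solve 2 (λ x y → x := x :- y :+ y) refl x y ⟩
      x ⊖ y ⊕ y ≡⟨ cong (_⊕ y) h ⟩
      𝟘 ⊕ y ≡⟨ ⊕-identityˡ y ⟩
      y ∎
      where open ≡-Reasoning

    N-𝟙 : N 𝟙 ≡ 1
    N-𝟙 = N-ι (+ 1)

    N-𝟘 : N 𝟘 ≡ 0
    N-𝟘 = N-ι (+ 0)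

    N-neg : ∀ x → N (neg x) ≡ N x
    N-neg x = begin
      N (neg x) ≡⟨ cong N (solve 1 (λ x → :- x := con (ℤ.- (+ 1)) :* x) refl x) ⟩
      N (ι (ℤ.- (+ 1)) ⊗ x) ≡⟨ N-⊗ _ x ⟩
      N (ι (ℤ.- (+ 1))) * N x ≡⟨ cong (_* N x) (N-ι (ℤ.- (+ 1))) ⟩
      1 * N x ≡⟨ *-identityˡ (N x) ⟩
      N x ∎
      where open ≡-Reasoning

    N-⊖ : ∀ x y → N (x ⊖ y) ≤ 2 * (N x + N y)
    N-⊖ x y = subst (λ t → N (x ⊖ y) ≤ 2 * (N x + t)) (N-neg y) (N-⊕ x (neg y))

    N-↑ : ∀ x n → N (x ↑ n) ≡ N x ^ n
    N-↑ x zero = N-𝟙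
    N-↑ x (suc n) = trans (N-⊗ x (x ↑ n)) (cong (N x *_) (N-↑ x n))

    N>0 : ∀ {x} → ¬ x ≡ 𝟘 → 1 ≤ N x
    N>0 {x} h with N x in eq
    ... | zero = contradiction (N≡0 eq) h
    ... | suc _ = s≤s z≤n

    ⊗-cancel : ∀ {x y} → 1 ≤ N x → x ⊗ y ≡ 𝟘 → y ≡ 𝟘
    ⊗-cancel {x} {y} x>0 h with m*n≡0⇒m≡0∨n≡0 (N x) (trans (sym (N-⊗ x y)) (trans (cong N h) N-𝟘))
    ... | inj₁ p = contradiction (subst (1 ≤_) p x>0) λ ()
    ... | inj₂ p = N≡0 p

    ⊗-cancelˡ : ∀ {x y z} → 1 ≤ N x → x ⊗ y ≡ x ⊗ z → y ≡ z
    ⊗-cancelˡ {x} {y} {z} x>0 h = ⊖≡𝟘 (⊗-cancel x>0 (begin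
      x ⊗ (y ⊖ z) ≡⟨ solve 3 (λ x y z → x :* (y :- z) := x :* y :- x :* z) refl x y z ⟩
      x ⊗ y ⊖ x ⊗ z ≡⟨ cong (_⊖ x ⊗ z) h ⟩
      x ⊗ z ⊖ x ⊗ z ≡⟨ ⊖-inverse (x ⊗ z) ⟩
      𝟘 ∎))
      where open ≡-Reasoning

    ↑-+ : ∀ x m n → x ↑ (m + n) ≡ x ↑ m ⊗ x ↑ n
    ↑-+ x zero n = sym (⊗-identityˡ _)
    ↑-+ x (suc m) n = trans (cong (x ⊗_) (↑-+ x m n)) (solve 3 (λ x y z → x :* (y :* z) := x :* y :* z) refl x _ _)

    ⟨_⟩ : ℕ → Carrier
    ⟨ n ⟩ = ι (+ n)

    ⟨suc⟩ : ∀ n → ⟨ suc n ⟩ ≡ 𝟙 ⊕ ⟨ n ⟩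
    ⟨suc⟩ n = ι-+ (+ 1) (+ n)

    ↑-⊗ : ∀ x y n → (x ⊗ y) ↑ n ≡ x ↑ n ⊗ y ↑ n
    ↑-⊗ x y zero = sym (⊗-identityˡ _)
    ↑-⊗ x y (suc n) = trans (cong (x ⊗ y ⊗_) (↑-⊗ x y n))
      (solve 4 (λ x y s t → x :* y :* (s :* t) := x :* s :* (y :* t)) refl x y _ _)

    N⊗≤ : ∀ {x y X Y} → N x ≤ X → N y ≤ Y → N (x ⊗ y) ≤ X * Y
    N⊗≤ {x} {y} h g = ≤-trans (≤-reflexive (N-⊗ x y)) (*-mono-≤ h g)

    N↑≤ : ∀ {x X} → N x ≤ X → ∀ n → N (x ↑ n) ≤ X ^ n
    N↑≤ {x} h n = ≤-trans (≤-reflexive (N-↑ x n)) (^-monoˡ-≤ n h)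

    N⊕≤ : ∀ {x y X Y} → N x ≤ X → N y ≤ Y → N (x ⊕ y) ≤ 2 * (X + Y)
    N⊕≤ {x} {y} h g = ≤-trans (N-⊕ x y) (*-monoʳ-≤ 2 (+-mono-≤ h g))

    N⊖≤ : ∀ {x y X Y} → N x ≤ X → N y ≤ Y → N (x ⊖ y) ≤ 2 * (X + Y)
    N⊖≤ {x} {y} h g = ≤-trans (N-⊖ x y) (*-monoʳ-≤ 2 (+-mono-≤ h g))

  -- Binomial coefficients of integers and of half-integers

  P : ℕ → ℕ → ℕ
  P zero n = 1
  P (suc m) zero = 1
  P (suc m) (suc n) = P m (suc n) + P (suc m) n

  P-zero : ∀ m → P m 0 ≡ 1
  P-zero zero = refl
  P-zero (suc m) = refl

  P-absorb : ∀ m n → suc n * P m (suc n) ≡ suc (m + n) * P m n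
  P-absorb zero n = refl
  P-absorb (suc m) zero = begin
    1 * (P m 1 + 1) ≡⟨ solve 1 (λ x → con 1 :* (x :+ con 1) := con 1 :* x :+ con 1) refl (P m 1) ⟩
    1 * P m 1 + 1 ≡⟨ cong (_+ 1) (P-absorb m 0) ⟩
    suc (m + 0) * P m 0 + 1 ≡⟨ cong (λ t → suc (m + 0) * t + 1) (P-zero m) ⟩
    suc (m + 0) * 1 + 1 ≡⟨ solve 1 (λ m → (con 1 :+ m) :* con 1 :+ con 1 := (con 2 :+ m) :* con 1) refl (m + 0) ⟩
    suc (suc m + 0) * 1 ∎
    where open ≡-Reasoning
          open +-*-Solver
  P-absorb (suc m) (suc n) = begin
    suc (suc n) * (P m (suc (suc n)) + P (suc m) (suc n)) ≡⟨ *-distribˡ-+ (suc (suc n)) (P m (suc (suc n))) _ ⟩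
    suc (suc n) * P m (suc (suc n)) + suc (suc n) * P (suc m) (suc n)
      ≡⟨ cong₂ _+_ (P-absorb m (suc n)) (cong (_+_ (P (suc m) (suc n))) (P-absorb (suc m) n)) ⟩
    suc (m + suc n) * x + (x + y + suc (suc m + n) * y)
      ≡⟨ solve 4 (λ m n x y → (con 1 :+ (m :+ (con 1 :+ n))) :* x :+ (x :+ y :+ (con 1 :+ (con 1 :+ m :+ n)) :* y)
           := (con 1 :+ (con 1 :+ m :+ (con 1 :+ n))) :* (x :+ y)) refl m n x y ⟩
    suc (suc m + suc n) * (x + y) ∎
    where open ≡-Reasoning
          open +-*-Solver
          x = P m (suc n)
          y = P (suc m) n

  -- `P m n` is the binomial coefficient binom(m + n, n), computed by Pascal's rule without
  -- subtraction; symmetry is what turns `P-absorb` into the recurrence of the central coefficients.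
  P-sym : ∀ m n → P m n ≡ P n m
  P-sym zero n = sym (P-zero n)
  P-sym (suc m) zero = refl
  P-sym (suc m) (suc n) = trans (cong₂ _+_ (P-sym m (suc n)) (P-sym (suc m) n)) (+-comm _ (P n (suc m)))

  P-central : ∀ n → suc n * P (suc n) (suc n) ≡ (4 * n + 2) * P n n
  P-central n = begin
    suc n * (P n (suc n) + P (suc n) n) ≡⟨ cong (λ t → suc n * (P n (suc n) + t)) (P-sym (suc n) n) ⟩
    suc n * (x + x) ≡⟨ solve 2 (λ n x → (con 1 :+ n) :* (x :+ x) := con 2 :* ((con 1 :+ n) :* x)) refl n x ⟩
    2 * (suc n * x) ≡⟨ cong (2 *_) (P-absorb n n) ⟩
    2 * (suc (n + n) * P n n) ≡⟨ solve 2 (λ n y → con 2 :* ((con 1 :+ (n :+ n)) :* y) := (con 4 :* n :+ con 2) :* y) refl n (P n n) ⟩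
    (4 * n + 2) * P n n ∎
    where open ≡-Reasoning
          open +-*-Solver
          x = P n (suc n)

  P≤2^ : ∀ m n → P m n ≤ 2 ^ (m + n)
  P≤2^ zero n = m^n>0 2 n
  P≤2^ (suc m) zero = m^n>0 2 (suc m + 0)
  P≤2^ (suc m) (suc n) = begin
    P m (suc n) + P (suc m) n ≤⟨ +-mono-≤ (P≤2^ m (suc n)) (P≤2^ (suc m) n) ⟩
    2 ^ (m + suc n) + 2 ^ (suc m + n) ≡⟨ cong (λ t → 2 ^ (m + suc n) + 2 ^ t) (sym (+-suc m n)) ⟩
    2 ^ (m + suc n) + 2 ^ (m + suc n) ≡⟨ cong (λ t → 2 ^ (m + suc n) + t) (sym (+-identityʳ _)) ⟩
    2 ^ (suc m + suc n) ∎
    where open ≤-Reasoning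

  sgn : ℕ → ℤ
  sgn zero = + 1
  sgn (suc n) = ℤ.- sgn n

  ∣sgn∣ : ∀ n → ∣ sgn n ∣ ≡ 1
  ∣sgn∣ zero = refl
  ∣sgn∣ (suc n) = trans (ℤ.∣-i∣≡∣i∣ (sgn n)) (∣sgn∣ n)

  -- β p m = 4ᵐ · binom(p − 1/2, m)
  β : ℕ → ℕ → ℤ
  β zero m = sgn m ℤ.* + P m m
  β (suc p) zero = + 1
  β (suc p) (suc m) = β p (suc m) ℤ.+ + 4 ℤ.* β p m

  β-zero : ∀ p → β p 0 ≡ + 1
  β-zero zero = refl
  β-zero (suc p) = refl

  -- The quotient of consecutive binomials binom(p - 1/2, m), cleared of denominators. All
  -- identities for `γ` and for the series below rest on this recurrence rather than on a closed
  -- formula.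
  β-suc : ∀ p m → + suc m ℤ.* β p (suc m) ≡ (+ 4 ℤ.* + p ℤ.- + 2 ℤ.- + 4 ℤ.* + m) ℤ.* β p m
  β-suc zero m = begin
    + suc m ℤ.* (ℤ.- sgn m ℤ.* + P (suc m) (suc m))
      ≡⟨ solve 3 (λ x s y → x :* (:- s :* y) := :- s :* (x :* y)) refl (+ suc m) (sgn m) _ ⟩
    ℤ.- sgn m ℤ.* (+ suc m ℤ.* + P (suc m) (suc m)) ≡⟨ cong (ℤ.- sgn m ℤ.*_) (sym (ℤ.pos-* (suc m) _)) ⟩
    ℤ.- sgn m ℤ.* + (suc m * P (suc m) (suc m)) ≡⟨ cong (λ t → ℤ.- sgn m ℤ.* + t) (P-central m) ⟩
    ℤ.- sgn m ℤ.* + ((4 * m + 2) * P m m) ≡⟨ cong (ℤ.- sgn m ℤ.*_) (ℤ.pos-* (4 * m + 2) _) ⟩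
    ℤ.- sgn m ℤ.* (+ (4 * m + 2) ℤ.* + P m m)
      ≡⟨ cong (λ t → ℤ.- sgn m ℤ.* (t ℤ.* + P m m)) (trans (ℤ.pos-+ (4 * m) 2) (cong (ℤ._+ + 2) (ℤ.pos-* 4 m))) ⟩
    ℤ.- sgn m ℤ.* ((+ 4 ℤ.* + m ℤ.+ + 2) ℤ.* + P m m)
      ≡⟨ solve 3 (λ m s y → :- s :* ((con (+ 4) :* m :+ con (+ 2)) :* y)
           := (con (+ 4) :* con (+ 0) :- con (+ 2) :- con (+ 4) :* m) :* (s :* y)) refl (+ m) (sgn m) (+ P m m) ⟩
    (+ 4 ℤ.* + 0 ℤ.- + 2 ℤ.- + 4 ℤ.* + m) ℤ.* (sgn m ℤ.* + P m m) ∎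
    where open ≡-Reasoning
          open ℤS.+-*-Solver
  β-suc (suc p) zero = begin
    + 1 ℤ.* (β p 1 ℤ.+ + 4 ℤ.* β p 0) ≡⟨ solve 2 (λ x y → con (+ 1) :* (x :+ con (+ 4) :* y) := con (+ 1) :* x :+ con (+ 4) :* y) refl (β p 1) (β p 0) ⟩
    + 1 ℤ.* β p 1 ℤ.+ + 4 ℤ.* β p 0 ≡⟨ cong (ℤ._+ + 4 ℤ.* β p 0) (β-suc p 0) ⟩
    (+ 4 ℤ.* + p ℤ.- + 2 ℤ.- + 4 ℤ.* + 0) ℤ.* β p 0 ℤ.+ + 4 ℤ.* β p 0
      ≡⟨ cong (λ t → (+ 4 ℤ.* + p ℤ.- + 2 ℤ.- + 4 ℤ.* + 0) ℤ.* t ℤ.+ + 4 ℤ.* t) (β-zero p) ⟩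
    (+ 4 ℤ.* + p ℤ.- + 2 ℤ.- + 4 ℤ.* + 0) ℤ.* + 1 ℤ.+ + 4 ℤ.* + 1
      ≡⟨ solve 1 (λ p → (con (+ 4) :* p :- con (+ 2) :- con (+ 4) :* con (+ 0)) :* con (+ 1) :+ con (+ 4) :* con (+ 1)
           := (con (+ 4) :* (con (+ 1) :+ p) :- con (+ 2) :- con (+ 4) :* con (+ 0)) :* con (+ 1)) refl (+ p) ⟩
    (+ 4 ℤ.* + suc p ℤ.- + 2 ℤ.- + 4 ℤ.* + 0) ℤ.* + 1 ∎
    where open ≡-Reasoning
          open ℤS.+-*-Solver
  β-suc (suc p) (suc m) = begin
    + suc (suc m) ℤ.* (z ℤ.+ + 4 ℤ.* y)
      ≡⟨ ℤ.*-distribˡ-+ (+ suc (suc m)) z _ ⟩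
    + suc (suc m) ℤ.* z ℤ.+ + suc (suc m) ℤ.* (+ 4 ℤ.* y) ≡⟨ cong (ℤ._+ + suc (suc m) ℤ.* (+ 4 ℤ.* y)) (β-suc p (suc m)) ⟩
    (+ 4 ℤ.* + p ℤ.- + 2 ℤ.- + 4 ℤ.* (+ 1 ℤ.+ + m)) ℤ.* y ℤ.+ (+ 2 ℤ.+ + m) ℤ.* (+ 4 ℤ.* y)
      ≡⟨ solve 3 (λ p m y → (con (+ 4) :* p :- con (+ 2) :- con (+ 4) :* (con (+ 1) :+ m)) :* y :+ (con (+ 2) :+ m) :* (con (+ 4) :* y)
           := (con (+ 4) :* (con (+ 1) :+ p) :- con (+ 2) :- con (+ 4) :* (con (+ 1) :+ m)) :* y :+ con (+ 4) :* ((con (+ 1) :+ m) :* y)) refl (+ p) (+ m) y ⟩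
    q ℤ.* y ℤ.+ + 4 ℤ.* (+ suc m ℤ.* y) ≡⟨ cong (λ t → q ℤ.* y ℤ.+ + 4 ℤ.* t) (β-suc p m) ⟩
    q ℤ.* y ℤ.+ + 4 ℤ.* ((+ 4 ℤ.* + p ℤ.- + 2 ℤ.- + 4 ℤ.* + m) ℤ.* x)
      ≡⟨ solve 4 (λ p m y x → (con (+ 4) :* (con (+ 1) :+ p) :- con (+ 2) :- con (+ 4) :* (con (+ 1) :+ m)) :* y
             :+ con (+ 4) :* ((con (+ 4) :* p :- con (+ 2) :- con (+ 4) :* m) :* x)
           := (con (+ 4) :* (con (+ 1) :+ p) :- con (+ 2) :- con (+ 4) :* (con (+ 1) :+ m)) :* (y :+ con (+ 4) :* x)) refl (+ p) (+ m) y x ⟩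
    q ℤ.* (y ℤ.+ + 4 ℤ.* x) ∎
    where open ≡-Reasoning
          open ℤS.+-*-Solver
          x = β p m
          y = β p (suc m)
          z = β p (suc (suc m))
          q = + 4 ℤ.* + suc p ℤ.- + 2 ℤ.- + 4 ℤ.* + suc m

  ∣β∣≤ : ∀ p m → ∣ β p m ∣ ≤ 2 ^ p * 4 ^ m
  ∣β∣≤ zero m = begin
    ∣ sgn m ℤ.* + P m m ∣ ≡⟨ ℤ.abs-* (sgn m) (+ P m m) ⟩
    ∣ sgn m ∣ * P m m ≡⟨ cong (_* P m m) (∣sgn∣ m) ⟩
    1 * P m m ≤⟨ *-monoʳ-≤ 1 (P≤2^ m m) ⟩
    1 * 2 ^ (m + m) ≡⟨ cong (1 *_) (trans (cong (2 ^_) (cong (λ t → m + t) (sym (+-identityʳ m)))) (sym (^-*-assoc 2 2 m))) ⟩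
    1 * 4 ^ m ∎
    where open ≤-Reasoning
  ∣β∣≤ (suc p) zero = ≤-trans (m^n>0 2 (suc p)) (≤-reflexive (sym (*-identityʳ _)))
  ∣β∣≤ (suc p) (suc m) = begin
    ∣ β p (suc m) ℤ.+ + 4 ℤ.* β p m ∣ ≤⟨ ℤ.∣i+j∣≤∣i∣+∣j∣ (β p (suc m)) _ ⟩
    ∣ β p (suc m) ∣ + ∣ + 4 ℤ.* β p m ∣ ≡⟨ cong (λ t → ∣ β p (suc m) ∣ + t) (ℤ.abs-* (+ 4) (β p m)) ⟩
    ∣ β p (suc m) ∣ + 4 * ∣ β p m ∣ ≤⟨ +-mono-≤ (∣β∣≤ p (suc m)) (*-monoʳ-≤ 4 (∣β∣≤ p m)) ⟩
    2 ^ p * 4 ^ suc m + 4 * (2 ^ p * 4 ^ m)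
      ≡⟨ solve 2 (λ x y → x :* (con 4 :* y) :+ con 4 :* (x :* y) := con 2 :* x :* (con 4 :* y)) refl (2 ^ p) (4 ^ m) ⟩
    2 ^ suc p * 4 ^ suc m ∎
    where open ≤-Reasoning
          open +-*-Solver

  ∸-step : ∀ {m n} → n < m → m ∸ n ≡ suc (m ∸ suc n)
  ∸-step {suc m} {zero} _ = refl
  ∸-step {suc m} {suc n} (s≤s h) = ∸-step h

  -- An odd number is not 0. Here it appears as twice a degree of homogeneity, and this is where the
  -- half-integer exponent of τ^(ν + 1/2) is indispensable: Euler's identity can be solved for its
  -- right side.
  odd≢0 : ∀ m n → ¬ + 2 ℤ.* + m ℤ.+ + 3 ℤ.- + 2 ℤ.* + n ≡ + 0
  odd≢0 m n h = even≢1 ∣ k ∣ (begin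
    2 * ∣ k ∣ ≡⟨ sym (ℤ.abs-* (+ 2) k) ⟩
    ∣ + 2 ℤ.* k ∣ ≡⟨ cong ∣_∣ (solve 2 (λ m n → con (+ 2) :* (n :- m :- con (+ 1))
        := con (+ 1) :- (con (+ 2) :* m :+ con (+ 3) :- con (+ 2) :* n)) refl (+ m) (+ n)) ⟩
    ∣ + 1 ℤ.- (+ 2 ℤ.* + m ℤ.+ + 3 ℤ.- + 2 ℤ.* + n) ∣ ≡⟨ cong (λ t → ∣ + 1 ℤ.- t ∣) h ⟩
    1 ∎)
    where
    open ≡-Reasoning
    open ℤS.+-*-Solver
    k = + n ℤ.- + m ℤ.- + 1
    even≢1 : ∀ k → ¬ 2 * k ≡ 1
    even≢1 (suc k) h = contradiction (trans (sym (+-suc k (k + 0))) (suc-injective h)) λ ()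

  -- The linear forms: recurrences of Newton and Euler, and nonvanishing

  module Forms (𝓡 : NormedRing) where
    open Ring 𝓡

    ↑-∸ : ∀ x {m n} → n < m → x ↑ (m ∸ n) ≡ x ⊗ x ↑ (m ∸ suc n)
    ↑-∸ x h = cong (x ↑_) (∸-step h)

    -- Up to a factor depending on ν only, γ ν h τ^(ν - h) √τ is the h-th divided derivative of τ^(ν + 1/2).
    γ : ℕ → ℕ → Carrier
    γ ν h = ι (+ 4) ↑ (ν ∸ h) ⊗ ι (β (suc ν) h)

    -- Twice the degree of homogeneity ν + 3/2 - n of a divided difference of τ^(ν + 1/2) at n
    -- nodes.
    weight : ℕ → ℕ → Carrier
    weight ν n = 𝟚 ⊗ ⟨ ν ⟩ ⊕ ι (+ 3) ⊖ 𝟚 ⊗ ⟨ n ⟩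

    weight-suc : ∀ ν n → weight ν (suc n) ≡ weight ν n ⊖ 𝟚
    weight-suc ν n = trans (cong (λ t → 𝟚 ⊗ ⟨ ν ⟩ ⊕ ι (+ 3) ⊖ 𝟚 ⊗ t) (⟨suc⟩ n))
      (solve 2 (λ x n → x :- con (+ 2) :* (con (+ 1) :+ n) := x :- con (+ 2) :* n :- con (+ 2)) refl (𝟚 ⊗ ⟨ ν ⟩ ⊕ ι (+ 3)) ⟨ n ⟩)

    γ-suc : ∀ ν h → h < ν → 𝟚 ⊗ ⟨ suc h ⟩ ⊗ γ ν (suc h) ≡ weight ν (suc h) ⊗ γ ν h
    γ-suc ν h h<ν = begin
      𝟚 ⊗ ⟨ suc h ⟩ ⊗ (f ⊗ ι (β (suc ν) (suc h)))
        ≡⟨ solve 3 (λ n f b → con (+ 2) :* n :* (f :* b) := con (+ 2) :* f :* (n :* b)) refl _ f _ ⟩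
      𝟚 ⊗ f ⊗ (⟨ suc h ⟩ ⊗ ι (β (suc ν) (suc h))) ≡⟨ cong (𝟚 ⊗ f ⊗_) (sym (ι-* _ _)) ⟩
      𝟚 ⊗ f ⊗ ι (+ suc h ℤ.* β (suc ν) (suc h)) ≡⟨ cong (λ t → 𝟚 ⊗ f ⊗ ι t) (β-suc (suc ν) h) ⟩
      𝟚 ⊗ f ⊗ ι ((+ 4 ℤ.* + suc ν ℤ.- + 2 ℤ.- + 4 ℤ.* + h) ℤ.* β (suc ν) h)
        ≡⟨ cong (𝟚 ⊗ f ⊗_) (ι-* _ _) ⟩
      𝟚 ⊗ f ⊗ (ι (+ 4 ℤ.* + suc ν ℤ.- + 2 ℤ.- + 4 ℤ.* + h) ⊗ ι (β (suc ν) h))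
        ≡⟨ cong (λ t → 𝟚 ⊗ f ⊗ (t ⊗ ι (β (suc ν) h))) coefficient ⟩
      𝟚 ⊗ f ⊗ ((ι (+ 4) ⊗ (𝟙 ⊕ ⟨ ν ⟩) ⊖ 𝟚 ⊖ ι (+ 4) ⊗ ⟨ h ⟩) ⊗ ι (β (suc ν) h))
        ≡⟨ solve 4 (λ f n h b → con (+ 2) :* f :* ((con (+ 4) :* (con (+ 1) :+ n) :- con (+ 2) :- con (+ 4) :* h) :* b)
             := (con (+ 2) :* n :+ con (+ 3) :- con (+ 2) :* h :- con (+ 2)) :* (con (+ 4) :* f :* b)) refl f ⟨ ν ⟩ ⟨ h ⟩ _ ⟩
      (weight ν h ⊖ 𝟚) ⊗ (ι (+ 4) ⊗ f ⊗ ι (β (suc ν) h))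
        ≡⟨ cong₂ (λ s t → s ⊗ (t ⊗ ι (β (suc ν) h))) (sym (weight-suc ν h)) (sym (↑-∸ (ι (+ 4)) h<ν)) ⟩
      weight ν (suc h) ⊗ γ ν h ∎
      where
      open ≡-Reasoning
      f = ι (+ 4) ↑ (ν ∸ suc h)
      coefficient : ι (+ 4 ℤ.* + suc ν ℤ.- + 2 ℤ.- + 4 ℤ.* + h) ≡ ι (+ 4) ⊗ (𝟙 ⊕ ⟨ ν ⟩) ⊖ 𝟚 ⊖ ι (+ 4) ⊗ ⟨ h ⟩
      coefficient = trans (ι-+ _ _) (cong₂ _⊕_
        (trans (ι-+ _ _) (cong₂ _⊕_ (trans (ι-* _ _) (cong (ι (+ 4) ⊗_) (⟨suc⟩ ν))) (ι-neg _)))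
        (trans (ι-neg _) (cong neg (ι-* _ _))))

    -- Divided differences with i nodes at μ and j nodes at μ + 1; X and Y stand for √μ and √(μ + 1).
    G : ℕ → (μ X Y : Carrier) → ℕ → ℕ → Carrier
    G ν μ X Y zero zero = 𝟘
    G ν μ X Y (suc i) zero = γ ν i ⊗ μ ↑ (ν ∸ i) ⊗ X
    G ν μ X Y zero (suc j) = γ ν j ⊗ (μ ⊕ 𝟙) ↑ (ν ∸ j) ⊗ Y
    G ν μ X Y (suc i) (suc j) = G ν μ X Y i (suc j) ⊖ G ν μ X Y (suc i) j

    module _ (a c : Carrier) (ρ : ℕ) where
      b : Carrier
      b = a ⊕ 𝟚

      -- The exponent `ρ` is ν - 1 because one factor a or b is already contained in the arguments a
      -- ζ and b ζ. `T` is the largest number of nodes lying at abc and one other point in the forms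
      -- that are used.
      ν T : ℕ
      ν = suc ρ
      T = ν + ν + 1

      module Form (ζ η₁ η₂ : Carrier) where
        Gᵃ Gᵇ : ℕ → ℕ → Carrier
        Gᵃ = G ν (b ⊗ c) (b ⊗ ζ) η₁
        Gᵇ = G ν (a ⊗ c) (a ⊗ ζ) η₂

        -- Up to the factor 4^ν this is 2^(n₁ + n₂) (ab)^(ν - 1) times the divided difference of
        -- τ^(ν + 1/2) at n₀ nodes abc, n₁ nodes abc + a and n₂ nodes abc + b, with abζ, aη₁, bη₂ in
        -- place of the three roots. Dividing the nodes by a, or by b, makes their spacing 1 on the
        -- two faces; the spacing b - a = 2 of the other pair is absorbed by the power of 2. The
        -- truncated exponents are genuine as long as n₀ + n₁ and n₀ + n₂ do not exceed `T`.
        J : ℕ → ℕ → ℕ → Carrier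
        J n₀ n₁ zero = 𝟚 ↑ n₁ ⊗ a ↑ (T ∸ (n₀ + n₁)) ⊗ b ↑ ρ ⊗ Gᵃ n₀ n₁
        J n₀ zero (suc n₂) = 𝟚 ↑ suc n₂ ⊗ b ↑ (T ∸ (n₀ + suc n₂)) ⊗ a ↑ ρ ⊗ Gᵇ n₀ (suc n₂)
        J n₀ (suc n₁) (suc n₂) = J n₀ n₁ (suc n₂) ⊖ J n₀ (suc n₁) n₂

        -- When all nodes are at abc, scaling by a and scaling by b must give the same element,
        -- although `J` is defined there by the first. The choice of the powers of a and b is made
        -- for this agreement.
        J-b : ∀ n₀ n₂ → n₀ ≤ suc ν → J n₀ 0 n₂ ≡ 𝟚 ↑ n₂ ⊗ b ↑ (T ∸ (n₀ + n₂)) ⊗ a ↑ ρ ⊗ Gᵇ n₀ n₂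
        J-b n₀ (suc n₂) h = refl
        J-b zero zero h = solve 4 (λ x y z w → con (+ 1) :* x :* y :* con (+ 0) := con (+ 1) :* z :* w :* con (+ 0)) refl _ _ _ _
        J-b (suc i) zero (s≤s h) = begin
          𝟙 ⊗ a ↑ (T ∸ suc (i + 0)) ⊗ b ↑ ρ ⊗ (γ ν i ⊗ (b ⊗ c) ↑ (ν ∸ i) ⊗ (b ⊗ ζ))
            ≡⟨ cong₂ (λ s t → 𝟙 ⊗ s ⊗ b ↑ ρ ⊗ (γ ν i ⊗ t ⊗ (b ⊗ ζ))) (exponent a) (↑-⊗ b c (ν ∸ i)) ⟩
          𝟙 ⊗ (a ⊗ a ↑ ρ ⊗ a ↑ (ν ∸ i)) ⊗ b ↑ ρ ⊗ (γ ν i ⊗ (b ↑ (ν ∸ i) ⊗ c ↑ (ν ∸ i)) ⊗ (b ⊗ ζ))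
            ≡⟨ solve 9 (λ a aρ ai b bρ bi γ ci ζ → con (+ 1) :* (a :* aρ :* ai) :* bρ :* (γ :* (bi :* ci) :* (b :* ζ))
                  := con (+ 1) :* (b :* bρ :* bi) :* aρ :* (γ :* (ai :* ci) :* (a :* ζ))) refl a _ _ b _ _ (γ ν i) (c ↑ (ν ∸ i)) ζ ⟩
          𝟙 ⊗ (b ⊗ b ↑ ρ ⊗ b ↑ (ν ∸ i)) ⊗ a ↑ ρ ⊗ (γ ν i ⊗ (a ↑ (ν ∸ i) ⊗ c ↑ (ν ∸ i)) ⊗ (a ⊗ ζ))
            ≡⟨ cong₂ (λ s t → 𝟙 ⊗ s ⊗ a ↑ ρ ⊗ (γ ν i ⊗ t ⊗ (a ⊗ ζ))) (sym (exponent b)) (sym (↑-⊗ a c (ν ∸ i))) ⟩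
          𝟙 ⊗ b ↑ (T ∸ suc (i + 0)) ⊗ a ↑ ρ ⊗ (γ ν i ⊗ (a ⊗ c) ↑ (ν ∸ i) ⊗ (a ⊗ ζ)) ∎
          where
          open ≡-Reasoning
          eq : T ∸ suc (i + 0) ≡ ν + (ν ∸ i)
          eq = begin
            ν + ν + 1 ∸ suc (i + 0) ≡⟨ cong₂ _∸_ (+-comm (ν + ν) 1) (cong suc (+-identityʳ i)) ⟩
            ν + ν ∸ i ≡⟨ +-∸-assoc ν h ⟩
            ν + (ν ∸ i) ∎
          exponent : ∀ x → x ↑ (T ∸ suc (i + 0)) ≡ x ⊗ x ↑ ρ ⊗ x ↑ (ν ∸ i)
          exponent x = trans (cong (x ↑_) eq) (↑-+ x ν (ν ∸ i))

        newton₁₂ : ∀ n₀ n₁ n₂ → J n₀ n₁ (suc n₂) ≡ J n₀ (suc n₁) (suc n₂) ⊕ J n₀ (suc n₁) n₂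
        newton₁₂ n₀ n₁ n₂ = solve 2 (λ x y → x := x :- y :+ y) refl _ _

        -- Newton's recurrence for nodes at distance a; the factor 2 compensates the smaller power
        -- of 2 in the term with one node abc + a less. The strict bound lets the truncated exponent
        -- of a drop by exactly one.
        newton₀₁-base : ∀ n₀ n₁ → n₀ + suc n₁ < T →
          J n₀ (suc n₁) 0 ≡ a ⊗ J (suc n₀) (suc n₁) 0 ⊕ 𝟚 ⊗ J (suc n₀) n₁ 0
        newton₀₁-base n₀ n₁ h = begin
          𝟚 ↑ suc n₁ ⊗ a ↑ (T ∸ (n₀ + suc n₁)) ⊗ b ↑ ρ ⊗ X
            ≡⟨ cong (λ t → 𝟚 ↑ suc n₁ ⊗ t ⊗ b ↑ ρ ⊗ X) (↑-∸ a h) ⟩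
          𝟚 ↑ suc n₁ ⊗ (a ⊗ a ↑ (T ∸ suc (n₀ + suc n₁))) ⊗ b ↑ ρ ⊗ X
            ≡⟨ solve 6 (λ t a a′ b x y → con (+ 2) :* t :* (a :* a′) :* b :* x
                 := a :* (con (+ 2) :* t :* a′ :* b :* (x :- y)) :+ con (+ 2) :* (t :* (a :* a′) :* b :* y)) refl (𝟚 ↑ n₁) a _ (b ↑ ρ) X Y ⟩
          a ⊗ J (suc n₀) (suc n₁) 0 ⊕ 𝟚 ⊗ (𝟚 ↑ n₁ ⊗ (a ⊗ a ↑ (T ∸ suc (n₀ + suc n₁))) ⊗ b ↑ ρ ⊗ Y)
            ≡⟨ cong (λ t → a ⊗ J (suc n₀) (suc n₁) 0 ⊕ 𝟚 ⊗ (𝟚 ↑ n₁ ⊗ t ⊗ b ↑ ρ ⊗ Y)) eq ⟩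
          a ⊗ J (suc n₀) (suc n₁) 0 ⊕ 𝟚 ⊗ J (suc n₀) n₁ 0 ∎
          where
          open ≡-Reasoning
          X = Gᵃ n₀ (suc n₁)
          Y = Gᵃ (suc n₀) n₁
          eq : a ⊗ a ↑ (T ∸ suc (n₀ + suc n₁)) ≡ a ↑ (T ∸ (suc n₀ + n₁))
          eq = trans (sym (↑-∸ a h)) (cong (λ t → a ↑ (T ∸ t)) (+-suc n₀ n₁))

        newton₀₂-base : ∀ n₀ n₂ → n₀ ≤ ν → n₀ + suc n₂ < T →
          J n₀ 0 (suc n₂) ≡ b ⊗ J (suc n₀) 0 (suc n₂) ⊕ 𝟚 ⊗ J (suc n₀) 0 n₂
        newton₀₂-base n₀ n₂ g h = begin
          𝟚 ↑ suc n₂ ⊗ b ↑ (T ∸ (n₀ + suc n₂)) ⊗ a ↑ ρ ⊗ X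
            ≡⟨ cong (λ t → 𝟚 ↑ suc n₂ ⊗ t ⊗ a ↑ ρ ⊗ X) (↑-∸ b h) ⟩
          𝟚 ↑ suc n₂ ⊗ (b ⊗ b ↑ (T ∸ suc (n₀ + suc n₂))) ⊗ a ↑ ρ ⊗ X
            ≡⟨ solve 6 (λ t a a′ b x y → con (+ 2) :* t :* (a :* a′) :* b :* x
                 := a :* (con (+ 2) :* t :* a′ :* b :* (x :- y)) :+ con (+ 2) :* (t :* (a :* a′) :* b :* y)) refl (𝟚 ↑ n₂) b _ (a ↑ ρ) X Y ⟩
          b ⊗ J (suc n₀) 0 (suc n₂) ⊕ 𝟚 ⊗ (𝟚 ↑ n₂ ⊗ (b ⊗ b ↑ (T ∸ suc (n₀ + suc n₂))) ⊗ a ↑ ρ ⊗ Y)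
            ≡⟨ cong (λ t → b ⊗ J (suc n₀) 0 (suc n₂) ⊕ 𝟚 ⊗ (𝟚 ↑ n₂ ⊗ t ⊗ a ↑ ρ ⊗ Y)) eq ⟩
          b ⊗ J (suc n₀) 0 (suc n₂) ⊕ 𝟚 ⊗ (𝟚 ↑ n₂ ⊗ b ↑ (T ∸ (suc n₀ + n₂)) ⊗ a ↑ ρ ⊗ Y)
            ≡⟨ cong (λ t → b ⊗ J (suc n₀) 0 (suc n₂) ⊕ 𝟚 ⊗ t) (sym (J-b (suc n₀) n₂ (s≤s g))) ⟩
          b ⊗ J (suc n₀) 0 (suc n₂) ⊕ 𝟚 ⊗ J (suc n₀) 0 n₂ ∎
          where
          open ≡-Reasoning
          X = Gᵇ n₀ (suc n₂)
          Y = Gᵇ (suc n₀) n₂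
          eq : b ⊗ b ↑ (T ∸ suc (n₀ + suc n₂)) ≡ b ↑ (T ∸ (suc n₀ + n₂))
          eq = trans (sym (↑-∸ b h)) (cong (λ t → b ↑ (T ∸ t)) (+-suc n₀ n₂))

        newton₀₁ : ∀ n₀ n₁ n₂ → n₀ ≤ ν → n₀ + suc n₁ < T → n₀ + n₂ < T →
          J n₀ (suc n₁) n₂ ≡ a ⊗ J (suc n₀) (suc n₁) n₂ ⊕ 𝟚 ⊗ J (suc n₀) n₁ n₂
        newton₀₁ n₀ n₁ zero g h₁ h₂ = newton₀₁-base n₀ n₁ h₁
        newton₀₁ n₀ zero (suc n₂) g h₁ h₂ = begin
          J n₀ 0 (suc n₂) ⊖ J n₀ 1 n₂
            ≡⟨ cong₂ _⊖_ (newton₀₂-base n₀ n₂ g h₂) (newton₀₁ n₀ 0 n₂ g h₁ (<-trans (+-monoʳ-< n₀ (n<1+n n₂)) h₂)) ⟩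
          (a ⊕ 𝟚) ⊗ x ⊕ 𝟚 ⊗ y ⊖ (a ⊗ z ⊕ 𝟚 ⊗ y)
            ≡⟨ solve 4 (λ a x y z → (a :+ con (+ 2)) :* x :+ con (+ 2) :* y :- (a :* z :+ con (+ 2) :* y) := a :* (x :- z) :+ con (+ 2) :* x) refl a x y z ⟩
          a ⊗ (x ⊖ z) ⊕ 𝟚 ⊗ x ∎
          where
          open ≡-Reasoning
          x = J (suc n₀) 0 (suc n₂)
          y = J (suc n₀) 0 n₂
          z = J (suc n₀) 1 n₂
        newton₀₁ n₀ (suc n₁) (suc n₂) g h₁ h₂ = begin
          J n₀ (suc n₁) (suc n₂) ⊖ J n₀ (suc (suc n₁)) n₂
            ≡⟨ cong₂ _⊖_ (newton₀₁ n₀ n₁ (suc n₂) g (<-trans (+-monoʳ-< n₀ (n<1+n (suc n₁))) h₁) h₂)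
                 (newton₀₁ n₀ (suc n₁) n₂ g h₁ (<-trans (+-monoʳ-< n₀ (n<1+n n₂)) h₂)) ⟩
          a ⊗ x ⊕ 𝟚 ⊗ y ⊖ (a ⊗ z ⊕ 𝟚 ⊗ w)
            ≡⟨ solve 5 (λ a x y z w → a :* x :+ con (+ 2) :* y :- (a :* z :+ con (+ 2) :* w) := a :* (x :- z) :+ con (+ 2) :* (y :- w)) refl a x y z w ⟩
          a ⊗ (x ⊖ z) ⊕ 𝟚 ⊗ (y ⊖ w) ∎
          where
          open ≡-Reasoning
          x = J (suc n₀) (suc n₁) (suc n₂)
          y = J (suc n₀) n₁ (suc n₂)
          z = J (suc n₀) (suc (suc n₁)) n₂
          w = J (suc n₀) (suc n₁) n₂

        newton₀₂ : ∀ n₀ n₁ n₂ → n₀ ≤ ν → n₀ + n₁ < T → n₀ + suc n₂ < T →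
          J n₀ n₁ (suc n₂) ≡ b ⊗ J (suc n₀) n₁ (suc n₂) ⊕ 𝟚 ⊗ J (suc n₀) n₁ n₂
        newton₀₂ n₀ zero n₂ g h₁ h₂ = newton₀₂-base n₀ n₂ g h₂
        newton₀₂ n₀ (suc n₁) zero g h₁ h₂ = begin
          J n₀ n₁ 1 ⊖ J n₀ (suc n₁) 0
            ≡⟨ cong₂ _⊖_ (newton₀₂ n₀ n₁ 0 g (<-trans (+-monoʳ-< n₀ (n<1+n n₁)) h₁) h₂) (newton₀₁-base n₀ n₁ h₁) ⟩
          (a ⊕ 𝟚) ⊗ x ⊕ 𝟚 ⊗ y ⊖ (a ⊗ z ⊕ 𝟚 ⊗ y)
            ≡⟨ solve 4 (λ a x y z → (a :+ con (+ 2)) :* x :+ con (+ 2) :* y :- (a :* z :+ con (+ 2) :* y)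
                 := (a :+ con (+ 2)) :* (x :- z) :+ con (+ 2) :* z) refl a x y z ⟩
          b ⊗ (x ⊖ z) ⊕ 𝟚 ⊗ z ∎
          where
          open ≡-Reasoning
          x = J (suc n₀) n₁ 1
          y = J (suc n₀) n₁ 0
          z = J (suc n₀) (suc n₁) 0
        newton₀₂ n₀ (suc n₁) (suc n₂) g h₁ h₂ = begin
          J n₀ n₁ (suc (suc n₂)) ⊖ J n₀ (suc n₁) (suc n₂)
            ≡⟨ cong₂ _⊖_ (newton₀₂ n₀ n₁ (suc n₂) g (<-trans (+-monoʳ-< n₀ (n<1+n n₁)) h₁) h₂)
                 (newton₀₂ n₀ (suc n₁) n₂ g h₁ (<-trans (+-monoʳ-< n₀ (n<1+n (suc n₂))) h₂)) ⟩
          b ⊗ x ⊕ 𝟚 ⊗ y ⊖ (b ⊗ z ⊕ 𝟚 ⊗ w)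
            ≡⟨ solve 5 (λ a x y z w → a :* x :+ con (+ 2) :* y :- (a :* z :+ con (+ 2) :* w) := a :* (x :- z) :+ con (+ 2) :* (y :- w)) refl b x y z w ⟩
          b ⊗ (x ⊖ z) ⊕ 𝟚 ⊗ (y ⊖ w) ∎
          where
          open ≡-Reasoning
          x = J (suc n₀) n₁ (suc (suc n₂))
          y = J (suc n₀) n₁ (suc n₂)
          z = J (suc n₀) (suc n₁) (suc n₂)
          w = J (suc n₀) (suc n₁) n₂

        -- Twice the nodes abc, abc + a, abc + b. For the last two the factor 2 is supplied by `J`,
        -- whose power of 2 rises with n₁ and n₂.
        u₀ u₁ u₂ : Carrier
        u₀ = 𝟚 ⊗ (a ⊗ b ⊗ c)
        u₁ = a ⊗ (b ⊗ c ⊕ 𝟙)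
        u₂ = b ⊗ (a ⊗ c ⊕ 𝟙)

        -- Euler's identity: the divided differences of τ^(ν + 1/2) are homogeneous in the nodes.
        Euler : ℕ → ℕ → ℕ → Set
        Euler n₀ n₁ n₂ =
          u₀ ⊗ ⟨ n₀ ⟩ ⊗ J (suc n₀) n₁ n₂ ⊕ u₁ ⊗ ⟨ n₁ ⟩ ⊗ J n₀ (suc n₁) n₂ ⊕ u₂ ⊗ ⟨ n₂ ⟩ ⊗ J n₀ n₁ (suc n₂)
            ≡ weight ν (n₀ + n₁ + n₂) ⊗ J n₀ n₁ n₂

        -- If nodes i and j are different, Newton's recurrence writes everything with both of them
        -- as a difference of terms lacking one. So subtract μ times the identity without the node j
        -- from the identity without the node i: the result is δ times the wanted identity. The
        -- relation of uᵢ and uⱼ leaves the remainder -2δ X, which lowers the weight by 2.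
        euler-step : ∀ {δ μ uⱼ uₛ p q s e Jᵢᵢⱼ Jᵢᵢ Jᵢⱼⱼ Jᵢⱼₛ Jᵢₛ Jᵢ X Jⱼⱼ Jⱼₛ Jⱼ uᵢ} → 1 ≤ N δ →
          uᵢ ≡ μ ⊗ uⱼ ⊖ 𝟚 ⊗ δ → X ≡ δ ⊗ Jᵢᵢⱼ ⊕ μ ⊗ Jᵢᵢ → Jⱼⱼ ≡ δ ⊗ Jᵢⱼⱼ ⊕ μ ⊗ X →
          Jⱼₛ ≡ δ ⊗ Jᵢⱼₛ ⊕ μ ⊗ Jᵢₛ → Jⱼ ≡ δ ⊗ X ⊕ μ ⊗ Jᵢ →
          uᵢ ⊗ p ⊗ X ⊕ uⱼ ⊗ (𝟙 ⊕ q) ⊗ Jⱼⱼ ⊕ uₛ ⊗ s ⊗ Jⱼₛ ≡ e ⊗ Jⱼ →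
          uᵢ ⊗ (𝟙 ⊕ p) ⊗ Jᵢᵢ ⊕ uⱼ ⊗ q ⊗ X ⊕ uₛ ⊗ s ⊗ Jᵢₛ ≡ e ⊗ Jᵢ →
          uᵢ ⊗ (𝟙 ⊕ p) ⊗ Jᵢᵢⱼ ⊕ uⱼ ⊗ (𝟙 ⊕ q) ⊗ Jᵢⱼⱼ ⊕ uₛ ⊗ s ⊗ Jᵢⱼₛ ≡ (e ⊖ 𝟚) ⊗ X
        euler-step {δ} {μ} {uⱼ} {uₛ} {p} {q} {s} {e} {Jᵢᵢⱼ} {Jᵢᵢ} {Jᵢⱼⱼ} {Jᵢⱼₛ} {Jᵢₛ} {Jᵢ} {X} {Jⱼⱼ} {Jⱼₛ} {Jⱼ} {uᵢ} δ>0 hu hX refl refl refl Eⱼ Eᵢ =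
          ⊗-cancelˡ δ>0 (begin
            δ ⊗ (uᵢ ⊗ (𝟙 ⊕ p) ⊗ Jᵢᵢⱼ ⊕ uⱼ ⊗ (𝟙 ⊕ q) ⊗ Jᵢⱼⱼ ⊕ uₛ ⊗ s ⊗ Jᵢⱼₛ)
              ≡⟨ solve 9 (λ δ uᵢ uⱼ p q Jᵢᵢⱼ Jᵢⱼⱼ Jᵢⱼₛ us →
                    δ :* (uᵢ :* (con (+ 1) :+ p) :* Jᵢᵢⱼ :+ uⱼ :* (con (+ 1) :+ q) :* Jᵢⱼⱼ :+ us :* Jᵢⱼₛ)
                    := uᵢ :* (con (+ 1) :+ p) :* (δ :* Jᵢᵢⱼ) :+ uⱼ :* (con (+ 1) :+ q) :* (δ :* Jᵢⱼⱼ) :+ us :* (δ :* Jᵢⱼₛ))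
                   refl δ uᵢ uⱼ p q Jᵢᵢⱼ Jᵢⱼⱼ Jᵢⱼₛ (uₛ ⊗ s) ⟩
            uᵢ ⊗ (𝟙 ⊕ p) ⊗ (δ ⊗ Jᵢᵢⱼ) ⊕ uⱼ ⊗ (𝟙 ⊕ q) ⊗ (δ ⊗ Jᵢⱼⱼ) ⊕ uₛ ⊗ s ⊗ (δ ⊗ Jᵢⱼₛ)
              ≡⟨ cong (λ t → uᵢ ⊗ (𝟙 ⊕ p) ⊗ t ⊕ uⱼ ⊗ (𝟙 ⊕ q) ⊗ (δ ⊗ Jᵢⱼⱼ) ⊕ uₛ ⊗ s ⊗ (δ ⊗ Jᵢⱼₛ)) hX′ ⟩
            uᵢ ⊗ (𝟙 ⊕ p) ⊗ (X ⊖ μ ⊗ Jᵢᵢ) ⊕ uⱼ ⊗ (𝟙 ⊕ q) ⊗ (δ ⊗ Jᵢⱼⱼ) ⊕ uₛ ⊗ s ⊗ (δ ⊗ Jᵢⱼₛ)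
              ≡⟨ solve 11 (λ uᵢ p X μ Jᵢᵢ uⱼ q Y us Z W →
                   uᵢ :* (con (+ 1) :+ p) :* (X :- μ :* Jᵢᵢ) :+ uⱼ :* (con (+ 1) :+ q) :* Y :+ us :* Z
                   := (uᵢ :* p :* X :+ uⱼ :* (con (+ 1) :+ q) :* (Y :+ μ :* X) :+ us :* (Z :+ μ :* W))
                    :- μ :* (uᵢ :* (con (+ 1) :+ p) :* Jᵢᵢ :+ uⱼ :* q :* X :+ us :* W) :+ (uᵢ :- μ :* uⱼ) :* X)
                   refl uᵢ p X μ Jᵢᵢ uⱼ q (δ ⊗ Jᵢⱼⱼ) (uₛ ⊗ s) (δ ⊗ Jᵢⱼₛ) Jᵢₛ ⟩
            (uᵢ ⊗ p ⊗ X ⊕ uⱼ ⊗ (𝟙 ⊕ q) ⊗ (δ ⊗ Jᵢⱼⱼ ⊕ μ ⊗ X) ⊕ uₛ ⊗ s ⊗ (δ ⊗ Jᵢⱼₛ ⊕ μ ⊗ Jᵢₛ))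
              ⊖ μ ⊗ (uᵢ ⊗ (𝟙 ⊕ p) ⊗ Jᵢᵢ ⊕ uⱼ ⊗ q ⊗ X ⊕ uₛ ⊗ s ⊗ Jᵢₛ) ⊕ (uᵢ ⊖ μ ⊗ uⱼ) ⊗ X
              ≡⟨ cong₂ _⊕_ (cong₂ (λ x y → x ⊖ μ ⊗ y) Eⱼ Eᵢ) (cong (λ t → (t ⊖ μ ⊗ uⱼ) ⊗ X) hu) ⟩
            e ⊗ (δ ⊗ X ⊕ μ ⊗ Jᵢ) ⊖ μ ⊗ (e ⊗ Jᵢ) ⊕ (μ ⊗ uⱼ ⊖ 𝟚 ⊗ δ ⊖ μ ⊗ uⱼ) ⊗ X
              ≡⟨ solve 6 (λ e δ X μ J u → e :* (δ :* X :+ μ :* J) :- μ :* (e :* J) :+ (μ :* u :- con (+ 2) :* δ :- μ :* u) :* X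
                   := δ :* ((e :- con (+ 2)) :* X)) refl e δ X μ Jᵢ uⱼ ⟩
            δ ⊗ ((e ⊖ 𝟚) ⊗ X) ∎)
          where
          open ≡-Reasoning
          hX′ : δ ⊗ Jᵢᵢⱼ ≡ X ⊖ μ ⊗ Jᵢᵢ
          hX′ = trans (solve 2 (λ x y → x := x :+ y :- y) refl (δ ⊗ Jᵢᵢⱼ) (μ ⊗ Jᵢᵢ)) (cong (_⊖ μ ⊗ Jᵢᵢ) (sym hX))

        euler-step′ : ∀ {δ μ uⱼ uₛ s e Jᵢᵢⱼ Jᵢᵢ Jᵢⱼⱼ Jᵢⱼₛ Jᵢₛ Jᵢ X Jⱼⱼ Jⱼₛ Jⱼ uᵢ} (p q : ℕ) → 1 ≤ N δ →
          uᵢ ≡ μ ⊗ uⱼ ⊖ 𝟚 ⊗ δ → X ≡ δ ⊗ Jᵢᵢⱼ ⊕ μ ⊗ Jᵢᵢ → Jⱼⱼ ≡ δ ⊗ Jᵢⱼⱼ ⊕ μ ⊗ X →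
          Jⱼₛ ≡ δ ⊗ Jᵢⱼₛ ⊕ μ ⊗ Jᵢₛ → Jⱼ ≡ δ ⊗ X ⊕ μ ⊗ Jᵢ →
          uᵢ ⊗ ⟨ p ⟩ ⊗ X ⊕ uⱼ ⊗ ⟨ suc q ⟩ ⊗ Jⱼⱼ ⊕ uₛ ⊗ s ⊗ Jⱼₛ ≡ e ⊗ Jⱼ →
          uᵢ ⊗ ⟨ suc p ⟩ ⊗ Jᵢᵢ ⊕ uⱼ ⊗ ⟨ q ⟩ ⊗ X ⊕ uₛ ⊗ s ⊗ Jᵢₛ ≡ e ⊗ Jᵢ →
          uᵢ ⊗ ⟨ suc p ⟩ ⊗ Jᵢᵢⱼ ⊕ uⱼ ⊗ ⟨ suc q ⟩ ⊗ Jᵢⱼⱼ ⊕ uₛ ⊗ s ⊗ Jᵢⱼₛ ≡ (e ⊖ 𝟚) ⊗ X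
        euler-step′ p q rewrite ⟨suc⟩ p | ⟨suc⟩ q = euler-step

        ≤ν⇒<T : ∀ {i j} → i ≤ ν → j ≤ ν → i + j < T
        ≤ν⇒<T h g = ≤-<-trans (+-mono-≤ h g) (subst (ν + ν <_) (+-comm 1 (ν + ν)) (n<1+n (ν + ν)))

        <ν⇒<T : ∀ {i j} → suc i ≤ ν → suc j ≤ ν → i + suc (suc j) < T
        <ν⇒<T {i} {j} h g = subst (_< T) (sym (+-suc i (suc j))) (≤ν⇒<T h g)

        -- With all nodes at one point, Euler's identity is the recurrence of the derivatives of a
        -- power of τ, that is `γ-suc`; the rest is bookkeeping of the scaling factors.
        euler-axis : ∀ {x y z w g g′ X} n → 𝟚 ⊗ ⟨ suc n ⟩ ⊗ g′ ≡ weight ν (suc n) ⊗ g →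
          𝟚 ⊗ (x ⊗ y) ⊗ ⟨ suc n ⟩ ⊗ (z ⊗ (g′ ⊗ w ⊗ X)) ≡ weight ν (suc n) ⊗ (x ⊗ z ⊗ (g ⊗ (y ⊗ w) ⊗ X))
        euler-axis {x} {y} {z} {w} {g} {g′} {X} n h = begin
          𝟚 ⊗ (x ⊗ y) ⊗ ⟨ suc n ⟩ ⊗ (z ⊗ (g′ ⊗ w ⊗ X))
            ≡⟨ solve 7 (λ x y z w g X n → con (+ 2) :* (x :* y) :* n :* (z :* (g :* w :* X)) := con (+ 2) :* n :* g :* (x :* z :* y :* w :* X))
                 refl x y z w g′ X ⟨ suc n ⟩ ⟩
          𝟚 ⊗ ⟨ suc n ⟩ ⊗ g′ ⊗ (x ⊗ z ⊗ y ⊗ w ⊗ X) ≡⟨ cong (_⊗ (x ⊗ z ⊗ y ⊗ w ⊗ X)) h ⟩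
          weight ν (suc n) ⊗ g ⊗ (x ⊗ z ⊗ y ⊗ w ⊗ X)
            ≡⟨ solve 7 (λ x y z w g X v → v :* g :* (x :* z :* y :* w :* X) := v :* (x :* z :* (g :* (y :* w) :* X))) refl x y z w g X (weight ν (suc n)) ⟩
          weight ν (suc n) ⊗ (x ⊗ z ⊗ (g ⊗ (y ⊗ w) ⊗ X)) ∎
          where open ≡-Reasoning

        euler₀ : ∀ n → n < ν → Euler (suc n) 0 0
        euler₀ n h = begin
          u₀ ⊗ ⟨ suc n ⟩ ⊗ (𝟙 ⊗ a′ ⊗ b ↑ ρ ⊗ (γ ν (suc n) ⊗ m ⊗ (b ⊗ ζ))) ⊕ u₁ ⊗ ⟨ 0 ⟩ ⊗ J (suc n) 1 0 ⊕ u₂ ⊗ ⟨ 0 ⟩ ⊗ J (suc n) 0 1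
            ≡⟨ solve 13 (λ a b c n a′ r γ m ζ u₁ X u₂ Y →
                 con (+ 2) :* (a :* b :* c) :* n :* (con (+ 1) :* a′ :* r :* (γ :* m :* ζ)) :+ u₁ :* con (+ 0) :* X :+ u₂ :* con (+ 0) :* Y
                 := con (+ 2) :* (a :* (b :* c)) :* n :* (a′ :* r :* (γ :* m :* ζ))) refl a b c _ a′ _ _ m _ u₁ _ u₂ _ ⟩
          𝟚 ⊗ (a ⊗ (b ⊗ c)) ⊗ ⟨ suc n ⟩ ⊗ (a′ ⊗ b ↑ ρ ⊗ (γ ν (suc n) ⊗ m ⊗ (b ⊗ ζ))) ≡⟨ euler-axis n (γ-suc ν n h) ⟩
          weight ν (suc n) ⊗ (a ⊗ (a′ ⊗ b ↑ ρ) ⊗ (γ ν n ⊗ (b ⊗ c ⊗ m) ⊗ (b ⊗ ζ)))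
            ≡⟨ cong₂ (λ s t → weight ν s ⊗ t) (trans (sym (+-identityʳ (suc n))) (cong (_+ 0) (sym (+-identityʳ (suc n)))))
                 (trans (solve 4 (λ a x y z → a :* (x :* y) :* z := con (+ 1) :* (a :* x) :* y :* z) refl a a′ _ _)
                 (cong₂ (λ s t → 𝟙 ⊗ s ⊗ b ↑ ρ ⊗ (γ ν n ⊗ t ⊗ (b ⊗ ζ))) (sym (↑-∸ a (≤ν⇒<T h z≤n))) (sym (↑-∸ (b ⊗ c) h)))) ⟩
          weight ν (suc n + 0 + 0) ⊗ J (suc n) 0 0 ∎
          where
          open ≡-Reasoning
          a′ = a ↑ (T ∸ suc (suc n + 0))
          m = (b ⊗ c) ↑ (ν ∸ suc n)

        euler₁ : ∀ n → n < ν → Euler 0 (suc n) 0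
        euler₁ n h = begin
          u₀ ⊗ ⟨ 0 ⟩ ⊗ J 1 (suc n) 0 ⊕ u₁ ⊗ ⟨ suc n ⟩ ⊗ (𝟚 ⊗ 𝟚 ↑ suc n ⊗ a′ ⊗ b ↑ ρ ⊗ (γ ν (suc n) ⊗ m ⊗ η₁)) ⊕ u₂ ⊗ ⟨ 0 ⟩ ⊗ J 0 (suc n) 1
            ≡⟨ solve 13 (λ a μ t n a′ r γ m η u₀ X u₂ Y →
                 u₀ :* con (+ 0) :* X :+ a :* μ :* n :* (con (+ 2) :* t :* a′ :* r :* (γ :* m :* η)) :+ u₂ :* con (+ 0) :* Y
                 := con (+ 2) :* (a :* μ) :* n :* (t :* a′ :* r :* (γ :* m :* η))) refl a (b ⊗ c ⊕ 𝟙) _ _ a′ _ _ m _ u₀ _ u₂ _ ⟩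
          𝟚 ⊗ (a ⊗ (b ⊗ c ⊕ 𝟙)) ⊗ ⟨ suc n ⟩ ⊗ (𝟚 ↑ suc n ⊗ a′ ⊗ b ↑ ρ ⊗ (γ ν (suc n) ⊗ m ⊗ η₁)) ≡⟨ euler-axis n (γ-suc ν n h) ⟩
          weight ν (suc n) ⊗ (a ⊗ (𝟚 ↑ suc n ⊗ a′ ⊗ b ↑ ρ) ⊗ (γ ν n ⊗ ((b ⊗ c ⊕ 𝟙) ⊗ m) ⊗ η₁))
            ≡⟨ cong₂ (λ s t → weight ν s ⊗ t) (sym (+-identityʳ (suc n)))
                 (trans (solve 5 (λ a t x y z → a :* (t :* x :* y) :* z := t :* (a :* x) :* y :* z) refl a _ a′ _ _)
                 (cong₂ (λ s t → 𝟚 ↑ suc n ⊗ s ⊗ b ↑ ρ ⊗ (γ ν n ⊗ t ⊗ η₁)) (sym (↑-∸ a (≤ν⇒<T z≤n h))) (sym (↑-∸ (b ⊗ c ⊕ 𝟙) h)))) ⟩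
          weight ν (suc n + 0) ⊗ J 0 (suc n) 0 ∎
          where
          open ≡-Reasoning
          a′ = a ↑ (T ∸ suc (suc n))
          m = (b ⊗ c ⊕ 𝟙) ↑ (ν ∸ suc n)

        euler₂ : ∀ n → n < ν → Euler 0 0 (suc n)
        euler₂ n h = begin
          u₀ ⊗ ⟨ 0 ⟩ ⊗ J 1 0 (suc n) ⊕ u₁ ⊗ ⟨ 0 ⟩ ⊗ J 0 1 (suc n) ⊕ u₂ ⊗ ⟨ suc n ⟩ ⊗ (𝟚 ⊗ 𝟚 ↑ suc n ⊗ b′ ⊗ a ↑ ρ ⊗ (γ ν (suc n) ⊗ m ⊗ η₂))
            ≡⟨ solve 13 (λ a μ t n a′ r γ m η u₀ X u₁ Y →
                 u₀ :* con (+ 0) :* X :+ u₁ :* con (+ 0) :* Y :+ a :* μ :* n :* (con (+ 2) :* t :* a′ :* r :* (γ :* m :* η))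
                 := con (+ 2) :* (a :* μ) :* n :* (t :* a′ :* r :* (γ :* m :* η))) refl b (a ⊗ c ⊕ 𝟙) _ _ b′ _ _ m _ u₀ _ u₁ _ ⟩
          𝟚 ⊗ (b ⊗ (a ⊗ c ⊕ 𝟙)) ⊗ ⟨ suc n ⟩ ⊗ (𝟚 ↑ suc n ⊗ b′ ⊗ a ↑ ρ ⊗ (γ ν (suc n) ⊗ m ⊗ η₂)) ≡⟨ euler-axis n (γ-suc ν n h) ⟩
          weight ν (suc n) ⊗ (b ⊗ (𝟚 ↑ suc n ⊗ b′ ⊗ a ↑ ρ) ⊗ (γ ν n ⊗ ((a ⊗ c ⊕ 𝟙) ⊗ m) ⊗ η₂))
            ≡⟨ cong (weight ν (suc n) ⊗_)
                 (trans (solve 5 (λ a t x y z → a :* (t :* x :* y) :* z := t :* (a :* x) :* y :* z) refl b _ b′ _ _)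
                 (cong₂ (λ s t → 𝟚 ↑ suc n ⊗ s ⊗ a ↑ ρ ⊗ (γ ν n ⊗ t ⊗ η₂)) (sym (↑-∸ b (≤ν⇒<T z≤n h))) (sym (↑-∸ (a ⊗ c ⊕ 𝟙) h)))) ⟩
          weight ν (suc n) ⊗ J 0 0 (suc n) ∎
          where
          open ≡-Reasoning
          b′ = b ↑ (T ∸ suc (suc n))
          m = (a ⊗ c ⊕ 𝟙) ↑ (ν ∸ suc n)

        module Nonzero (a>0 : 1 ≤ N a) (b>0 : 1 ≤ N b) where

          euler : ∀ n₀ n₁ n₂ → n₀ ≤ ν → n₁ ≤ ν → n₂ ≤ ν → 1 ≤ n₀ + n₁ + n₂ → Euler n₀ n₁ n₂
          euler (suc n) zero zero h₀ h₁ h₂ h = euler₀ n h₀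
          euler zero (suc n) zero h₀ h₁ h₂ h = euler₁ n h₁
          euler zero zero (suc n) h₀ h₁ h₂ h = euler₂ n h₂
          euler (suc i) (suc j) zero h₀ h₁ h₂ h = begin
            u₀ ⊗ ⟨ suc i ⟩ ⊗ _ ⊕ u₁ ⊗ ⟨ suc j ⟩ ⊗ _ ⊕ u₂ ⊗ ⟨ 0 ⟩ ⊗ _
              ≡⟨ euler-step′ i j a>0 (solve 2 (λ a c → con (+ 2) :* (a :* (a :+ con (+ 2)) :* c)
                     := con (+ 2) :* (a :* ((a :+ con (+ 2)) :* c :+ con (+ 1))) :- con (+ 2) :* a) refl a c)
                   (newton₀₁ (suc i) j 0 h₀ (≤ν⇒<T h₀ h₁) (≤ν⇒<T h₀ h₂)) (newton₀₁ i (suc j) 0 (<⇒≤ h₀) (<ν⇒<T h₀ h₁) (≤ν⇒<T (<⇒≤ h₀) h₂))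
                   (newton₀₁ i j 1 (<⇒≤ h₀) (≤ν⇒<T (<⇒≤ h₀) h₁) (≤ν⇒<T (<⇒≤ h₀) (s≤s z≤n))) (newton₀₁ i j 0 (<⇒≤ h₀) (≤ν⇒<T (<⇒≤ h₀) h₁) (≤ν⇒<T (<⇒≤ h₀) h₂))

                   (euler i (suc j) 0 (<⇒≤ h₀) h₁ h₂ (m≤n⇒m≤n+o 0 (m≤n⇒m≤o+n i (s≤s z≤n))))

                   (trans (euler (suc i) j 0 h₀ (<⇒≤ h₁) h₂ (s≤s z≤n)) (cong (λ t → weight ν (t + 0) ⊗ J (suc i) j 0) (sym (+-suc i j)))) ⟩
            (weight ν (i + suc j + 0) ⊖ 𝟚) ⊗ J (suc i) (suc j) 0 ≡⟨ cong (_⊗ J (suc i) (suc j) 0) (sym (weight-suc ν (i + suc j + 0))) ⟩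
            weight ν (suc i + suc j + 0) ⊗ J (suc i) (suc j) 0 ∎
            where open ≡-Reasoning
          euler (suc i) zero (suc l) h₀ h₁ h₂ h = begin
            u₀ ⊗ ⟨ suc i ⟩ ⊗ _ ⊕ u₁ ⊗ ⟨ 0 ⟩ ⊗ _ ⊕ u₂ ⊗ ⟨ suc l ⟩ ⊗ _
              ≡⟨ swap _ _ _ ⟩
            u₀ ⊗ ⟨ suc i ⟩ ⊗ _ ⊕ u₂ ⊗ ⟨ suc l ⟩ ⊗ _ ⊕ u₁ ⊗ ⟨ 0 ⟩ ⊗ _
              ≡⟨ euler-step′ i l b>0 (solve 2 (λ a c → con (+ 2) :* (a :* (a :+ con (+ 2)) :* c)
                     := con (+ 2) :* ((a :+ con (+ 2)) :* (a :* c :+ con (+ 1))) :- con (+ 2) :* (a :+ con (+ 2))) refl a c)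
                   (newton₀₂ (suc i) 0 l h₀ (≤ν⇒<T h₀ h₁) (≤ν⇒<T h₀ h₂)) (newton₀₂ i 0 (suc l) (<⇒≤ h₀) (≤ν⇒<T (<⇒≤ h₀) h₁) (<ν⇒<T h₀ h₂))
                   (newton₀₂ i 1 l (<⇒≤ h₀) (≤ν⇒<T (<⇒≤ h₀) (s≤s z≤n)) (≤ν⇒<T (<⇒≤ h₀) h₂)) (newton₀₂ i 0 l (<⇒≤ h₀) (≤ν⇒<T (<⇒≤ h₀) h₁) (≤ν⇒<T (<⇒≤ h₀) h₂))
                   (trans (swap _ _ _)
                     (euler i 0 (suc l) (<⇒≤ h₀) h₁ h₂ (m≤n⇒m≤o+n (i + 0) (s≤s z≤n))))
                   (trans (swap _ _ _)
                     (trans (euler (suc i) 0 l h₀ h₁ (<⇒≤ h₂) (s≤s z≤n)) (cong (λ t → weight ν t ⊗ J (suc i) 0 l) (sym (+-suc (i + 0) l))))) ⟩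
            (weight ν (i + 0 + suc l) ⊖ 𝟚) ⊗ J (suc i) 0 (suc l) ≡⟨ cong (_⊗ J (suc i) 0 (suc l)) (sym (weight-suc ν (i + 0 + suc l))) ⟩
            weight ν (suc i + 0 + suc l) ⊗ J (suc i) 0 (suc l) ∎
            where
            open ≡-Reasoning
            swap : ∀ x y z → x ⊕ y ⊕ z ≡ x ⊕ z ⊕ y
            swap x y z = solve 3 (λ x y z → x :+ y :+ z := x :+ z :+ y) refl x y z
          euler n₀ (suc j) (suc l) h₀ h₁ h₂ h = begin
            u₀ ⊗ ⟨ n₀ ⟩ ⊗ _ ⊕ u₁ ⊗ ⟨ suc j ⟩ ⊗ _ ⊕ u₂ ⊗ ⟨ suc l ⟩ ⊗ _
              ≡⟨ rotate _ _ _ ⟩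
            u₁ ⊗ ⟨ suc j ⟩ ⊗ _ ⊕ u₂ ⊗ ⟨ suc l ⟩ ⊗ _ ⊕ u₀ ⊗ ⟨ n₀ ⟩ ⊗ _
              ≡⟨ euler-step′ j l (≤-reflexive (sym N-𝟙)) (solve 2 (λ a c → a :* ((a :+ con (+ 2)) :* c :+ con (+ 1))
                     := con (+ 1) :* ((a :+ con (+ 2)) :* (a :* c :+ con (+ 1))) :- con (+ 2) :* con (+ 1)) refl a c)
                   (newton n₀ (suc j) l) (newton n₀ j (suc l)) (newton (suc n₀) j l) (newton n₀ j l)
                   (trans (sym (rotate _ _ _))
                     (euler n₀ j (suc l) h₀ (<⇒≤ h₁) h₂ (m≤n⇒m≤o+n (n₀ + j) (s≤s z≤n))))
                   (trans (sym (rotate _ _ _))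
                     (trans (euler n₀ (suc j) l h₀ h₁ (<⇒≤ h₂) (m≤n⇒m≤n+o l (m≤n⇒m≤o+n n₀ (s≤s z≤n))))
                       (cong (λ t → weight ν t ⊗ J n₀ (suc j) l) (trans (cong (_+ l) (+-suc n₀ j)) (sym (+-suc (n₀ + j) l)))))) ⟩
            (weight ν (n₀ + j + suc l) ⊖ 𝟚) ⊗ J n₀ (suc j) (suc l) ≡⟨ cong (_⊗ J n₀ (suc j) (suc l)) (sym (weight-suc ν (n₀ + j + suc l))) ⟩
            weight ν (suc (n₀ + j + suc l)) ⊗ J n₀ (suc j) (suc l) ≡⟨ cong (λ t → weight ν (t + suc l) ⊗ J n₀ (suc j) (suc l)) (sym (+-suc n₀ j)) ⟩
            weight ν (n₀ + suc j + suc l) ⊗ J n₀ (suc j) (suc l) ∎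
            where
            open ≡-Reasoning
            rotate : ∀ x y z → x ⊕ y ⊕ z ≡ y ⊕ z ⊕ x
            rotate x y z = solve 3 (λ x y z → x :+ y :+ z := y :+ z :+ x) refl x y z
            newton : ∀ n₀ n₁ n₂ → J n₀ n₁ (suc n₂) ≡ 𝟙 ⊗ J n₀ (suc n₁) (suc n₂) ⊕ 𝟙 ⊗ J n₀ (suc n₁) n₂
            newton n₀ n₁ n₂ = solve 2 (λ x y → x := con (+ 1) :* (x :- y) :+ con (+ 1) :* y) refl _ _

          N-weight>0 : ∀ n → 1 ≤ N (weight ν n)
          N-weight>0 n = N>0 λ h → odd≢0 ν n (ℤ.∣i∣≡0⇒i≡0 (m*m≡0⇒m≡0 _ (begin
            _ ≡⟨ sym (N-ι _) ⟩
            N (ι (+ 2 ℤ.* + ν ℤ.+ + 3 ℤ.- + 2 ℤ.* + n)) ≡⟨ cong N (trans (ι-+ _ _) (cong₂ _⊕_ (trans (ι-+ _ _) (cong (_⊕ ι (+ 3)) (ι-* _ _)))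
                (trans (ι-neg _) (cong neg (ι-* _ _))))) ⟩
            N (weight ν n) ≡⟨ cong N h ⟩
            N 𝟘 ≡⟨ N-𝟘 ⟩
            0 ∎)))
            where
            open ≡-Reasoning
            m*m≡0⇒m≡0 : ∀ m → m * m ≡ 0 → m ≡ 0
            m*m≡0⇒m≡0 zero _ = refl

          euler-zero : ∀ n₀ n₁ n₂ → n₀ ≤ ν → n₁ ≤ ν → n₂ ≤ ν → 1 ≤ n₀ + n₁ + n₂ →
            J (suc n₀) n₁ n₂ ≡ 𝟘 → J n₀ (suc n₁) n₂ ≡ 𝟘 → J n₀ n₁ (suc n₂) ≡ 𝟘 → J n₀ n₁ n₂ ≡ 𝟘
          euler-zero n₀ n₁ n₂ h₀ h₁ h₂ h z₀ z₁ z₂ = ⊗-cancel (N-weight>0 (n₀ + n₁ + n₂)) (begin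
            weight ν (n₀ + n₁ + n₂) ⊗ J n₀ n₁ n₂ ≡⟨ sym (euler n₀ n₁ n₂ h₀ h₁ h₂ h) ⟩
            x ⊗ J (suc n₀) n₁ n₂ ⊕ y ⊗ J n₀ (suc n₁) n₂ ⊕ z ⊗ J n₀ n₁ (suc n₂)
              ≡⟨ cong₂ _⊕_ (cong₂ (λ s t → x ⊗ s ⊕ y ⊗ t) z₀ z₁) (cong (z ⊗_) z₂) ⟩
            x ⊗ 𝟘 ⊕ y ⊗ 𝟘 ⊕ z ⊗ 𝟘 ≡⟨ solve 3 (λ x y z → x :* con (+ 0) :+ y :* con (+ 0) :+ z :* con (+ 0) := con (+ 0)) refl x y z ⟩
            𝟘 ∎)
            where
            open ≡-Reasoning
            x = u₀ ⊗ ⟨ n₀ ⟩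
            y = u₁ ⊗ ⟨ n₁ ⟩
            z = u₂ ⊗ ⟨ n₂ ⟩

          zero-combination : ∀ {x y z δ μ} → x ≡ δ ⊗ y ⊕ μ ⊗ z → y ≡ 𝟘 → z ≡ 𝟘 → x ≡ 𝟘
          zero-combination {δ = δ} {μ} refl refl refl = solve 2 (λ δ μ → δ :* con (+ 0) :+ μ :* con (+ 0) := con (+ 0)) refl δ μ

          zero-component : ∀ {x y z δ μ} → 1 ≤ N μ → x ≡ δ ⊗ y ⊕ μ ⊗ z → x ≡ 𝟘 → y ≡ 𝟘 → z ≡ 𝟘
          zero-component {x} {y} {z} {δ} {μ} μ>0 h hx refl = ⊗-cancel μ>0 (begin
            μ ⊗ z ≡⟨ solve 3 (λ δ μ z → μ :* z := δ :* con (+ 0) :+ μ :* z) refl δ μ z ⟩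
            δ ⊗ 𝟘 ⊕ μ ⊗ z ≡⟨ sym h ⟩
            x ≡⟨ hx ⟩
            𝟘 ∎)
            where open ≡-Reasoning

          newton₁₂′ : ∀ n₀ n₁ n₂ → J n₀ n₁ (suc n₂) ≡ 𝟙 ⊗ J n₀ (suc n₁) (suc n₂) ⊕ 𝟙 ⊗ J n₀ (suc n₁) n₂
          newton₁₂′ n₀ n₁ n₂ = solve 2 (λ x y → x := con (+ 1) :* (x :- y) :+ con (+ 1) :* y) refl _ _

          Vanishing : ℕ → ℕ → ℕ → Set
          Vanishing n₀ n₁ n₂ = J (suc n₀) n₁ n₂ ≡ 𝟘 × J n₀ (suc n₁) n₂ ≡ 𝟘 × J n₀ n₁ (suc n₂) ≡ 𝟘

          𝟙>0 : 1 ≤ N 𝟙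
          𝟙>0 = ≤-reflexive (sym N-𝟙)

          𝟚>0 : 1 ≤ N 𝟚
          𝟚>0 = ≤-trans (s≤s z≤n) (≤-reflexive (sym (N-ι (+ 2))))

          -- If the three forms above a corner vanish, Euler makes the form at the corner vanish,
          -- since its weight is nonzero. This corner is one of the three forms above the corner
          -- with one node less, and Newton's recurrences supply the other two.
          vanishing₂ : ∀ n₂ → n₂ ≤ ν → Vanishing ν ν n₂ → Vanishing ν ν 0
          vanishing₂ zero h v = v
          vanishing₂ (suc n) h (z₀ , z₁ , z₂) = vanishing₂ n (<⇒≤ h)
            ( zero-component 𝟚>0 (newton₀₂ ν ν n ≤-refl (≤ν⇒<T ≤-refl ≤-refl) (≤ν⇒<T ≤-refl h)) z z₀
            , zero-component 𝟙>0 (newton₁₂′ ν ν n) z z₁ , z )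
            where z = euler-zero ν ν (suc n) ≤-refl ≤-refl h (s≤s z≤n) z₀ z₁ z₂

          vanishing₁ : ∀ n₁ → n₁ ≤ ν → Vanishing ν n₁ 0 → Vanishing ν 0 0
          vanishing₁ zero h v = v
          vanishing₁ (suc n) h (z₀ , z₁ , z₂) = vanishing₁ n (<⇒≤ h)
            ( zero-component 𝟚>0 (newton₀₁ ν n 0 ≤-refl (≤ν⇒<T ≤-refl h) (≤ν⇒<T ≤-refl z≤n)) z z₀
            , z , zero-combination (newton₁₂′ ν n 0) z₂ z )
            where z = euler-zero ν (suc n) 0 ≤-refl h z≤n (s≤s z≤n) z₀ z₁ z₂

          vanishing₀ : ∀ n₀ → n₀ ≤ ν → Vanishing n₀ 0 0 → Vanishing 0 0 0
          vanishing₀ zero h v = v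
          vanishing₀ (suc n) h (z₀ , z₁ , z₂) = vanishing₀ n (<⇒≤ h)
            ( z , zero-combination (newton₀₁ n 0 0 (<⇒≤ h) (≤ν⇒<T (<⇒≤ h) (s≤s z≤n)) (≤ν⇒<T (<⇒≤ h) z≤n)) z₁ z
            , zero-combination (newton₀₂ n 0 0 (<⇒≤ h) (≤ν⇒<T (<⇒≤ h) z≤n) (≤ν⇒<T (<⇒≤ h) (s≤s z≤n))) z₂ z )
            where z = euler-zero (suc n) 0 0 h z≤n z≤n (s≤s z≤n) z₀ z₁ z₂

          ⊗>0 : ∀ {x y} → 1 ≤ N x → 1 ≤ N y → 1 ≤ N (x ⊗ y)
          ⊗>0 {x} {y} h g = ≤-trans (*-mono-≤ h g) (≤-reflexive (sym (N-⊗ x y)))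

          ↑>0 : ∀ {x} → 1 ≤ N x → ∀ n → 1 ≤ N (x ↑ n)
          ↑>0 h zero = 𝟙>0
          ↑>0 h (suc n) = ⊗>0 h (↑>0 h n)

          -- If the three forms vanished, Newton and Euler would propagate the vanishing down to J 1 0 0, a nonzero multiple of ζ.
          nonvanishing : 1 ≤ N c → 1 ≤ N ζ → ¬ Vanishing ν ν ν
          nonvanishing c>0 ζ>0 v = contradiction (subst (1 ≤_) (trans (cong N (proj₁ v₀)) N-𝟘) J>0) λ ()
            where
            v₀ = vanishing₀ ν ≤-refl (vanishing₁ ν ≤-refl (vanishing₂ ν ≤-refl v))
            γ>0 : 1 ≤ N (γ ν 0)
            γ>0 = ⊗>0 (↑>0 (≤-trans (s≤s z≤n) (≤-reflexive (sym (N-ι (+ 4))))) ν) 𝟙>0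
            J>0 : 1 ≤ N (J 1 0 0)
            J>0 = ⊗>0 (⊗>0 (⊗>0 𝟙>0 (↑>0 a>0 (T ∸ 1))) (↑>0 b>0 ρ)) (⊗>0 (⊗>0 γ>0 (↑>0 (⊗>0 b>0 c>0) ν)) (⊗>0 b>0 ζ>0))

  -- Size of the coefficients of the forms

  module FormBounds (𝓡 : NormedRing) where
    open +-*-Solver
    open Ring 𝓡 hiding (solve; _:=_; _:+_; _:*_; _:-_; :-_; con)
    open Forms 𝓡

    γ-bound : ℕ → ℕ
    γ-bound ν = 16 ^ ν * 4 ^ suc ν

    N-γ : ∀ ν h → h ≤ ν → N (γ ν h) ≤ γ-bound ν
    N-γ ν h h≤ν = begin
      N (γ ν h) ≤⟨ N⊗≤ (N↑≤ (≤-reflexive (N-ι (+ 4))) (ν ∸ h))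
                     (≤-trans (≤-reflexive (N-ι (β (suc ν) h))) (*-mono-≤ (∣β∣≤ (suc ν) h) (∣β∣≤ (suc ν) h))) ⟩
      16 ^ (ν ∸ h) * (2 ^ suc ν * 4 ^ h * (2 ^ suc ν * 4 ^ h))
        ≡⟨ solve 3 (λ x y z → x :* (y :* z :* (y :* z)) := x :* (z :* z) :* (y :* y)) refl (16 ^ (ν ∸ h)) (2 ^ suc ν) (4 ^ h) ⟩
      16 ^ (ν ∸ h) * (4 ^ h * 4 ^ h) * (2 ^ suc ν * 2 ^ suc ν)
        ≡⟨ cong₂ (λ s t → 16 ^ (ν ∸ h) * s * t) (sym (^-distribʳ-* h 4 4)) (sym (^-distribʳ-* (suc ν) 2 2)) ⟩
      16 ^ (ν ∸ h) * 16 ^ h * 4 ^ suc ν ≡⟨ cong (_* 4 ^ suc ν) (sym (^-distribˡ-+-* 16 (ν ∸ h) h)) ⟩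
      16 ^ (ν ∸ h + h) * 4 ^ suc ν ≡⟨ cong (λ t → 16 ^ t * 4 ^ suc ν) (m∸n+n≡m h≤ν) ⟩
      γ-bound ν ∎
      where
      open ≤-Reasoning
      ^-distribʳ-* : ∀ n x y → (x * y) ^ n ≡ x ^ n * y ^ n
      ^-distribʳ-* zero x y = refl
      ^-distribʳ-* (suc n) x y = trans (cong (λ t → x * y * t) (^-distribʳ-* n x y))
        (solve 4 (λ x y s t → x :* y :* (s :* t) := x :* s :* (y :* t)) refl x y (x ^ n) (y ^ n))

    doubling : ∀ m D → 2 * (4 ^ m * D + 4 ^ m * D) ≡ 4 ^ suc m * D
    doubling m D = solve 2 (λ x D → con 2 :* (x :* D :+ x :* D) := con 4 :* x :* D) refl (4 ^ m) D

    G-bound : ∀ ν {μ X Y U E} → 1 ≤ U → N μ ≤ U → N (μ ⊕ 𝟙) ≤ U → N X ≤ E → N Y ≤ E →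
      ∀ i j → i ≤ suc ν → j ≤ suc ν → N (G ν μ X Y i j) ≤ 4 ^ (i + j) * (γ-bound ν * U ^ ν * E)
    G-bound ν {U = suc u} {E} U>0 hμ hμ′ hX hY = go
      where
      U = suc u
      D = γ-bound ν * U ^ ν * E
      axis : ∀ {x Z} h → h ≤ ν → N x ≤ U → N Z ≤ E → ∀ m → N (γ ν h ⊗ x ↑ (ν ∸ h) ⊗ Z) ≤ 4 ^ m * D
      axis {x} {Z} h h≤ν hx hZ m = begin
        N (γ ν h ⊗ x ↑ (ν ∸ h) ⊗ Z) ≤⟨ N⊗≤ (N⊗≤ (N-γ ν h h≤ν) (N↑≤ hx (ν ∸ h))) hZ ⟩
        γ-bound ν * U ^ (ν ∸ h) * E ≤⟨ *-monoˡ-≤ E (*-monoʳ-≤ (γ-bound ν) (^-monoʳ-≤ U (m∸n≤m ν h))) ⟩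
        D ≡⟨ sym (*-identityˡ D) ⟩
        1 * D ≤⟨ *-monoˡ-≤ D (m^n>0 4 m) ⟩
        4 ^ m * D ∎
        where open ≤-Reasoning
      go : ∀ i j → i ≤ suc ν → j ≤ suc ν → N (G ν _ _ _ i j) ≤ 4 ^ (i + j) * D
      go zero zero _ _ = ≤-trans (≤-reflexive N-𝟘) z≤n
      go (suc i) zero (s≤s p) _ = axis i p hμ hX (suc i + 0)
      go zero (suc j) _ (s≤s q) = axis j q hμ′ hY (suc j)
      go (suc i) (suc j) p q = begin
        N (G ν _ _ _ i (suc j) ⊖ G ν _ _ _ (suc i) j) ≤⟨ N⊖≤ (go i (suc j) (<⇒≤ p) q) (go (suc i) j p (<⇒≤ q)) ⟩
        2 * (4 ^ (i + suc j) * D + 4 ^ (suc i + j) * D) ≡⟨ cong (λ t → 2 * (4 ^ (i + suc j) * D + 4 ^ t * D)) (sym (+-suc i j)) ⟩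
        2 * (4 ^ (i + suc j) * D + 4 ^ (i + suc j) * D) ≡⟨ doubling (i + suc j) D ⟩
        4 ^ (suc i + suc j) * D ∎
        where open ≤-Reasoning

    module _ (a c : Carrier) (ρ : ℕ) (ζ η₁ η₂ : Carrier) where
      b′ : Carrier
      b′ = b a c ρ
      ν′ T′ : ℕ
      ν′ = ν a c ρ
      T′ = T a c ρ
      open Form a c ρ ζ η₁ η₂

      -- At least ν nodes are at abc and at least one is elsewhere; this brings the exponent of a or
      -- b in front of `Gᵃ` or `Gᵇ` down from T to at most ν. With A of order Q and U of order Q⁴
      -- the coefficients then have norm about Q^(6ν - 1).
      J-bound : ∀ {A U E} → 1 ≤ A → 1 ≤ U → N a ≤ A → N b′ ≤ A →
        N (b′ ⊗ c) ≤ U → N (b′ ⊗ c ⊕ 𝟙) ≤ U → N (a ⊗ c) ≤ U → N (a ⊗ c ⊕ 𝟙) ≤ U →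
        N (b′ ⊗ ζ) ≤ E → N (a ⊗ ζ) ≤ E → N η₁ ≤ E → N η₂ ≤ E →
        ∀ n₀ n₁ n₂ → ν′ ≤ n₀ → n₀ ≤ suc ν′ → n₁ ≤ suc ν′ → n₂ ≤ suc ν′ → n₀ + n₁ ≤ T′ → n₀ + n₂ ≤ T′ → 1 ≤ n₁ + n₂ →
        N (J n₀ n₁ n₂) ≤ 4 ^ (n₁ + n₂) * (A ^ ν′ * A ^ ρ * (4 ^ T′ * (γ-bound ν′ * U ^ ν′ * E)))
      J-bound {suc A′} {U} {E} A>0 U>0 ha hb hbc hbc′ hac hac′ hζ hζ′ h₁ h₂ n₀ n₁ n₂ g₀ = go n₀ n₁ n₂ g₀
        where
        A = suc A′
        D = γ-bound ν′ * U ^ ν′ * E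
        F = A ^ ν′ * A ^ ρ * (4 ^ T′ * D)
        axis : ∀ {x y Z} n₀ n → 1 ≤ n → ν′ ≤ n₀ → n₀ + n ≤ T′ → N x ≤ A → N y ≤ A → N Z ≤ 4 ^ (n₀ + n) * D →
          N (𝟚 ↑ n ⊗ x ↑ (T′ ∸ (n₀ + n)) ⊗ y ↑ ρ ⊗ Z) ≤ 4 ^ n * F
        axis {x} {y} {Z} n₀ n n>0 g₀ g hx hy hZ = begin
          N (𝟚 ↑ n ⊗ x ↑ (T′ ∸ (n₀ + n)) ⊗ y ↑ ρ ⊗ Z)
            ≤⟨ N⊗≤ (N⊗≤ (N⊗≤ (N↑≤ (≤-reflexive (N-ι (+ 2))) n) (N↑≤ hx (T′ ∸ (n₀ + n)))) (N↑≤ hy ρ)) hZ ⟩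
          4 ^ n * A ^ (T′ ∸ (n₀ + n)) * A ^ ρ * (4 ^ (n₀ + n) * D)
            ≤⟨ *-mono-≤ (*-monoˡ-≤ (A ^ ρ) (*-monoʳ-≤ (4 ^ n) (^-monoʳ-≤ A exponent))) (*-monoˡ-≤ D (^-monoʳ-≤ 4 g)) ⟩
          4 ^ n * A ^ ν′ * A ^ ρ * (4 ^ T′ * D)
            ≡⟨ solve 4 (λ x y z w → x :* y :* z :* w := x :* (y :* z :* w)) refl (4 ^ n) (A ^ ν′) (A ^ ρ) (4 ^ T′ * D) ⟩
          4 ^ n * F ∎
          where
          open ≤-Reasoning
          exponent : T′ ∸ (n₀ + n) ≤ ν′
          exponent = begin
            T′ ∸ (n₀ + n) ≤⟨ ∸-monoʳ-≤ T′ (+-mono-≤ g₀ n>0) ⟩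
            ν′ + ν′ + 1 ∸ (ν′ + 1) ≡⟨ cong (_∸ (ν′ + 1)) (+-assoc ν′ ν′ 1) ⟩
            ν′ + (ν′ + 1) ∸ (ν′ + 1) ≡⟨ m+n∸n≡m ν′ (ν′ + 1) ⟩
            ν′ ∎
        go : ∀ n₀ n₁ n₂ → ν′ ≤ n₀ → n₀ ≤ suc ν′ → n₁ ≤ suc ν′ → n₂ ≤ suc ν′ → n₀ + n₁ ≤ T′ → n₀ + n₂ ≤ T′ → 1 ≤ n₁ + n₂ →
          N (J n₀ n₁ n₂) ≤ 4 ^ (n₁ + n₂) * F
        go n₀ n₁ zero g₀ k₀ k₁ k₂ t₁ t₂ h = ≤-trans
          (axis n₀ n₁ (subst (1 ≤_) (+-identityʳ n₁) h) g₀ t₁ ha hb (G-bound ν′ U>0 hbc hbc′ hζ h₁ n₀ n₁ k₀ k₁))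
          (≤-reflexive (cong (λ t → 4 ^ t * F) (sym (+-identityʳ n₁))))
        go n₀ zero (suc n₂) g₀ k₀ k₁ k₂ t₁ t₂ h = axis n₀ (suc n₂) h g₀ t₂ hb ha (G-bound ν′ U>0 hac hac′ hζ′ h₂ n₀ (suc n₂) k₀ k₂)
        go n₀ (suc n₁) (suc n₂) g₀ k₀ k₁ k₂ t₁ t₂ h = begin
          N (J n₀ n₁ (suc n₂) ⊖ J n₀ (suc n₁) n₂)
            ≤⟨ N⊖≤ (go n₀ n₁ (suc n₂) g₀ k₀ (<⇒≤ k₁) k₂ (≤-trans (+-monoʳ-≤ n₀ (n≤1+n n₁)) t₁) t₂ (m≤n⇒m≤o+n n₁ (s≤s z≤n)))
                   (go n₀ (suc n₁) n₂ g₀ k₀ k₁ (<⇒≤ k₂) t₁ (≤-trans (+-monoʳ-≤ n₀ (n≤1+n n₂)) t₂) (s≤s z≤n)) ⟩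
          2 * (4 ^ (n₁ + suc n₂) * F + 4 ^ (suc n₁ + n₂) * F) ≡⟨ cong (λ t → 2 * (4 ^ (n₁ + suc n₂) * F + 4 ^ t * F)) (sym (+-suc n₁ n₂)) ⟩
          2 * (4 ^ (n₁ + suc n₂) * F + 4 ^ (n₁ + suc n₂) * F) ≡⟨ doubling (n₁ + suc n₂) F ⟩
          4 ^ (suc n₁ + suc n₂) * F ∎
          where open ≤-Reasoning

  -- The rule binom(r, j + i) binom(j + i, j) = binom(r, j) binom(r - j, i) for r = p + j - 1/2. It
  -- identifies the j-th divided derivative of a binomial series with a binomial series of exponent
  -- lower by j.
  β-P : ∀ p j i → β (p + j) (j + i) ℤ.* + P j i ≡ β (p + j) j ℤ.* β p i
  β-P p j zero = begin
    β (p + j) (j + 0) ℤ.* + P j 0 ≡⟨ cong₂ (λ s t → β (p + j) s ℤ.* + t) (+-identityʳ j) (P-zero j) ⟩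
    β (p + j) j ℤ.* + 1 ≡⟨ cong (β (p + j) j ℤ.*_) (sym (β-zero p)) ⟩
    β (p + j) j ℤ.* β p 0 ∎
    where open ≡-Reasoning
  β-P p j (suc i) = ℤ.*-cancelˡ-≡ (+ suc i) _ _ (begin
    + suc i ℤ.* (β (p + j) (j + suc i) ℤ.* + P j (suc i))
      ≡⟨ solve 3 (λ n x y → n :* (x :* y) := x :* (n :* y)) refl (+ suc i) (β (p + j) (j + suc i)) (+ P j (suc i)) ⟩
    β (p + j) (j + suc i) ℤ.* (+ suc i ℤ.* + P j (suc i))
      ≡⟨ cong₂ (λ s t → β (p + j) s ℤ.* t) (+-suc j i)
           (trans (sym (ℤ.pos-* (suc i) _)) (trans (cong +_ (P-absorb j i)) (ℤ.pos-* (suc (j + i)) _))) ⟩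
    β (p + j) (suc (j + i)) ℤ.* (+ suc (j + i) ℤ.* + P j i)
      ≡⟨ solve 3 (λ n x y → x :* (n :* y) := n :* x :* y) refl (+ suc (j + i)) (β (p + j) (suc (j + i))) (+ P j i) ⟩
    + suc (j + i) ℤ.* β (p + j) (suc (j + i)) ℤ.* + P j i ≡⟨ cong (ℤ._* + P j i) (β-suc (p + j) (j + i)) ⟩
    (+ 4 ℤ.* + (p + j) ℤ.- + 2 ℤ.- + 4 ℤ.* + (j + i)) ℤ.* β (p + j) (j + i) ℤ.* + P j i
      ≡⟨ solve 5 (λ p j i x y → (con (+ 4) :* (p :+ j) :- con (+ 2) :- con (+ 4) :* (j :+ i)) :* x :* y
           := (con (+ 4) :* p :- con (+ 2) :- con (+ 4) :* i) :* (x :* y)) refl (+ p) (+ j) (+ i) (β (p + j) (j + i)) (+ P j i) ⟩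
    (+ 4 ℤ.* + p ℤ.- + 2 ℤ.- + 4 ℤ.* + i) ℤ.* (β (p + j) (j + i) ℤ.* + P j i) ≡⟨ cong (e ℤ.*_) (β-P p j i) ⟩
    e ℤ.* (β (p + j) j ℤ.* β p i) ≡⟨ solve 3 (λ e x y → e :* (x :* y) := x :* (e :* y)) refl e (β (p + j) j) (β p i) ⟩
    β (p + j) j ℤ.* (e ℤ.* β p i) ≡⟨ cong (β (p + j) j ℤ.*_) (sym (β-suc p i)) ⟩
    β (p + j) j ℤ.* (+ suc i ℤ.* β p (suc i)) ≡⟨ solve 3 (λ e x y → x :* (e :* y) := e :* (x :* y)) refl (+ suc i) (β (p + j) j) (β p (suc i)) ⟩
    + suc i ℤ.* (β (p + j) j ℤ.* β p (suc i)) ∎)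
    where
    open ≡-Reasoning
    open ℤS.+-*-Solver
    e = + 4 ℤ.* + p ℤ.- + 2 ℤ.- + 4 ℤ.* + i

  n≤2^n : ∀ n → n ≤ 2 ^ n
  n≤2^n zero = z≤n
  n≤2^n (suc n) = begin
    1 + n ≤⟨ +-mono-≤ (m^n>0 2 n) (n≤2^n n) ⟩
    2 ^ n + 2 ^ n ≡⟨ cong (λ t → 2 ^ n + t) (sym (+-identityʳ _)) ⟩
    2 ^ suc n ∎
    where open ≤-Reasoning

  *-^ : ∀ x y n → (x * y) ^ n ≡ x ^ n * y ^ n
  *-^ x y zero = refl
  *-^ x y (suc n) = trans (cong (λ t → x * y * t) (*-^ x y n)) (lemma x y (x ^ n) (y ^ n))
    where
    lemma : ∀ x y s t → x * y * (s * t) ≡ x * s * (y * t)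
    lemma = solve-∀

  -- Power series in 1/B through their scaled partial sums

  module Series (𝓡 : NormedRing) (M : NormedRing.Carrier 𝓡) where
    open Ring 𝓡

    -- The factor 4 clears the denominators of binom(p - 1/2, m): the expansion of (1 + w/M)^(p -
    -- 1/2) in powers of 1/B has the integral coefficients β p m w^m.
    B : Carrier
    B = ι (+ 4) ⊗ M

    q : ℕ
    q = N B

    -- Σ_{m ≤ L} f m B^(L - m), that is, B^L times a partial sum of the series Σ f m B^(-m).
    Ev : (ℕ → Carrier) → ℕ → Carrier
    Ev f zero = f 0
    Ev f (suc L) = B ⊗ Ev f L ⊕ f (suc L)

    Ev-cong : ∀ {f g} → (∀ m → f m ≡ g m) → ∀ L → Ev f L ≡ Ev g L
    Ev-cong h zero = h 0
    Ev-cong h (suc L) = cong₂ (λ s t → B ⊗ s ⊕ t) (Ev-cong h L) (h (suc L))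

    Ev-linear : ∀ x f g L → Ev (λ m → x ⊗ f m ⊕ g m) L ≡ x ⊗ Ev f L ⊕ Ev g L
    Ev-linear x f g zero = refl
    Ev-linear x f g (suc L) = trans (cong (λ t → B ⊗ t ⊕ (x ⊗ f (suc L) ⊕ g (suc L))) (Ev-linear x f g L))
      (solve 6 (λ b x s t u v → b :* (x :* s :+ t) :+ (x :* u :+ v) := x :* (b :* s :+ u) :+ (b :* t :+ v)) refl B x _ _ _ _)

    Ev-scale : ∀ x f L → Ev (λ m → x ⊗ f m) L ≡ x ⊗ Ev f L
    Ev-scale x f zero = refl
    Ev-scale x f (suc L) = trans (cong (λ t → B ⊗ t ⊕ x ⊗ f (suc L)) (Ev-scale x f L))
      (solve 4 (λ b x s u → b :* (x :* s) :+ x :* u := x :* (b :* s :+ u)) refl B x _ _)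

    Ev-first : ∀ f L → Ev f (suc L) ≡ f 0 ⊗ B ↑ suc L ⊕ Ev (λ m → f (suc m)) L
    Ev-first f zero = solve 3 (λ b x y → b :* x :+ y := x :* (b :* con (+ 1)) :+ y) refl B _ _
    Ev-first f (suc L) = trans (cong (λ t → B ⊗ t ⊕ f (suc (suc L))) (Ev-first f L))
      (solve 5 (λ b x y z w → b :* (x :* y :+ z) :+ w := x :* (b :* y) :+ (b :* z :+ w)) refl B _ _ _ _)

    Ev-skip : ∀ f i → (∀ m → m < i → f m ≡ 𝟘) → ∀ L → Ev f (i + L) ≡ Ev (λ m → f (i + m)) L
    Ev-skip f zero h L = refl
    Ev-skip f (suc i) h L = begin
      Ev f (suc (i + L)) ≡⟨ Ev-first f (i + L) ⟩
      f 0 ⊗ B ↑ suc (i + L) ⊕ Ev (λ m → f (suc m)) (i + L)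
        ≡⟨ cong₂ (λ s t → s ⊗ B ↑ suc (i + L) ⊕ t) (h 0 (s≤s z≤n)) (Ev-skip (λ m → f (suc m)) i (λ m m<i → h (suc m) (s≤s m<i)) L) ⟩
      𝟘 ⊗ B ↑ suc (i + L) ⊕ Ev (λ m → f (suc i + m)) L ≡⟨ solve 2 (λ x y → con (+ 0) :* x :+ y := y) refl _ _ ⟩
      Ev (λ m → f (suc i + m)) L ∎
      where open ≡-Reasoning

    Ev-bound : ∀ {A} → 4 * A ≤ q → ∀ L {f C} → (∀ m → N (f m) ≤ C * A ^ m) → N (Ev f L) ≤ 4 * C * q ^ L
    Ev-bound h zero {f} {C} hf = begin
      N (f 0) ≤⟨ hf 0 ⟩
      C * 1 ≤⟨ *-monoˡ-≤ 1 (m≤n*m C 4) ⟩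
      4 * C * 1 ∎
      where open ≤-Reasoning
    Ev-bound {A} h (suc L) {f} {C} hf = begin
      N (Ev f (suc L)) ≡⟨ cong N (Ev-first f L) ⟩
      N (f 0 ⊗ B ↑ suc L ⊕ Ev (λ m → f (suc m)) L)
        ≤⟨ N⊕≤ (N⊗≤ (≤-trans (hf 0) (≤-reflexive (*-identityʳ C))) (N↑≤ ≤-refl (suc L)))
               (Ev-bound h L {C = C * A} (λ m → ≤-trans (hf (suc m)) (≤-reflexive (sym (*-assoc C A _))))) ⟩
      2 * (C * (q * q ^ L) + 4 * (C * A) * q ^ L) ≡⟨ lemma₁ C A q (q ^ L) ⟩
      2 * (C * (q * q ^ L) + C * (4 * A * q ^ L)) ≤⟨ *-monoʳ-≤ 2 (+-monoʳ-≤ (C * (q * q ^ L)) (*-monoʳ-≤ C (*-monoˡ-≤ (q ^ L) h))) ⟩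
      2 * (C * (q * q ^ L) + C * (q * q ^ L)) ≡⟨ lemma₂ C (q * q ^ L) ⟩
      4 * C * (q * q ^ L) ∎
      where
      open ≤-Reasoning
      lemma₁ : ∀ C A q z → 2 * (C * (q * z) + 4 * (C * A) * z) ≡ 2 * (C * (q * z) + C * (4 * A * z))
      lemma₁ = solve-∀
      lemma₂ : ∀ C z → 2 * (C * z + C * z) ≡ 4 * C * z
      lemma₂ = solve-∀

    -- x L / B^L tends to 0, expressed without quotients: K plays the role of 1/ε.
    Negligible : (ℕ → Carrier) → Set
    Negligible x = ∀ K → ∃ λ L₀ → ∀ L → L₀ ≤ L → K * N (x L) ≤ q ^ L

    negl-geometric : ∀ {x} C A → 2 * A ≤ q → (∀ L → N (x L) ≤ C * A ^ L) → Negligible x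
    negl-geometric {x} C A h hx K = K * C , λ L L₀≤L → begin
      K * N (x L) ≤⟨ *-monoʳ-≤ K (hx L) ⟩
      K * (C * A ^ L) ≡⟨ sym (*-assoc K C _) ⟩
      K * C * A ^ L ≤⟨ *-monoˡ-≤ (A ^ L) (≤-trans L₀≤L (n≤2^n L)) ⟩
      2 ^ L * A ^ L ≡⟨ sym (*-^ 2 A L) ⟩
      (2 * A) ^ L ≤⟨ ^-monoˡ-≤ L h ⟩
      q ^ L ∎
      where open ≤-Reasoning

    negl-eventually : ∀ {x y} L₁ → (∀ L → L₁ ≤ L → x L ≡ y L) → Negligible x → Negligible y
    negl-eventually L₁ h nx K with nx K
    ... | L₀ , g = L₀ + L₁ , λ L le → subst (λ t → K * N t ≤ q ^ L) (h L (≤-trans (m≤n+m L₁ L₀) le)) (g L (≤-trans (m≤m+n L₀ L₁) le))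

    negl-cong : ∀ {x y} → (∀ L → x L ≡ y L) → Negligible x → Negligible y
    negl-cong h = negl-eventually 0 (λ L _ → h L)

    negl-𝟘 : Negligible (λ _ → 𝟘)
    negl-𝟘 K = 0 , λ L _ → ≤-trans (≤-reflexive (trans (cong (K *_) N-𝟘) (*-zeroʳ K))) z≤n

    negl-⊕ : ∀ {x y} → Negligible x → Negligible y → Negligible (λ L → x L ⊕ y L)
    negl-⊕ {x} {y} nx ny K with nx (4 * K) | ny (4 * K)
    ... | L₀ , g | L₁ , h = L₀ + L₁ , λ L le → *-cancelˡ-≤ 2 (begin
      2 * (K * N (x L ⊕ y L)) ≤⟨ *-monoʳ-≤ 2 (*-monoʳ-≤ K (N-⊕ (x L) (y L))) ⟩
      2 * (K * (2 * (N (x L) + N (y L)))) ≡⟨ lemma K (N (x L)) (N (y L)) ⟩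
      4 * K * N (x L) + 4 * K * N (y L) ≤⟨ +-mono-≤ (g L (≤-trans (m≤m+n L₀ L₁) le)) (h L (≤-trans (m≤n+m L₁ L₀) le)) ⟩
      q ^ L + q ^ L ≡⟨ cong (λ t → q ^ L + t) (sym (+-identityʳ _)) ⟩
      2 * q ^ L ∎)
      where
      open ≤-Reasoning
      lemma : ∀ K s t → 2 * (K * (2 * (s + t))) ≡ 4 * K * s + 4 * K * t
      lemma = solve-∀

    negl-⊗ : ∀ {x} k → Negligible x → Negligible (λ L → k ⊗ x L)
    negl-⊗ {x} k nx K with nx (K * N k)
    ... | L₀ , g = L₀ , λ L le → ≤-trans (≤-reflexive (trans (cong (K *_) (N-⊗ k (x L))) (sym (*-assoc K (N k) _)))) (g L le)

    negl-cancel : ∀ {x k} → 1 ≤ N k → Negligible (λ L → k ⊗ x L) → Negligible x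
    negl-cancel {x} {k} k>0 nx K with nx K
    ... | L₀ , g = L₀ , λ L le → ≤-trans (*-monoʳ-≤ K (begin
      N (x L) ≡⟨ sym (*-identityˡ _) ⟩
      1 * N (x L) ≤⟨ *-monoˡ-≤ (N (x L)) k>0 ⟩
      N k * N (x L) ≡⟨ sym (N-⊗ k (x L)) ⟩
      N (k ⊗ x L) ∎)) (g L le)
      where open ≤-Reasoning

    -- The Taylor coefficients of (1 + 4wv)^(p - 1/2) in v, to be evaluated at v = 1/B, where 1 + 4wv = (M + w)/M.
    term : Carrier → ℕ → ℕ → Carrier
    term w p m = ι (β p m) ⊗ w ↑ m

    N-term : ∀ {w W} → N w ≤ W → ∀ p m → N (term w p m) ≤ 4 ^ p * (16 * W) ^ m
    N-term {w} {W} hw p m = begin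
      N (term w p m) ≤⟨ N⊗≤ (≤-trans (≤-reflexive (N-ι (β p m))) (*-mono-≤ (∣β∣≤ p m) (∣β∣≤ p m))) (N↑≤ hw m) ⟩
      2 ^ p * 4 ^ m * (2 ^ p * 4 ^ m) * W ^ m ≡⟨ lemma (2 ^ p) (4 ^ m) (W ^ m) ⟩
      2 ^ p * 2 ^ p * (4 ^ m * 4 ^ m * W ^ m) ≡⟨ cong₂ _*_ (sym (*-^ 2 2 p)) (trans (cong (_* W ^ m) (sym (*-^ 4 4 m))) (sym (*-^ 16 W m))) ⟩
      4 ^ p * (16 * W) ^ m ∎
      where
      open ≤-Reasoning
      lemma : ∀ x y z → x * y * (x * y) * z ≡ x * x * (y * y * z)
      lemma = solve-∀

    -- Raising the exponent by 1 multiplies the series by (M + w)/M. For partial sums this is exact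
    -- except for the one coefficient that the truncation cuts off.
    Ev-term-suc : ∀ w p L → M ⊗ Ev (term w (suc p)) L ≡ (M ⊕ w) ⊗ Ev (term w p) L ⊖ w ⊗ term w p L
    Ev-term-suc w p zero = trans (solve 1 (λ m → m :* (con (+ 1) :* con (+ 1)) := m) refl M)
      (trans (solve 2 (λ m w → m := (m :+ w) :* (con (+ 1) :* con (+ 1)) :- w :* (con (+ 1) :* con (+ 1))) refl M w)
        (cong (λ t → (M ⊕ w) ⊗ (ι t ⊗ 𝟙) ⊖ w ⊗ (ι t ⊗ 𝟙)) (sym (β-zero p))))
    Ev-term-suc w p (suc L) = begin
      M ⊗ (B ⊗ X ⊕ ι (β p (suc L) ℤ.+ + 4 ℤ.* β p L) ⊗ (w ⊗ w ↑ L))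
        ≡⟨ cong (λ t → M ⊗ (B ⊗ X ⊕ t ⊗ (w ⊗ w ↑ L))) (trans (ι-+ _ _) (cong (ι (β p (suc L)) ⊕_) (ι-* _ _))) ⟩
      M ⊗ (B ⊗ X ⊕ (y ⊕ ι (+ 4) ⊗ z) ⊗ (w ⊗ w ↑ L))
        ≡⟨ solve 7 (λ m b x y z w v → m :* (b :* x :+ (y :+ con (+ 4) :* z) :* (w :* v))
             := b :* (m :* x) :+ m :* y :* (w :* v) :+ con (+ 4) :* m :* z :* (w :* v)) refl M B X y z w (w ↑ L) ⟩
      B ⊗ (M ⊗ X) ⊕ M ⊗ y ⊗ (w ⊗ w ↑ L) ⊕ B ⊗ z ⊗ (w ⊗ w ↑ L)
        ≡⟨ cong (λ t → B ⊗ t ⊕ M ⊗ y ⊗ (w ⊗ w ↑ L) ⊕ B ⊗ z ⊗ (w ⊗ w ↑ L)) (Ev-term-suc w p L) ⟩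
      B ⊗ ((M ⊕ w) ⊗ Y ⊖ w ⊗ (z ⊗ w ↑ L)) ⊕ M ⊗ y ⊗ (w ⊗ w ↑ L) ⊕ B ⊗ z ⊗ (w ⊗ w ↑ L)
        ≡⟨ solve 7 (λ b m w Y z v y → b :* ((m :+ w) :* Y :- w :* (z :* v)) :+ m :* y :* (w :* v) :+ b :* z :* (w :* v)
             := (m :+ w) :* (b :* Y :+ y :* (w :* v)) :- w :* (y :* (w :* v))) refl B M w Y z (w ↑ L) y ⟩
      (M ⊕ w) ⊗ Ev (term w p) (suc L) ⊖ w ⊗ term w p (suc L) ∎
      where
      open ≡-Reasoning
      X = Ev (term w (suc p)) L
      Y = Ev (term w p) L
      y = ι (β p (suc L))
      z = ι (β p L)

    module _ {w W} (W>0 : 1 ≤ W) (hw : N w ≤ W) (hW : 32 * W ≤ q) where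

      negl-term : ∀ p → Negligible (term w p)
      negl-term p = negl-geometric (4 ^ p) (16 * W) (≤-trans (≤-reflexive (sym (*-assoc 2 16 W))) hW) (N-term hw p)

      -- Reduces every half-integer power of (M + w)/M to its square root, so that the same
      -- approximations `ξ` serve for all derivatives.
      Ev-power : ∀ n → Negligible (λ L → M ↑ n ⊗ Ev (term w (suc n)) L ⊖ (M ⊕ w) ↑ n ⊗ Ev (term w 1) L)
      Ev-power zero = negl-cong (λ L → solve 1 (λ x → con (+ 0) := con (+ 1) :* x :- con (+ 1) :* x) refl _) negl-𝟘
      Ev-power (suc n) = negl-cong
        (λ L → trans (solve 7 (λ m mn w t v x y → (m :+ w) :* (mn :* x :- v :* y) :+ :- (mn :* w) :* t
                 := mn :* ((m :+ w) :* x :- w :* t) :- (m :+ w) :* v :* y) refl M (M ↑ n) w (term w (suc n) L) ((M ⊕ w) ↑ n) _ _)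
               (trans (cong (λ t → M ↑ n ⊗ t ⊖ (M ⊕ w) ⊗ (M ⊕ w) ↑ n ⊗ Ev (term w 1) L) (sym (Ev-term-suc w (suc n) L)))
                 (solve 4 (λ m mn x y → mn :* (m :* x) :- y := m :* mn :* x :- y) refl M (M ↑ n) _ _)))
        (negl-⊕ (negl-⊗ (M ⊕ w) (Ev-power n)) (negl-⊗ (neg (M ↑ n ⊗ w)) (negl-term (suc n))))

      -- The two expressions differ in the last j coefficients only, and single coefficients grow
      -- too slowly to matter against B^L.
      Ev-delay : ∀ p j → Negligible (λ L → B ↑ j ⊗ Ev (term w p) (L ∸ j) ⊖ Ev (term w p) L)
      Ev-delay p zero = negl-cong (λ L → solve 1 (λ x → con (+ 0) := con (+ 1) :* x :- x) refl _) negl-𝟘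
      Ev-delay p (suc j) = negl-eventually (suc j) step
        (negl-⊕ (Ev-delay p j) (negl-⊗ (neg (B ↑ j)) (negl-delay j)))
        where
        negl-delay : ∀ j → Negligible (λ L → term w p (L ∸ j))
        negl-delay j = negl-geometric (4 ^ p) (16 * W) (≤-trans (≤-reflexive (sym (*-assoc 2 16 W))) hW) bound
          where
          bound : ∀ L → N (term w p (L ∸ j)) ≤ 4 ^ p * (16 * W) ^ L
          bound L = ≤-trans (N-term hw p (L ∸ j)) (*-monoʳ-≤ (4 ^ p) (^-monoʳ-≤ (16 * W) {{>-nonZero (*-mono-≤ {1} {16} {1} {W} (s≤s z≤n) W>0)}} (m∸n≤m L j)))
        step : ∀ L → suc j ≤ L → B ↑ j ⊗ Ev (term w p) (L ∸ j) ⊖ Ev (term w p) L ⊕ neg (B ↑ j) ⊗ term w p (L ∸ j)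
          ≡ B ⊗ B ↑ j ⊗ Ev (term w p) (L ∸ suc j) ⊖ Ev (term w p) L
        step L le rewrite ∸-step le = solve 5 (λ b bj x y z → bj :* (b :* x :+ y) :- z :+ :- bj :* y := b :* bj :* x :- z) refl B (B ↑ j) _ _ _

    Ev-single : ∀ f → (∀ m → f (suc m) ≡ 𝟘) → ∀ L → Ev f L ≡ f 0 ⊗ B ↑ L
    Ev-single f h zero = solve 1 (λ x → x := x :* con (+ 1)) refl _
    Ev-single f h (suc L) = trans (cong₂ (λ s t → B ⊗ s ⊕ t) (Ev-single f h L) (h L))
      (solve 3 (λ b x y → b :* (x :* y) :+ con (+ 0) := x :* (b :* y)) refl B _ _)

    infixl 7 _⋆_
    _⋆_ : (ℕ → Carrier) → (ℕ → Carrier) → ℕ → Carrier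
    (f ⋆ g) zero = f 0 ⊗ g 0
    (f ⋆ g) (suc n) = f 0 ⊗ g (suc n) ⊕ ((λ i → f (suc i)) ⋆ g) n

    ⋆-cong : ∀ {f f′ g g′} → (∀ i → f i ≡ f′ i) → (∀ i → g i ≡ g′ i) → ∀ n → (f ⋆ g) n ≡ (f′ ⋆ g′) n
    ⋆-cong h k zero = cong₂ _⊗_ (h 0) (k 0)
    ⋆-cong h k (suc n) = cong₂ _⊕_ (cong₂ _⊗_ (h 0) (k (suc n))) (⋆-cong (λ i → h (suc i)) k n)

    ⋆-last : ∀ f g n → (f ⋆ g) (suc n) ≡ (f ⋆ (λ i → g (suc i))) n ⊕ f (suc n) ⊗ g 0
    ⋆-last f g zero = refl
    ⋆-last f g (suc n) = trans (cong (f 0 ⊗ g (suc (suc n)) ⊕_) (⋆-last (λ i → f (suc i)) g n))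
      (solve 3 (λ x y z → x :+ (y :+ z) := x :+ y :+ z) refl _ _ _)

    ⋆-comm : ∀ f g n → (f ⋆ g) n ≡ (g ⋆ f) n
    ⋆-comm f g zero = ⊗-comm _ _
    ⋆-comm f g (suc n) = begin
      f 0 ⊗ g (suc n) ⊕ ((λ i → f (suc i)) ⋆ g) n ≡⟨ ⊕-comm _ _ ⟩
      ((λ i → f (suc i)) ⋆ g) n ⊕ f 0 ⊗ g (suc n) ≡⟨ cong₂ _⊕_ (⋆-comm (λ i → f (suc i)) g n) (⊗-comm _ _) ⟩
      (g ⋆ (λ i → f (suc i))) n ⊕ g (suc n) ⊗ f 0 ≡⟨ sym (⋆-last g f n) ⟩
      (g ⋆ f) (suc n) ∎
      where open ≡-Reasoning

    ⋆-linearˡ : ∀ x f f′ g n → ((λ i → x ⊗ f i ⊕ f′ i) ⋆ g) n ≡ x ⊗ (f ⋆ g) n ⊕ (f′ ⋆ g) n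
    ⋆-linearˡ x f f′ g zero = solve 4 (λ x a b c → (x :* a :+ b) :* c := x :* (a :* c) :+ b :* c) refl x _ _ _
    ⋆-linearˡ x f f′ g (suc n) = trans (cong ((x ⊗ f 0 ⊕ f′ 0) ⊗ g (suc n) ⊕_) (⋆-linearˡ x (λ i → f (suc i)) (λ i → f′ (suc i)) g n))
      (solve 6 (λ x a b c s t → (x :* a :+ b) :* c :+ (x :* s :+ t) := x :* (a :* c :+ s) :+ (b :* c :+ t)) refl x _ _ _ _ _)

    ⋆-linearʳ : ∀ x f g g′ n → (f ⋆ (λ i → x ⊗ g i ⊕ g′ i)) n ≡ x ⊗ (f ⋆ g) n ⊕ (f ⋆ g′) n
    ⋆-linearʳ x f g g′ n = trans (⋆-comm f _ n) (trans (⋆-linearˡ x g g′ f n) (cong₂ (λ s t → x ⊗ s ⊕ t) (⋆-comm g f n) (⋆-comm g′ f n)))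

    ⋆-scaleʳ : ∀ x f g n → (f ⋆ (λ i → x ⊗ g i)) n ≡ x ⊗ (f ⋆ g) n
    ⋆-scaleʳ x f g zero = solve 3 (λ x a b → a :* (x :* b) := x :* (a :* b)) refl x _ _
    ⋆-scaleʳ x f g (suc n) = trans (cong (f 0 ⊗ (x ⊗ g (suc n)) ⊕_) (⋆-scaleʳ x (λ i → f (suc i)) g n))
      (solve 4 (λ x a b s → a :* (x :* b) :+ x :* s := x :* (a :* b :+ s)) refl x _ _ _)

    -- Multiplying the i-th coefficient by i is the derivation v d/dv, and `⋆` is the Cauchy
    -- product.
    ⋆-leibniz : ∀ f g n → ((λ i → ⟨ i ⟩ ⊗ f i) ⋆ g) n ⊕ (f ⋆ (λ i → ⟨ i ⟩ ⊗ g i)) n ≡ ⟨ n ⟩ ⊗ (f ⋆ g) n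
    ⋆-leibniz f g zero = solve 2 (λ x y → con (+ 0) :* x :* y :+ x :* (con (+ 0) :* y) := con (+ 0) :* (x :* y)) refl _ _
    ⋆-leibniz f g (suc n) = begin
      ⟨ 0 ⟩ ⊗ f 0 ⊗ g (suc n) ⊕ ((λ i → ⟨ suc i ⟩ ⊗ f (suc i)) ⋆ g) n ⊕ (f 0 ⊗ (⟨ suc n ⟩ ⊗ g (suc n)) ⊕ Y)
        ≡⟨ cong (λ t → ⟨ 0 ⟩ ⊗ f 0 ⊗ g (suc n) ⊕ t ⊕ (f 0 ⊗ (⟨ suc n ⟩ ⊗ g (suc n)) ⊕ Y))
             (trans (⋆-cong {g = g} (λ i → trans (cong (_⊗ f (suc i)) (⟨suc⟩ i))
                 (solve 2 (λ i x → (con (+ 1) :+ i) :* x := con (+ 1) :* x :+ i :* x) refl ⟨ i ⟩ (f (suc i)))) (λ _ → refl) n)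
               (⋆-linearˡ 𝟙 f′ (λ i → ⟨ i ⟩ ⊗ f′ i) g n)) ⟩
      ⟨ 0 ⟩ ⊗ f 0 ⊗ g (suc n) ⊕ (𝟙 ⊗ (f′ ⋆ g) n ⊕ X) ⊕ (f 0 ⊗ (⟨ suc n ⟩ ⊗ g (suc n)) ⊕ Y)
        ≡⟨ solve 6 (λ a b s x m y → con (+ 0) :* a :* b :+ (con (+ 1) :* s :+ x) :+ (a :* (m :* b) :+ y)
             := m :* (a :* b) :+ s :+ (x :+ y)) refl (f 0) (g (suc n)) _ X ⟨ suc n ⟩ Y ⟩
      ⟨ suc n ⟩ ⊗ (f 0 ⊗ g (suc n)) ⊕ (f′ ⋆ g) n ⊕ (X ⊕ Y) ≡⟨ cong₂ (λ s t → s ⊗ (f 0 ⊗ g (suc n)) ⊕ (f′ ⋆ g) n ⊕ t) (⟨suc⟩ n) (⋆-leibniz f′ g n) ⟩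
      (𝟙 ⊕ ⟨ n ⟩) ⊗ (f 0 ⊗ g (suc n)) ⊕ (f′ ⋆ g) n ⊕ ⟨ n ⟩ ⊗ (f′ ⋆ g) n
        ≡⟨ solve 3 (λ n x s → (con (+ 1) :+ n) :* x :+ s :+ n :* s := (con (+ 1) :+ n) :* (x :+ s)) refl ⟨ n ⟩ _ _ ⟩
      (𝟙 ⊕ ⟨ n ⟩) ⊗ (f ⋆ g) (suc n) ≡⟨ cong (_⊗ (f ⋆ g) (suc n)) (sym (⟨suc⟩ n)) ⟩
      ⟨ suc n ⟩ ⊗ (f ⋆ g) (suc n) ∎
      where
      open ≡-Reasoning
      f′ = λ i → f (suc i)
      X = ((λ i → ⟨ i ⟩ ⊗ f′ i) ⋆ g) n
      Y = (f′ ⋆ (λ i → ⟨ i ⟩ ⊗ g i)) n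

    ⋆-Ev : ∀ f g L → (f ⋆ Ev g) L ≡ Ev (f ⋆ g) L
    ⋆-Ev f g zero = refl
    ⋆-Ev f g (suc L) = begin
      f 0 ⊗ Ev g (suc L) ⊕ (f′ ⋆ Ev g) L ≡⟨ cong₂ (λ s t → f 0 ⊗ s ⊕ t) (Ev-first g L) (⋆-Ev f′ g L) ⟩
      f 0 ⊗ (g 0 ⊗ B ↑ suc L ⊕ Ev (λ m → g (suc m)) L) ⊕ Ev (f′ ⋆ g) L
        ≡⟨ solve 5 (λ x y z s t → x :* (y :* z :+ s) :+ t := x :* y :* z :+ (x :* s :+ t)) refl (f 0) (g 0) _ _ _ ⟩
      f 0 ⊗ g 0 ⊗ B ↑ suc L ⊕ (f 0 ⊗ Ev (λ m → g (suc m)) L ⊕ Ev (f′ ⋆ g) L)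
        ≡⟨ cong (f 0 ⊗ g 0 ⊗ B ↑ suc L ⊕_) (sym (Ev-linear (f 0) (λ m → g (suc m)) (f′ ⋆ g) L)) ⟩
      f 0 ⊗ g 0 ⊗ B ↑ suc L ⊕ Ev (λ m → (f ⋆ g) (suc m)) L ≡⟨ sym (Ev-first (f ⋆ g) L) ⟩
      Ev (f ⋆ g) (suc L) ∎
      where
      open ≡-Reasoning
      f′ = λ i → f (suc i)

    ⋆-↑ : ∀ f L → (f ⋆ (B ↑_)) L ≡ Ev f L
    ⋆-↑ f zero = solve 1 (λ x → x :* con (+ 1) := x) refl _
    ⋆-↑ f (suc L) = trans (cong (f 0 ⊗ B ↑ suc L ⊕_) (⋆-↑ (λ i → f (suc i)) L)) (sym (Ev-first f L))

    ⋆-bound : ∀ {A} n {f h C E} → (∀ i → N (f i) ≤ C * A ^ i) → (∀ i → i ≤ n → N (h i) ≤ E * A ^ i) →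
      N ((f ⋆ h) n) ≤ 4 ^ n * (C * E * A ^ n)
    ⋆-bound zero {C = C} {E} hf hh = ≤-trans (N⊗≤ (hf 0) (hh 0 z≤n)) (≤-reflexive (lemma C E))
      where
      lemma : ∀ C E → C * 1 * (E * 1) ≡ 1 * (C * E * 1)
      lemma = solve-∀
    ⋆-bound {A} (suc n) {f} {h} {C} {E} hf hh = begin
      N (f 0 ⊗ h (suc n) ⊕ ((λ i → f (suc i)) ⋆ h) n)
        ≤⟨ N⊕≤ (N⊗≤ (≤-trans (hf 0) (≤-reflexive (*-identityʳ C))) (hh (suc n) ≤-refl))
               (⋆-bound n {C = C * A} (λ i → ≤-trans (hf (suc i)) (≤-reflexive (sym (*-assoc C A _)))) (λ i i≤n → hh i (m≤n⇒m≤1+n i≤n))) ⟩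
      2 * (C * (E * (A * A ^ n)) + 4 ^ n * (C * A * E * A ^ n)) ≡⟨ lemma₁ C E A (A ^ n) (4 ^ n) ⟩
      2 * (1 + 4 ^ n) * (C * E * (A * A ^ n)) ≤⟨ *-monoˡ-≤ (C * E * (A * A ^ n)) (*-monoʳ-≤ 2 (+-monoˡ-≤ (4 ^ n) (m^n>0 4 n))) ⟩
      2 * (4 ^ n + 4 ^ n) * (C * E * (A * A ^ n)) ≡⟨ cong (_* (C * E * (A * A ^ n))) (lemma₂ (4 ^ n)) ⟩
      4 ^ suc n * (C * E * A ^ suc n) ∎
      where
      open ≤-Reasoning
      lemma₁ : ∀ C E A x y → 2 * (C * (E * (A * x)) + y * (C * A * E * x)) ≡ 2 * (1 + y) * (C * E * (A * x))
      lemma₁ = solve-∀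
      lemma₂ : ∀ x → 2 * (x + x) ≡ 4 * x
      lemma₂ = solve-∀

    module _ (w : Carrier) where

      ⟨suc⟩>0 : ∀ n → 1 ≤ N ⟨ suc n ⟩
      ⟨suc⟩>0 n = ≤-trans (s≤s z≤n) (≤-reflexive (sym (N-ι (+ suc n))))

      √ : ℕ → Carrier
      √ = term w 1

      -- The coefficients of the differential equation (1 + 4wv) y' = 2w y of y = (1 + 4wv)^(1/2).
      √-suc : ∀ n → ⟨ suc n ⟩ ⊗ √ (suc n) ≡ 𝟚 ⊗ w ⊗ √ n ⊕ neg (ι (+ 4) ⊗ w) ⊗ (⟨ n ⟩ ⊗ √ n)
      √-suc n = begin
        ⟨ suc n ⟩ ⊗ (ι (β 1 (suc n)) ⊗ (w ⊗ w ↑ n)) ≡⟨ solve 4 (λ n b w v → n :* (b :* (w :* v)) := n :* b :* (w :* v)) refl ⟨ suc n ⟩ _ w _ ⟩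
        ⟨ suc n ⟩ ⊗ ι (β 1 (suc n)) ⊗ (w ⊗ w ↑ n) ≡⟨ cong (_⊗ (w ⊗ w ↑ n)) (trans (sym (ι-* _ _)) (trans (cong ι (β-suc 1 n)) (ι-* _ _))) ⟩
        ι (+ 2 ℤ.- + 4 ℤ.* + n) ⊗ ι (β 1 n) ⊗ (w ⊗ w ↑ n)
          ≡⟨ cong (λ t → t ⊗ ι (β 1 n) ⊗ (w ⊗ w ↑ n)) (trans (ι-+ _ _) (cong (𝟚 ⊕_) (trans (ι-neg _) (cong neg (ι-* _ _))))) ⟩
        (𝟚 ⊖ ι (+ 4) ⊗ ⟨ n ⟩) ⊗ ι (β 1 n) ⊗ (w ⊗ w ↑ n)
          ≡⟨ solve 4 (λ n b w v → (con (+ 2) :- con (+ 4) :* n) :* b :* (w :* v)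
               := con (+ 2) :* w :* (b :* v) :+ :- (con (+ 4) :* w) :* (n :* (b :* v))) refl ⟨ n ⟩ _ w _ ⟩
        𝟚 ⊗ w ⊗ √ n ⊕ neg (ι (+ 4) ⊗ w) ⊗ (⟨ n ⟩ ⊗ √ n) ∎
        where open ≡-Reasoning

      -- The square F = √ ⋆ √ satisfies the differential equation (1 + 4wv) F' = 4w F.
      √⋆√-suc : ∀ n → ⟨ suc n ⟩ ⊗ (√ ⋆ √) (suc n) ≡ ι (+ 4) ⊗ w ⊗ (𝟙 ⊖ ⟨ n ⟩) ⊗ (√ ⋆ √) n
      √⋆√-suc n = begin
        ⟨ suc n ⟩ ⊗ (√ ⋆ √) (suc n) ≡⟨ sym (⋆-leibniz √ √ (suc n)) ⟩
        (D ⋆ √) (suc n) ⊕ (√ ⋆ D) (suc n) ≡⟨ cong ((D ⋆ √) (suc n) ⊕_) (⋆-comm √ D (suc n)) ⟩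
        (D ⋆ √) (suc n) ⊕ (D ⋆ √) (suc n) ≡⟨ cong (λ t → t ⊕ t) half ⟩
        (𝟚 ⊗ w ⊗ X ⊕ y ⊗ Y) ⊕ (𝟚 ⊗ w ⊗ X ⊕ y ⊗ Y)
          ≡⟨ solve 3 (λ w X Y → (con (+ 2) :* w :* X :+ :- (con (+ 4) :* w) :* Y) :+ (con (+ 2) :* w :* X :+ :- (con (+ 4) :* w) :* Y)
               := con (+ 4) :* w :* (X :- (Y :+ Y))) refl w X Y ⟩
        ι (+ 4) ⊗ w ⊗ (X ⊖ (Y ⊕ Y)) ≡⟨ cong (λ t → ι (+ 4) ⊗ w ⊗ (X ⊖ t)) (trans (cong (Y ⊕_) (⋆-comm D √ n)) (⋆-leibniz √ √ n)) ⟩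
        ι (+ 4) ⊗ w ⊗ (X ⊖ ⟨ n ⟩ ⊗ X)
          ≡⟨ solve 3 (λ w n X → con (+ 4) :* w :* (X :- n :* X) := con (+ 4) :* w :* (con (+ 1) :- n) :* X) refl w ⟨ n ⟩ X ⟩
        ι (+ 4) ⊗ w ⊗ (𝟙 ⊖ ⟨ n ⟩) ⊗ X ∎
        where
        open ≡-Reasoning
        D = λ i → ⟨ i ⟩ ⊗ √ i
        X = (√ ⋆ √) n
        Y = (D ⋆ √) n
        y = neg (ι (+ 4) ⊗ w)
        half : (D ⋆ √) (suc n) ≡ 𝟚 ⊗ w ⊗ X ⊕ y ⊗ Y
        half = begin
          ⟨ 0 ⟩ ⊗ √ 0 ⊗ √ (suc n) ⊕ ((λ i → D (suc i)) ⋆ √) n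
            ≡⟨ solve 3 (λ x y z → con (+ 0) :* x :* y :+ z := z) refl _ _ _ ⟩
          ((λ i → D (suc i)) ⋆ √) n
            ≡⟨ ⋆-cong {g = √} (λ i → √-suc i) (λ _ → refl) n ⟩
          ((λ i → 𝟚 ⊗ w ⊗ √ i ⊕ y ⊗ D i) ⋆ √) n ≡⟨ ⋆-linearˡ (𝟚 ⊗ w) √ (λ i → y ⊗ D i) √ n ⟩
          𝟚 ⊗ w ⊗ X ⊕ ((λ i → y ⊗ D i) ⋆ √) n
            ≡⟨ cong (𝟚 ⊗ w ⊗ X ⊕_) (trans (⋆-comm (λ i → y ⊗ D i) √ n) (trans (⋆-scaleʳ y √ D n) (cong (y ⊗_) (⋆-comm √ D n)))) ⟩
          𝟚 ⊗ w ⊗ X ⊕ y ⊗ Y ∎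

      √⋆√-0 : (√ ⋆ √) 0 ≡ 𝟙
      √⋆√-0 = solve 0 (con (+ 1) :* con (+ 1) :* (con (+ 1) :* con (+ 1)) := con (+ 1)) refl

      √⋆√-1 : (√ ⋆ √) 1 ≡ ι (+ 4) ⊗ w
      √⋆√-1 = ⊗-cancelˡ (⟨suc⟩>0 0) (trans (√⋆√-suc 0) (trans (cong (ι (+ 4) ⊗ w ⊗ (𝟙 ⊖ ⟨ 0 ⟩) ⊗_) √⋆√-0)
        (solve 1 (λ w → con (+ 4) :* w :* (con (+ 1) :- con (+ 0)) :* con (+ 1) := con (+ 1) :* (con (+ 4) :* w)) refl w)))

      -- In the recurrence of the square the factor 1 - n vanishes at n = 1, and zero is then passed
      -- on. So the square of the series is 1 + 4wv, obtained without a convolution identity for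
      -- binomial coefficients.
      √⋆√-2 : ∀ n → (√ ⋆ √) (suc (suc n)) ≡ 𝟘
      √⋆√-2 zero = ⊗-cancel (⟨suc⟩>0 1) (trans (√⋆√-suc 1)
        (solve 2 (λ w x → con (+ 4) :* w :* (con (+ 1) :- con (+ 1)) :* x := con (+ 0)) refl w _))
      √⋆√-2 (suc n) = ⊗-cancel (⟨suc⟩>0 (suc (suc n))) (trans (√⋆√-suc (suc (suc n))) (trans (cong (ι (+ 4) ⊗ w ⊗ (𝟙 ⊖ ⟨ suc (suc n) ⟩) ⊗_) (√⋆√-2 n))
        (solve 1 (λ x → x :* con (+ 0) := con (+ 0)) refl _)))

      Ev-√⋆√ : ∀ L → M ⊗ Ev (√ ⋆ √) (suc L) ≡ (M ⊕ w) ⊗ B ↑ suc L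
      Ev-√⋆√ L = begin
        M ⊗ Ev (√ ⋆ √) (suc L) ≡⟨ cong (M ⊗_) (Ev-first (√ ⋆ √) L) ⟩
        M ⊗ ((√ ⋆ √) 0 ⊗ B ↑ suc L ⊕ Ev (λ m → (√ ⋆ √) (suc m)) L)
          ≡⟨ cong₂ (λ s t → M ⊗ (s ⊗ B ↑ suc L ⊕ t)) √⋆√-0 (trans (Ev-single _ √⋆√-2 L) (cong (_⊗ B ↑ L) √⋆√-1)) ⟩
        M ⊗ (𝟙 ⊗ (B ⊗ B ↑ L) ⊕ ι (+ 4) ⊗ w ⊗ B ↑ L)
          ≡⟨ solve 3 (λ m w b → m :* (con (+ 1) :* (con (+ 4) :* m :* b) :+ con (+ 4) :* w :* b) := (m :+ w) :* (con (+ 4) :* m :* b)) refl M w (B ↑ L) ⟩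
        (M ⊕ w) ⊗ B ↑ suc L ∎
        where open ≡-Reasoning

      -- ξ L / B^L approximates the square root of (M + w)/M.
      ξ : ℕ → Carrier
      ξ = Ev √

      module _ {W} (W>0 : 1 ≤ W) (hw : N w ≤ W) (hW : 128 * W ≤ q) where
        A : ℕ
        A = 16 * W

        q>0 : 1 ≤ q
        q>0 = ≤-trans (*-mono-≤ {1} {128} {1} {W} (s≤s z≤n) W>0) hW

        -- The difference of the L-th and the j-th approximation of the root, multiplied by B^(L +
        -- j).
        tail : ℕ → ℕ → Carrier
        tail L j = B ↑ j ⊗ ξ L ⊖ B ↑ L ⊗ ξ j

        tail-step : ∀ i j → tail (i + suc j) j ≡ B ↑ j ⊗ Ev (λ m → √ (suc j + m)) i
        tail-step zero j = solve 4 (λ b bj x y → bj :* (b :* x :+ y) :- b :* bj :* x := bj :* y) refl B (B ↑ j) _ _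
          ∙ cong (λ t → B ↑ j ⊗ √ t) (sym (+-identityʳ (suc j)))
          where
          infixr 4 _∙_
          _∙_ = trans
        tail-step (suc i) j = begin
          B ↑ j ⊗ (B ⊗ ξ (i + suc j) ⊕ √ (suc (i + suc j))) ⊖ B ⊗ B ↑ (i + suc j) ⊗ ξ j
            ≡⟨ solve 6 (λ b bj x y bl z → bj :* (b :* x :+ y) :- b :* bl :* z := b :* (bj :* x :- bl :* z) :+ bj :* y) refl B (B ↑ j) _ _ _ _ ⟩
          B ⊗ tail (i + suc j) j ⊕ B ↑ j ⊗ √ (suc (i + suc j)) ≡⟨ cong₂ (λ s t → B ⊗ s ⊕ B ↑ j ⊗ √ t) (tail-step i j) (+-comm (suc i) (suc j)) ⟩
          B ⊗ (B ↑ j ⊗ Ev (λ m → √ (suc j + m)) i) ⊕ B ↑ j ⊗ √ (suc j + suc i)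
            ≡⟨ solve 4 (λ b bj x y → b :* (bj :* x) :+ bj :* y := bj :* (b :* x :+ y)) refl B (B ↑ j) _ _ ⟩
          B ↑ j ⊗ Ev (λ m → √ (suc j + m)) (suc i) ∎
          where open ≡-Reasoning

        tail-bound : ∀ L j → j ≤ L → N (tail L j) ≤ 16 * A * q ^ L * A ^ j
        tail-bound L j j≤L with m≤n⇒m<n∨m≡n j≤L
        ... | inj₂ refl = ≤-trans (≤-reflexive (trans (cong N (⊖-inverse (B ↑ j ⊗ ξ j))) N-𝟘)) z≤n
        ... | inj₁ j<L = subst (λ t → N (tail t j) ≤ 16 * A * q ^ t * A ^ j) (m∸n+n≡m j<L) (begin
          N (tail (i + suc j) j) ≡⟨ cong N (tail-step i j) ⟩
          N (B ↑ j ⊗ Ev (λ m → √ (suc j + m)) i)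
            ≤⟨ N⊗≤ (N↑≤ ≤-refl j) (Ev-bound (≤-trans (≤-trans (≤-reflexive (sym (*-assoc 4 16 W))) (*-monoˡ-≤ W (m≤n+m 64 64))) hW) i {C = 4 * A ^ suc j} λ m → begin
                 N (√ (suc j + m)) ≤⟨ N-term hw 1 (suc j + m) ⟩
                 4 * A ^ (suc j + m) ≡⟨ cong (4 *_) (^-distribˡ-+-* A (suc j) m) ⟩
                 4 * (A ^ suc j * A ^ m) ≡⟨ sym (*-assoc 4 (A ^ suc j) _) ⟩
                 4 * A ^ suc j * A ^ m ∎) ⟩
          q ^ j * (4 * (4 * (A * A ^ j)) * q ^ i) ≡⟨ lemma (q ^ j) (q ^ i) A (A ^ j) ⟩
          16 * A * (1 * (q ^ j * q ^ i)) * A ^ j ≤⟨ *-monoˡ-≤ (A ^ j) (*-monoʳ-≤ (16 * A) (*-monoˡ-≤ (q ^ j * q ^ i) q>0)) ⟩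
          16 * A * (q * (q ^ j * q ^ i)) * A ^ j
            ≡⟨ cong (λ t → 16 * A * t * A ^ j) (trans (cong (q *_) (sym (^-distribˡ-+-* q j i))) (cong (q ^_) (+-comm (suc j) i))) ⟩
          16 * A * q ^ (i + suc j) * A ^ j ∎)
          where
          open ≤-Reasoning
          i = L ∸ suc j
          lemma : ∀ x y A z → x * (4 * (4 * (A * z)) * y) ≡ 16 * A * (1 * (x * y)) * z
          lemma = solve-∀

        -- Squaring a partial sum also produces products of total degree above L. Convolving √ with
        -- the powers of B gives ξ L, and convolving it with its own partial sums gives the partial
        -- sum of the square; what is left over is the convolution with the tails.
        square-tail : ∀ L → ξ L ⊗ ξ L ≡ B ↑ L ⊗ Ev (√ ⋆ √) L ⊕ (√ ⋆ tail L) L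
        square-tail L = begin
          ξ L ⊗ ξ L ≡⟨ solve 2 (λ x y → x :* x := y :+ (x :* x :- y)) refl (ξ L) Y ⟩
          Y ⊕ (ξ L ⊗ ξ L ⊖ Y) ≡⟨ cong (Y ⊕_) (sym difference) ⟩
          Y ⊕ (√ ⋆ tail L) L ∎
          where
          open ≡-Reasoning
          Y = B ↑ L ⊗ Ev (√ ⋆ √) L
          difference : (√ ⋆ tail L) L ≡ ξ L ⊗ ξ L ⊖ Y
          difference = begin
            (√ ⋆ tail L) L
              ≡⟨ ⋆-cong {f = √} (λ _ → refl) (λ j → solve 4 (λ bj x bl y → bj :* x :- bl :* y := x :* bj :+ :- bl :* y) refl (B ↑ j) (ξ L) (B ↑ L) (ξ j)) L ⟩
            (√ ⋆ (λ j → ξ L ⊗ B ↑ j ⊕ neg (B ↑ L) ⊗ ξ j)) L ≡⟨ ⋆-linearʳ (ξ L) √ (B ↑_) (λ j → neg (B ↑ L) ⊗ ξ j) L ⟩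
            ξ L ⊗ (√ ⋆ (B ↑_)) L ⊕ (√ ⋆ (λ j → neg (B ↑ L) ⊗ ξ j)) L
              ≡⟨ cong₂ (λ s t → ξ L ⊗ s ⊕ t) (⋆-↑ √ L) (trans (⋆-scaleʳ (neg (B ↑ L)) √ ξ L) (cong (neg (B ↑ L) ⊗_) (⋆-Ev √ √ L))) ⟩
            ξ L ⊗ ξ L ⊕ neg (B ↑ L) ⊗ Ev (√ ⋆ √) L ≡⟨ solve 3 (λ x b y → x :* x :+ :- b :* y := x :* x :- b :* y) refl (ξ L) (B ↑ L) _ ⟩
            ξ L ⊗ ξ L ⊖ Y ∎

        ξ-square-tail : ∀ L′ → let L = suc L′ in
          M ⊗ (ξ L ⊗ ξ L) ⊖ (M ⊕ w) ⊗ (B ↑ L ⊗ B ↑ L) ≡ M ⊗ (√ ⋆ tail L) L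
        ξ-square-tail L′ = begin
          M ⊗ (ξ L ⊗ ξ L) ⊖ (M ⊕ w) ⊗ (B ↑ L ⊗ B ↑ L) ≡⟨ cong (λ t → M ⊗ t ⊖ (M ⊕ w) ⊗ (B ↑ L ⊗ B ↑ L)) (square-tail L) ⟩
          M ⊗ (B ↑ L ⊗ Ev (√ ⋆ √) L ⊕ R) ⊖ (M ⊕ w) ⊗ (B ↑ L ⊗ B ↑ L)
            ≡⟨ solve 5 (λ m w b e r → m :* (b :* e :+ r) :- (m :+ w) :* (b :* b) := b :* (m :* e) :+ m :* r :- (m :+ w) :* (b :* b)) refl M w (B ↑ L) _ R ⟩
          B ↑ L ⊗ (M ⊗ Ev (√ ⋆ √) L) ⊕ M ⊗ R ⊖ (M ⊕ w) ⊗ (B ↑ L ⊗ B ↑ L)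
            ≡⟨ cong (λ t → B ↑ L ⊗ t ⊕ M ⊗ R ⊖ (M ⊕ w) ⊗ (B ↑ L ⊗ B ↑ L)) (Ev-√⋆√ L′) ⟩
          B ↑ L ⊗ ((M ⊕ w) ⊗ B ↑ L) ⊕ M ⊗ R ⊖ (M ⊕ w) ⊗ (B ↑ L ⊗ B ↑ L)
            ≡⟨ solve 4 (λ m w b r → b :* ((m :+ w) :* b) :+ m :* r :- (m :+ w) :* (b :* b) := m :* r) refl M w (B ↑ L) R ⟩
          M ⊗ R ∎
          where
          open ≡-Reasoning
          L = suc L′
          R = (√ ⋆ tail L) L

        -- The expression is of second order in B^L, hence the bound by q^(2L). The number 128 is 2
        -- · 4 · 16: coefficients grow like (16 W)^L, `⋆-bound` loses 4^L, and 2^L absorbs K and the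
        -- constants.
        ξ-square : ∀ K → ∃ λ L₀ → ∀ L → L₀ ≤ L → K * N (M ⊗ (ξ L ⊗ ξ L) ⊖ (M ⊕ w) ⊗ (B ↑ L ⊗ B ↑ L)) ≤ q ^ L * q ^ L
        ξ-square K = suc (K * C) , bound
          where
          C = N M * (4 * (16 * A))
          bound : ∀ L → suc (K * C) ≤ L → K * N (M ⊗ (ξ L ⊗ ξ L) ⊖ (M ⊕ w) ⊗ (B ↑ L ⊗ B ↑ L)) ≤ q ^ L * q ^ L
          bound (suc L′) (s≤s le) = begin
            K * N (M ⊗ (ξ L ⊗ ξ L) ⊖ (M ⊕ w) ⊗ (B ↑ L ⊗ B ↑ L)) ≡⟨ cong (λ t → K * N t) (ξ-square-tail L′) ⟩
            K * N (M ⊗ (√ ⋆ tail L) L) ≤⟨ *-monoʳ-≤ K (N⊗≤ ≤-refl (⋆-bound {A} L {C = 4} {E = 16 * A * q ^ L} (N-term hw 1) (tail-bound L))) ⟩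
            K * (N M * (4 ^ L * (4 * (16 * A * q ^ L) * A ^ L))) ≡⟨ lemma K (N M) (4 ^ L) A (q ^ L) (A ^ L) ⟩
            K * C * (4 ^ L * A ^ L) * q ^ L ≤⟨ *-monoˡ-≤ (q ^ L) (*-monoˡ-≤ (4 ^ L * A ^ L) (≤-trans (m≤n⇒m≤1+n le) (n≤2^n L))) ⟩
            2 ^ L * (4 ^ L * A ^ L) * q ^ L
              ≡⟨ cong (_* q ^ L) (trans (cong (2 ^ L *_) (sym (*-^ 4 A L))) (sym (*-^ 2 (4 * A) L))) ⟩
            (2 * (4 * A)) ^ L * q ^ L ≤⟨ *-monoˡ-≤ (q ^ L) (^-monoˡ-≤ L (≤-trans (≤-reflexive (lemma₂ W)) hW)) ⟩
            q ^ L * q ^ L ∎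
            where
            open ≤-Reasoning
            L = suc L′
            lemma : ∀ K m x A y z → K * (m * (x * (4 * (16 * A * y) * z))) ≡ K * (m * (4 * (16 * A))) * (x * z) * y
            lemma = solve-∀
            lemma₂ : ∀ W → 2 * (4 * (16 * W)) ≡ 128 * W
            lemma₂ = solve-∀

  -- Divided differences of powers at the nodes 0, a, b

  module DividedDifferences (𝓡 : NormedRing) (a b : NormedRing.Carrier 𝓡) where
    open Ring 𝓡

    δ₀ : ℕ → Carrier
    δ₀ zero = 𝟙
    δ₀ (suc _) = 𝟘

    -- dd n₀ n₁ n₂ m is the divided difference of wᵐ at n₀ nodes 0, n₁ nodes a and n₂ nodes b.
    dd : ℕ → ℕ → ℕ → ℕ → Carrier
    dd (suc n₀) n₁ n₂ zero = δ₀ (n₀ + n₁ + n₂)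
    dd (suc n₀) n₁ n₂ (suc m) = dd n₀ n₁ n₂ m
    dd zero (suc n₁) n₂ zero = δ₀ (n₁ + n₂)
    dd zero (suc n₁) n₂ (suc m) = a ⊗ dd zero (suc n₁) n₂ m ⊕ dd zero n₁ n₂ m
    dd zero zero (suc n₂) zero = δ₀ n₂
    dd zero zero (suc n₂) (suc m) = b ⊗ dd zero zero (suc n₂) m ⊕ dd zero zero n₂ m
    dd zero zero zero m = 𝟘

    dd-zero : ∀ n₀ n₁ n₂ {k} → n₀ + n₁ + n₂ ≡ suc k → dd n₀ n₁ n₂ 0 ≡ δ₀ k
    dd-zero (suc n₀) n₁ n₂ h = cong δ₀ (suc-injective h)
    dd-zero zero (suc n₁) n₂ h = cong δ₀ (suc-injective h)
    dd-zero zero zero (suc n₂) h = cong δ₀ (suc-injective h)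

    +-suc₁ : ∀ x y z → x + suc y + z ≡ suc (x + y + z)
    +-suc₁ x y z = cong (_+ z) (+-suc x y)

    -- The recursion of `dd` removes nodes in a fixed order. This rule and `leibniz₂` say that any
    -- node may be removed first, as for the factor w in w · wᵐ.
    leibniz₁ : ∀ n₀ n₁ n₂ m → dd n₀ (suc n₁) n₂ (suc m) ≡ a ⊗ dd n₀ (suc n₁) n₂ m ⊕ dd n₀ n₁ n₂ m
    leibniz₁ zero n₁ n₂ m = refl
    leibniz₁ (suc n₀) n₁ n₂ zero = trans (dd-zero n₀ (suc n₁) n₂ (+-suc₁ n₀ n₁ n₂))
      (trans (solve 2 (λ a x → x := a :* con (+ 0) :+ x) refl a _)
        (cong (λ t → a ⊗ t ⊕ δ₀ (n₀ + n₁ + n₂)) (sym (cong δ₀ (+-suc₁ n₀ n₁ n₂)))))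
    leibniz₁ (suc n₀) n₁ n₂ (suc m) = leibniz₁ n₀ n₁ n₂ m

    leibniz₂ : ∀ n₀ n₁ n₂ m → dd n₀ n₁ (suc n₂) (suc m) ≡ b ⊗ dd n₀ n₁ (suc n₂) m ⊕ dd n₀ n₁ n₂ m
    leibniz₂ zero zero n₂ m = refl
    leibniz₂ zero (suc n₁) n₂ zero = begin
      a ⊗ δ₀ (n₁ + suc n₂) ⊕ dd 0 n₁ (suc n₂) 0 ≡⟨ cong₂ (λ s t → a ⊗ δ₀ s ⊕ t) (+-suc n₁ n₂) (dd-zero 0 n₁ (suc n₂) (+-suc n₁ n₂)) ⟩
      a ⊗ 𝟘 ⊕ δ₀ (n₁ + n₂) ≡⟨ solve 3 (λ a b x → a :* con (+ 0) :+ x := b :* con (+ 0) :+ x) refl a b _ ⟩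
      b ⊗ 𝟘 ⊕ δ₀ (n₁ + n₂) ≡⟨ cong (λ t → b ⊗ δ₀ t ⊕ δ₀ (n₁ + n₂)) (sym (+-suc n₁ n₂)) ⟩
      b ⊗ δ₀ (n₁ + suc n₂) ⊕ δ₀ (n₁ + n₂) ∎
      where open ≡-Reasoning
    leibniz₂ zero (suc n₁) n₂ (suc m) = trans (cong₂ (λ s t → a ⊗ s ⊕ t) (leibniz₂ zero (suc n₁) n₂ m) (leibniz₂ zero n₁ n₂ m))
      (solve 6 (λ a b x y z w → a :* (b :* x :+ y) :+ (b :* z :+ w) := b :* (a :* x :+ z) :+ (a :* y :+ w)) refl a b _ _ _ _)
    leibniz₂ (suc n₀) n₁ n₂ zero = trans (dd-zero n₀ n₁ (suc n₂) (+-suc (n₀ + n₁) n₂))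
      (trans (solve 2 (λ b x → x := b :* con (+ 0) :+ x) refl b _)
        (cong (λ t → b ⊗ t ⊕ δ₀ (n₀ + n₁ + n₂)) (sym (cong δ₀ (+-suc (n₀ + n₁) n₂)))))
    leibniz₂ (suc n₀) n₁ n₂ (suc m) = leibniz₂ n₀ n₁ n₂ m

    -- An additional node 0 lowers the exponent by one, so Newton's recurrence against the node 0 is
    -- an instance of the Leibniz rule.
    newton₀₁ : ∀ n₀ n₁ n₂ m → dd n₀ (suc n₁) n₂ m ≡ a ⊗ dd (suc n₀) (suc n₁) n₂ m ⊕ dd (suc n₀) n₁ n₂ m
    newton₀₁ n₀ n₁ n₂ m = leibniz₁ (suc n₀) n₁ n₂ m

    newton₀₂ : ∀ n₀ n₁ n₂ m → dd n₀ n₁ (suc n₂) m ≡ b ⊗ dd (suc n₀) n₁ (suc n₂) m ⊕ dd (suc n₀) n₁ n₂ m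
    newton₀₂ n₀ n₁ n₂ m = leibniz₂ (suc n₀) n₁ n₂ m

    newton₁₂ : ∀ n₀ n₁ n₂ m → dd n₀ n₁ (suc n₂) m ≡ (b ⊖ a) ⊗ dd n₀ (suc n₁) (suc n₂) m ⊕ dd n₀ (suc n₁) n₂ m
    newton₁₂ n₀ n₁ n₂ m = begin
      y ≡⟨ solve 3 (λ a x y → y := a :* x :+ y :- a :* x) refl a x y ⟩
      a ⊗ x ⊕ y ⊖ a ⊗ x ≡⟨ cong (_⊖ a ⊗ x) (trans (sym (leibniz₁ n₀ n₁ (suc n₂) m)) (leibniz₂ n₀ (suc n₁) n₂ m)) ⟩
      b ⊗ x ⊕ z ⊖ a ⊗ x ≡⟨ solve 4 (λ a b x z → b :* x :+ z :- a :* x := (b :- a) :* x :+ z) refl a b x z ⟩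
      (b ⊖ a) ⊗ x ⊕ z ∎
      where
      open ≡-Reasoning
      x = dd n₀ (suc n₁) (suc n₂) m
      y = dd n₀ n₁ (suc n₂) m
      z = dd n₀ (suc n₁) n₂ m

    dd-vanish : ∀ n₀ n₁ n₂ m → suc m < n₀ + n₁ + n₂ → dd n₀ n₁ n₂ m ≡ 𝟘
    dd-vanish n₀ n₁ n₂ zero h with n₀ + n₁ + n₂ in eq
    ... | suc (suc k) = dd-zero n₀ n₁ n₂ eq
    ... | suc zero = contradiction h λ { (s≤s ()) }
    dd-vanish (suc n₀) n₁ n₂ (suc m) (s≤s h) = dd-vanish n₀ n₁ n₂ m h
    dd-vanish zero (suc n₁) n₂ (suc m) (s≤s h) = trans
      (cong₂ (λ s t → a ⊗ s ⊕ t) (dd-vanish zero (suc n₁) n₂ m (m<n⇒m<1+n h)) (dd-vanish zero n₁ n₂ m h))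
      (solve 1 (λ a → a :* con (+ 0) :+ con (+ 0) := con (+ 0)) refl a)
    dd-vanish zero zero (suc n₂) (suc m) (s≤s h) = trans
      (cong₂ (λ s t → b ⊗ s ⊕ t) (dd-vanish zero zero (suc n₂) m (m<n⇒m<1+n h)) (dd-vanish zero zero n₂ m h))
      (solve 1 (λ a → a :* con (+ 0) :+ con (+ 0) := con (+ 0)) refl b)

    module _ {W} (W>0 : 1 ≤ W) (ha : N a ≤ W) (hb : N b ≤ W) where

      N-δ₀ : ∀ k → N (δ₀ k) * W ^ suc k ≤ 4 * W * 1
      N-δ₀ zero = ≤-trans (≤-reflexive (cong (_* (W * 1)) N-𝟙)) (≤-trans (*-monoˡ-≤ (W * 1) {1} {4} (s≤s z≤n)) (≤-reflexive (lemma W)))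
        where
        lemma : ∀ W → 4 * (W * 1) ≡ 4 * W * 1
        lemma = solve-∀
      N-δ₀ (suc k) = ≤-trans (≤-reflexive (cong (_* W ^ suc (suc k)) N-𝟘)) z≤n

      dd-bound-step : ∀ {w x y} m s → N w ≤ W → N x * W ^ suc s ≤ (4 * W) ^ suc m → N y * W ^ s ≤ (4 * W) ^ suc m →
        N (w ⊗ x ⊕ y) * W ^ suc s ≤ (4 * W) ^ suc (suc m)
      dd-bound-step {w} {x} {y} m s hw hx hy = begin
        N (w ⊗ x ⊕ y) * (W * W ^ s) ≤⟨ *-monoˡ-≤ (W * W ^ s) (N⊕≤ (N⊗≤ hw ≤-refl) ≤-refl) ⟩
        2 * (W * N x + N y) * (W * W ^ s) ≡⟨ lemma W (N x) (N y) (W ^ s) ⟩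
        2 * W * (N x * (W * W ^ s) + N y * W ^ s) ≤⟨ *-monoʳ-≤ (2 * W) (+-mono-≤ hx hy) ⟩
        2 * W * ((4 * W) ^ suc m + (4 * W) ^ suc m) ≡⟨ lemma₂ W ((4 * W) ^ suc m) ⟩
        (4 * W) ^ suc (suc m) ∎
        where
        open ≤-Reasoning
        lemma : ∀ W x y z → 2 * (W * x + y) * (W * z) ≡ 2 * W * (x * (W * z) + y * z)
        lemma = solve-∀
        lemma₂ : ∀ W x → 2 * W * (x + x) ≡ 4 * W * x
        lemma₂ = solve-∀

      -- A divided difference of wᵐ at n nodes is the complete homogeneous polynomial of degree m +
      -- 1 - n in the nodes, hence of size W^(m + 1 - n) up to a constant power; multiplying by W^n
      -- avoids the negative exponent.
      dd-bound : ∀ n₀ n₁ n₂ m → N (dd n₀ n₁ n₂ m) * W ^ (n₀ + n₁ + n₂) ≤ (4 * W) ^ suc m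
      dd-bound (suc n₀) n₁ n₂ zero = N-δ₀ (n₀ + n₁ + n₂)
      dd-bound zero (suc n₁) n₂ zero = N-δ₀ (n₁ + n₂)
      dd-bound zero zero (suc n₂) zero = N-δ₀ n₂
      dd-bound zero zero zero m = ≤-trans (≤-reflexive (cong (_* 1) N-𝟘)) z≤n
      dd-bound (suc n₀) n₁ n₂ (suc m) = begin
        x * (W * W ^ s) ≡⟨ lemma x W (W ^ s) ⟩
        W * (x * W ^ s) ≤⟨ *-monoˡ-≤ (x * W ^ s) (m≤n*m W 4) ⟩
        4 * W * (x * W ^ s) ≤⟨ *-monoʳ-≤ (4 * W) (dd-bound n₀ n₁ n₂ m) ⟩
        (4 * W) ^ suc (suc m) ∎
        where
        open ≤-Reasoning
        x = N (dd n₀ n₁ n₂ m)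
        s = n₀ + n₁ + n₂
        lemma : ∀ x W y → x * (W * y) ≡ W * (x * y)
        lemma = solve-∀
      dd-bound zero (suc n₁) n₂ (suc m) = dd-bound-step m (n₁ + n₂) ha (dd-bound zero (suc n₁) n₂ m) (dd-bound zero n₁ n₂ m)
      dd-bound zero zero (suc n₂) (suc m) = dd-bound-step m n₂ hb (dd-bound zero zero (suc n₂) m) (dd-bound zero zero n₂ m)

    -- The divided difference of wᵐ at j nodes w.
    confluent : Carrier → ℕ → ℕ → Carrier
    confluent w zero m = 𝟘
    confluent w (suc j) zero = δ₀ j
    confluent w (suc j) (suc m) = w ⊗ confluent w (suc j) m ⊕ confluent w j m

    dd-confluent₁ : ∀ j m → dd 0 j 0 m ≡ confluent a j m
    dd-confluent₁ zero m = refl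
    dd-confluent₁ (suc j) zero = cong δ₀ (+-identityʳ j)
    dd-confluent₁ (suc j) (suc m) = cong₂ (λ s t → a ⊗ s ⊕ t) (dd-confluent₁ (suc j) m) (dd-confluent₁ j m)

    dd-confluent₂ : ∀ j m → dd 0 0 j m ≡ confluent b j m
    dd-confluent₂ zero m = refl
    dd-confluent₂ (suc j) zero = refl
    dd-confluent₂ (suc j) (suc m) = cong₂ (λ s t → b ⊗ s ⊕ t) (dd-confluent₂ (suc j) m) (dd-confluent₂ j m)

    confluent-vanish : ∀ w j m → m < j → confluent w (suc j) m ≡ 𝟘
    confluent-vanish w (suc j) zero h = refl
    confluent-vanish w (suc j) (suc m) (s≤s h) = trans
      (cong₂ (λ s t → w ⊗ s ⊕ t) (confluent-vanish w (suc j) m (m<n⇒m<1+n h)) (confluent-vanish w j m h))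
      (solve 1 (λ a → a :* con (+ 0) :+ con (+ 0) := con (+ 0)) refl w)

    -- With a single point as node the divided difference is the divided derivative of the power.
    confluent-P : ∀ w j i → confluent w (suc j) (j + i) ≡ ι (+ P j i) ⊗ w ↑ i
    confluent-P w zero zero = solve 0 (con (+ 1) := con (+ 1) :* con (+ 1)) refl
    confluent-P w zero (suc i) = trans (cong (λ t → w ⊗ t ⊕ 𝟘) (confluent-P w zero i))
      (solve 2 (λ w x → w :* (con (+ 1) :* x) :+ con (+ 0) := con (+ 1) :* (w :* x)) refl w _)
    confluent-P w (suc j) zero = trans (cong₂ (λ s t → w ⊗ s ⊕ t)
        (trans (cong (confluent w (suc (suc j))) (+-identityʳ j)) (confluent-vanish w (suc j) j (n<1+n j))) (trans (confluent-P w j zero)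
          (cong (λ t → ι (+ t) ⊗ 𝟙) (P-zero j))))
      (solve 1 (λ w → w :* con (+ 0) :+ con (+ 1) :* con (+ 1) := con (+ 1) :* con (+ 1)) refl w)
    confluent-P w (suc j) (suc i) = begin
      w ⊗ confluent w (suc (suc j)) (j + suc i) ⊕ confluent w (suc j) (j + suc i)
        ≡⟨ cong₂ (λ s t → w ⊗ s ⊕ t) (trans (cong (confluent w (suc (suc j))) (+-suc j i)) (confluent-P w (suc j) i)) (confluent-P w j (suc i)) ⟩
      w ⊗ (ι (+ P (suc j) i) ⊗ w ↑ i) ⊕ ι (+ P j (suc i)) ⊗ (w ⊗ w ↑ i)
        ≡⟨ solve 4 (λ w x y z → w :* (x :* y) :+ z :* (w :* y) := (z :+ x) :* (w :* y)) refl w _ _ _ ⟩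
      (ι (+ P j (suc i)) ⊕ ι (+ P (suc j) i)) ⊗ (w ⊗ w ↑ i) ≡⟨ cong (_⊗ (w ⊗ w ↑ i)) (sym (ι-+ (+ P j (suc i)) (+ P (suc j) i))) ⟩
      ι (+ P (suc j) (suc i)) ⊗ (w ⊗ w ↑ i) ∎
      where open ≡-Reasoning

  -- The forms at the true square roots, and their Taylor expansion

  module Comparison (𝓡 : NormedRing) (a c : NormedRing.Carrier 𝓡) (ρ : ℕ) where
    open Ring 𝓡
    open Forms 𝓡 hiding (b; ν; T)

    b : Carrier
    b = Forms.b 𝓡 a c ρ

    ν T : ℕ
    ν = Forms.ν 𝓡 a c ρ
    T = Forms.T 𝓡 a c ρ

    M : Carrier
    M = a ⊗ b ⊗ c

    open Series 𝓡 M
    open DividedDifferences 𝓡 a b using (dd)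
    module DD = DividedDifferences 𝓡 a b
    module Form′ = Form a c ρ

    -- The divided difference of (1 + w/M)^(ν + 1/2) at nodes w = 0, a, b, expanded in powers of
    -- 1/B.
    S : ℕ → ℕ → ℕ → ℕ → Carrier
    S n₀ n₁ n₂ = Ev (λ m → ι (β (suc ν) m) ⊗ dd n₀ n₁ n₂ m)

    S-combination : ∀ x (f g h : ℕ → Carrier) → (∀ m → f m ≡ x ⊗ g m ⊕ h m) → ∀ L →
      Ev (λ m → ι (β (suc ν) m) ⊗ f m) L ≡ x ⊗ Ev (λ m → ι (β (suc ν) m) ⊗ g m) L ⊕ Ev (λ m → ι (β (suc ν) m) ⊗ h m) L
    S-combination x f g h eq L = trans
      (Ev-cong (λ m → trans (cong (ι (β (suc ν) m) ⊗_) (eq m))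
        (solve 4 (λ b x g h → b :* (x :* g :+ h) := x :* (b :* g) :+ b :* h) refl (ι (β (suc ν) m)) x (g m) (h m))) L)
      (Ev-linear x (λ m → ι (β (suc ν) m) ⊗ g m) (λ m → ι (β (suc ν) m) ⊗ h m) L)

    unit : Carrier
    unit = (a ⊗ b) ↑ ν ⊗ B ↑ ν

    -- The expected value of the form at the true roots. Its series begins with the power B^(-3ν)
    -- when there are 3ν + 1 nodes, because divided differences of lower powers vanish. As ab has
    -- size |k|² and B has size |k|⁵, the product (ab)^ν B^ν B^(-3ν) has size |k|^(-8ν).
    main : ℕ → ℕ → ℕ → ℕ → Carrier
    main n₀ n₁ n₂ L = 𝟚 ↑ (n₁ + n₂) ⊗ unit ⊗ S n₀ n₁ n₂ L

    main₀₁ : ∀ n₀ n₁ n₂ L → main n₀ (suc n₁) n₂ L ≡ a ⊗ main (suc n₀) (suc n₁) n₂ L ⊕ 𝟚 ⊗ main (suc n₀) n₁ n₂ L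
    main₀₁ n₀ n₁ n₂ L = trans
      (cong (𝟚 ↑ suc (n₁ + n₂) ⊗ unit ⊗_) (S-combination a (dd n₀ (suc n₁) n₂) (dd (suc n₀) (suc n₁) n₂) (dd (suc n₀) n₁ n₂) (DD.newton₀₁ n₀ n₁ n₂) L))
      (solve 5 (λ t u a x y → con (+ 2) :* t :* u :* (a :* x :+ y) := a :* (con (+ 2) :* t :* u :* x) :+ con (+ 2) :* (t :* u :* y))
        refl (𝟚 ↑ (n₁ + n₂)) unit a _ _)

    main₀₂ : ∀ n₀ n₁ n₂ L → main n₀ n₁ (suc n₂) L ≡ b ⊗ main (suc n₀) n₁ (suc n₂) L ⊕ 𝟚 ⊗ main (suc n₀) n₁ n₂ L
    main₀₂ n₀ n₁ n₂ L rewrite +-suc n₁ n₂ = trans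
      (cong (𝟚 ↑ suc (n₁ + n₂) ⊗ unit ⊗_) (S-combination b (dd n₀ n₁ (suc n₂)) (dd (suc n₀) n₁ (suc n₂)) (dd (suc n₀) n₁ n₂) (DD.newton₀₂ n₀ n₁ n₂) L))
      (solve 5 (λ t u a x y → con (+ 2) :* t :* u :* (a :* x :+ y) := a :* (con (+ 2) :* t :* u :* x) :+ con (+ 2) :* (t :* u :* y))
        refl (𝟚 ↑ (n₁ + n₂)) unit b _ _)

    main₁₂ : ∀ n₀ n₁ n₂ L → main n₀ n₁ (suc n₂) L ≡ main n₀ (suc n₁) (suc n₂) L ⊕ main n₀ (suc n₁) n₂ L
    main₁₂ n₀ n₁ n₂ L rewrite +-suc n₁ n₂ = trans
      (cong (𝟚 ↑ suc (n₁ + n₂) ⊗ unit ⊗_) (S-combination (b ⊖ a) (dd n₀ n₁ (suc n₂)) (dd n₀ (suc n₁) (suc n₂)) (dd n₀ (suc n₁) n₂) (DD.newton₁₂ n₀ n₁ n₂) L))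
      (solve 5 (λ t u a x y → con (+ 2) :* t :* u :* (((a :+ con (+ 2)) :- a) :* x :+ y) := con (+ 2) :* (con (+ 2) :* t) :* u :* x :+ con (+ 2) :* t :* u :* y)
        refl (𝟚 ↑ (n₁ + n₂)) unit a _ _)

    -- These arguments make abζ : aη₁ : bη₂ approximate 1 : √((M + a)/M) : √((M + b)/M), the ratio
    -- of the true roots.
    J∞ : ℕ → ℕ → ℕ → ℕ → Carrier
    J∞ n₀ n₁ n₂ L = Form′.J (B ↑ L) (b ⊗ ξ a L) (a ⊗ ξ b L) n₀ n₁ n₂

    Δ : ℕ → ℕ → ℕ → ℕ → Carrier
    Δ n₀ n₁ n₂ L = J∞ n₀ n₁ n₂ L ⊖ main n₀ n₁ n₂ L

    Δ-combination : ∀ {x y z x′ y′ z′} δ μ → x ≡ δ ⊗ y ⊕ μ ⊗ z → x′ ≡ δ ⊗ y′ ⊕ μ ⊗ z′ →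
      (x ⊖ x′) ⊕ neg μ ⊗ (z ⊖ z′) ≡ δ ⊗ (y ⊖ y′)
    Δ-combination {y = y} {z} {y′ = y′} {z′} δ μ refl refl =
      solve 6 (λ δ μ y z y′ z′ → (δ :* y :+ μ :* z :- (δ :* y′ :+ μ :* z′)) :+ :- μ :* (z :- z′) := δ :* (y :- y′)) refl δ μ y z y′ z′

    module _ {W} (W>0 : 1 ≤ W) (ha : N a ≤ W) (hb : N b ≤ W) (hW : 128 * W ≤ q) (a>0 : 1 ≤ N a) (b>0 : 1 ≤ N b) where

      -- With all nodes at 0 only the single coefficient m = i survives. The root at abc needs no
      -- approximation, so the difference is exactly 0 from L = i on.
      negl-axis₀ : ∀ i → i ≤ ν → Negligible (Δ (suc i) 0 0)
      negl-axis₀ i i≤ν = negl-eventually i (λ L i≤L → sym (eq L i≤L)) negl-𝟘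
        where
        eq : ∀ L → i ≤ L → Δ (suc i) 0 0 L ≡ 𝟘
        eq L i≤L = begin
          Form′.J (B ↑ L) (b ⊗ ξ a L) (a ⊗ ξ b L) (suc i) 0 0 ⊖ 𝟙 ⊗ unit ⊗ S (suc i) 0 0 L
            ≡⟨ cong₂ (λ s t → 𝟙 ⊗ s ⊗ b ↑ ρ ⊗ (γ ν i ⊗ (b ⊗ c) ↑ (ν ∸ i) ⊗ (b ⊗ B ↑ L)) ⊖ 𝟙 ⊗ unit ⊗ t) exponent series ⟩
          𝟙 ⊗ (a ↑ ν ⊗ a ↑ (ν ∸ i)) ⊗ b ↑ ρ ⊗ (ι (+ 4) ↑ (ν ∸ i) ⊗ x ⊗ (b ⊗ c) ↑ (ν ∸ i) ⊗ (b ⊗ B ↑ L)) ⊖ 𝟙 ⊗ unit ⊗ (x ⊗ B ↑ (L ∸ i))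
            ≡⟨ cong₂ _⊖_ (solve 8 (λ aν ai bρ f x bc b BL → con (+ 1) :* (aν :* ai) :* bρ :* (f :* x :* bc :* (b :* BL))
                  := aν :* (b :* bρ) :* x :* (f :* (ai :* bc)) :* BL) refl (a ↑ ν) (a ↑ (ν ∸ i)) (b ↑ ρ) _ x _ b (B ↑ L))
               (cong (λ t → 𝟙 ⊗ (t ⊗ B ↑ ν) ⊗ (x ⊗ B ↑ (L ∸ i))) (↑-⊗ a b ν)) ⟩
          a ↑ ν ⊗ b ↑ ν ⊗ x ⊗ (ι (+ 4) ↑ (ν ∸ i) ⊗ (a ↑ (ν ∸ i) ⊗ (b ⊗ c) ↑ (ν ∸ i))) ⊗ B ↑ L ⊖ 𝟙 ⊗ (a ↑ ν ⊗ b ↑ ν ⊗ B ↑ ν) ⊗ (x ⊗ B ↑ (L ∸ i))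
            ≡⟨ cong₂ (λ s t → a ↑ ν ⊗ b ↑ ν ⊗ x ⊗ s ⊗ t ⊖ 𝟙 ⊗ (a ↑ ν ⊗ b ↑ ν ⊗ B ↑ ν) ⊗ (x ⊗ B ↑ (L ∸ i))) B-power
                 (trans (cong (B ↑_) (sym (m+[n∸m]≡n i≤L))) (↑-+ B i (L ∸ i))) ⟩
          a ↑ ν ⊗ b ↑ ν ⊗ x ⊗ B ↑ (ν ∸ i) ⊗ (B ↑ i ⊗ B ↑ (L ∸ i)) ⊖ 𝟙 ⊗ (a ↑ ν ⊗ b ↑ ν ⊗ B ↑ ν) ⊗ (x ⊗ B ↑ (L ∸ i))
            ≡⟨ cong (λ t → a ↑ ν ⊗ b ↑ ν ⊗ x ⊗ B ↑ (ν ∸ i) ⊗ (B ↑ i ⊗ B ↑ (L ∸ i)) ⊖ 𝟙 ⊗ (a ↑ ν ⊗ b ↑ ν ⊗ t) ⊗ (x ⊗ B ↑ (L ∸ i)))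
                 (trans (cong (B ↑_) (sym (m∸n+n≡m i≤ν))) (↑-+ B (ν ∸ i) i)) ⟩
          a ↑ ν ⊗ b ↑ ν ⊗ x ⊗ B ↑ (ν ∸ i) ⊗ (B ↑ i ⊗ B ↑ (L ∸ i)) ⊖ 𝟙 ⊗ (a ↑ ν ⊗ b ↑ ν ⊗ (B ↑ (ν ∸ i) ⊗ B ↑ i)) ⊗ (x ⊗ B ↑ (L ∸ i))
            ≡⟨ solve 6 (λ a b x u v w → a :* b :* x :* u :* (v :* w) :- con (+ 1) :* (a :* b :* (u :* v)) :* (x :* w) := con (+ 0))
                 refl (a ↑ ν) (b ↑ ν) x (B ↑ (ν ∸ i)) (B ↑ i) (B ↑ (L ∸ i)) ⟩
          𝟘 ∎
          where
          open ≡-Reasoning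
          x = ι (β (suc ν) i)
          exponent : a ↑ (T ∸ suc (i + 0)) ≡ a ↑ ν ⊗ a ↑ (ν ∸ i)
          exponent = trans (cong (a ↑_) (trans (cong₂ _∸_ (+-comm (ν + ν) 1) (cong suc (+-identityʳ i))) (+-∸-assoc ν i≤ν))) (↑-+ a ν (ν ∸ i))
          B-power : ι (+ 4) ↑ (ν ∸ i) ⊗ (a ↑ (ν ∸ i) ⊗ (b ⊗ c) ↑ (ν ∸ i)) ≡ B ↑ (ν ∸ i)
          B-power = trans (cong (ι (+ 4) ↑ (ν ∸ i) ⊗_) (sym (↑-⊗ a (b ⊗ c) (ν ∸ i)))) (trans (sym (↑-⊗ (ι (+ 4)) (a ⊗ (b ⊗ c)) (ν ∸ i)))
            (cong (_↑ (ν ∸ i)) (solve 3 (λ a b c → con (+ 4) :* (a :* (b :* c)) := con (+ 4) :* (a :* b :* c)) refl a b c)))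
          dd-high : ∀ i m → dd (suc i) 0 0 (i + suc m) ≡ 𝟘
          dd-high zero m = dd-0 m
            where
            dd-0 : ∀ m → dd 0 0 0 m ≡ 𝟘
            dd-0 zero = refl
            dd-0 (suc m) = refl
          dd-high (suc i) m = dd-high i m
          dd-peak : ∀ i → dd (suc i) 0 0 (i + 0) ≡ 𝟙
          dd-peak zero = refl
          dd-peak (suc i) = dd-peak i
          series : S (suc i) 0 0 L ≡ x ⊗ B ↑ (L ∸ i)
          series = begin
            S (suc i) 0 0 L ≡⟨ cong (S (suc i) 0 0) (sym (m+[n∸m]≡n i≤L)) ⟩
            S (suc i) 0 0 (i + (L ∸ i)) ≡⟨ Ev-skip _ i (λ m m<i → trans (cong (ι (β (suc ν) m) ⊗_) (DD.dd-vanish (suc i) 0 0 m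
                (s≤s (≤-trans m<i (≤-reflexive (sym (trans (+-identityʳ (i + 0)) (+-identityʳ i)))))))) (⊗-zeroʳ _)) (L ∸ i) ⟩
            Ev (λ m → ι (β (suc ν) (i + m)) ⊗ dd (suc i) 0 0 (i + m)) (L ∸ i)
              ≡⟨ Ev-single _ (λ m → trans (cong (ι (β (suc ν) (i + suc m)) ⊗_) (dd-high i m)) (⊗-zeroʳ _)) (L ∸ i) ⟩
            ι (β (suc ν) (i + 0)) ⊗ dd (suc i) 0 0 (i + 0) ⊗ B ↑ (L ∸ i)
              ≡⟨ cong₂ (λ s t → ι (β (suc ν) s) ⊗ t ⊗ B ↑ (L ∸ i)) (+-identityʳ i) (dd-peak i) ⟩
            x ⊗ 𝟙 ⊗ B ↑ (L ∸ i) ≡⟨ cong (_⊗ B ↑ (L ∸ i)) (⊗-identityʳ x) ⟩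
            x ⊗ B ↑ (L ∸ i) ∎

      -- By `confluent-P` and `β-P` the second series is a constant times the expansion of (1 +
      -- w/M)^(ν - j + 1/2), started j places late. `Ev-delay` removes the delay and `Ev-power`
      -- reduces the exponent to 1/2.
      negl-confluent : ∀ {w} → N w ≤ W → ∀ j → j ≤ ν →
        Negligible (λ L → γ ν j ⊗ (M ⊕ w) ↑ (ν ∸ j) ⊗ ξ w L ⊖ B ↑ ν ⊗ Ev (λ m → ι (β (suc ν) m) ⊗ DD.confluent w (suc j) m) L)
      negl-confluent {w} hw j j≤ν = negl-eventually j combine
        (negl-⊕ (negl-⊗ (neg (B ↑ μ ⊗ x)) (Ev-delay W>0 hw hW′ (suc μ) j)) (negl-⊗ (neg (ι (+ 4) ↑ μ ⊗ x)) (Ev-power W>0 hw hW′ μ)))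
        where
        open ≡-Reasoning
        μ = ν ∸ j
        x = ι (β (suc ν) j)
        hW′ : 32 * W ≤ q
        hW′ = ≤-trans (*-monoˡ-≤ W (m≤n+m 32 96)) hW
        exponent : suc μ + j ≡ suc ν
        exponent = cong suc (m∸n+n≡m j≤ν)
        series : ∀ L → j ≤ L → Ev (λ m → ι (β (suc ν) m) ⊗ DD.confluent w (suc j) m) L ≡ x ⊗ Ev (term w (suc μ)) (L ∸ j)
        series L j≤L = begin
          Ev f L ≡⟨ cong (Ev f) (sym (m+[n∸m]≡n j≤L)) ⟩
          Ev f (j + (L ∸ j)) ≡⟨ Ev-skip f j (λ m m<j → trans (cong (ι (β (suc ν) m) ⊗_) (DD.confluent-vanish w j m m<j)) (⊗-zeroʳ _)) (L ∸ j) ⟩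
          Ev (λ m → f (j + m)) (L ∸ j) ≡⟨ Ev-cong coefficient (L ∸ j) ⟩
          Ev (λ m → x ⊗ term w (suc μ) m) (L ∸ j) ≡⟨ Ev-scale x (term w (suc μ)) (L ∸ j) ⟩
          x ⊗ Ev (term w (suc μ)) (L ∸ j) ∎
          where
          f = λ m → ι (β (suc ν) m) ⊗ DD.confluent w (suc j) m
          coefficient : ∀ m → f (j + m) ≡ x ⊗ term w (suc μ) m
          coefficient m = begin
            ι (β (suc ν) (j + m)) ⊗ DD.confluent w (suc j) (j + m) ≡⟨ cong (ι (β (suc ν) (j + m)) ⊗_) (DD.confluent-P w j m) ⟩
            ι (β (suc ν) (j + m)) ⊗ (ι (+ P j m) ⊗ w ↑ m) ≡⟨ solve 3 (λ x y z → x :* (y :* z) := x :* y :* z) refl _ _ _ ⟩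
            ι (β (suc ν) (j + m)) ⊗ ι (+ P j m) ⊗ w ↑ m ≡⟨ cong (_⊗ w ↑ m) (sym (ι-* _ _)) ⟩
            ι (β (suc ν) (j + m) ℤ.* + P j m) ⊗ w ↑ m ≡⟨ cong (λ t → ι t ⊗ w ↑ m)
                (subst (λ p → β p (j + m) ℤ.* + P j m ≡ β p j ℤ.* β (suc μ) m) exponent (β-P (suc μ) j m)) ⟩
            ι (β (suc ν) j ℤ.* β (suc μ) m) ⊗ w ↑ m ≡⟨ cong (_⊗ w ↑ m) (ι-* _ _) ⟩
            x ⊗ ι (β (suc μ) m) ⊗ w ↑ m ≡⟨ solve 3 (λ x y z → x :* y :* z := x :* (y :* z)) refl _ _ _ ⟩
            x ⊗ term w (suc μ) m ∎
        combine : ∀ L → j ≤ L →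
          neg (B ↑ μ ⊗ x) ⊗ (B ↑ j ⊗ Ev (term w (suc μ)) (L ∸ j) ⊖ Ev (term w (suc μ)) L)
            ⊕ neg (ι (+ 4) ↑ μ ⊗ x) ⊗ (M ↑ μ ⊗ Ev (term w (suc μ)) L ⊖ (M ⊕ w) ↑ μ ⊗ Ev (term w 1) L)
          ≡ γ ν j ⊗ (M ⊕ w) ↑ μ ⊗ ξ w L ⊖ B ↑ ν ⊗ Ev (λ m → ι (β (suc ν) m) ⊗ DD.confluent w (suc j) m) L
        combine L j≤L = begin
          _ ≡⟨ cong (λ t → neg (t ⊗ x) ⊗ (B ↑ j ⊗ E′ ⊖ E) ⊕ neg (ι (+ 4) ↑ μ ⊗ x) ⊗ (M ↑ μ ⊗ E ⊖ (M ⊕ w) ↑ μ ⊗ ξ w L)) (↑-⊗ (ι (+ 4)) M μ) ⟩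
          neg (ι (+ 4) ↑ μ ⊗ M ↑ μ ⊗ x) ⊗ (B ↑ j ⊗ E′ ⊖ E) ⊕ neg (ι (+ 4) ↑ μ ⊗ x) ⊗ (M ↑ μ ⊗ E ⊖ (M ⊕ w) ↑ μ ⊗ ξ w L)
            ≡⟨ solve 8 (λ f m x bj E′ E p ξ → :- (f :* m :* x) :* (bj :* E′ :- E) :+ :- (f :* x) :* (m :* E :- p :* ξ)
                 := f :* x :* p :* ξ :- f :* m :* bj :* (x :* E′)) refl (ι (+ 4) ↑ μ) (M ↑ μ) x (B ↑ j) E′ E _ (ξ w L) ⟩
          γ ν j ⊗ (M ⊕ w) ↑ μ ⊗ ξ w L ⊖ ι (+ 4) ↑ μ ⊗ M ↑ μ ⊗ B ↑ j ⊗ (x ⊗ E′)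
            ≡⟨ cong₂ (λ s t → γ ν j ⊗ (M ⊕ w) ↑ μ ⊗ ξ w L ⊖ s ⊗ t)
                 (trans (cong (_⊗ B ↑ j) (sym (↑-⊗ (ι (+ 4)) M μ))) (trans (sym (↑-+ B μ j)) (cong (B ↑_) (m∸n+n≡m j≤ν)))) (sym (series L j≤L)) ⟩
          γ ν j ⊗ (M ⊕ w) ↑ μ ⊗ ξ w L ⊖ B ↑ ν ⊗ Ev (λ m → ι (β (suc ν) m) ⊗ DD.confluent w (suc j) m) L ∎
          where
          E′ = Ev (term w (suc μ)) (L ∸ j)
          E = Ev (term w (suc μ)) L

      axis-scale : ∀ {w v μ x} j → j ≤ ν → w ⊗ μ ≡ M ⊕ w → ∀ s t z →
        z ⊗ w ↑ (T ∸ suc j) ⊗ v ↑ ρ ⊗ (s ⊗ μ ↑ (ν ∸ j) ⊗ (v ⊗ x)) ⊖ z ⊗ (w ↑ ν ⊗ v ↑ ν ⊗ B ↑ ν) ⊗ t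
          ≡ z ⊗ w ↑ ν ⊗ v ↑ ν ⊗ (s ⊗ (M ⊕ w) ↑ (ν ∸ j) ⊗ x ⊖ B ↑ ν ⊗ t)
      axis-scale {w} {v} {μ} {x} j j≤ν h s t z = begin
        z ⊗ w ↑ (T ∸ suc j) ⊗ v ↑ ρ ⊗ (s ⊗ μ ↑ (ν ∸ j) ⊗ (v ⊗ x)) ⊖ z ⊗ (w ↑ ν ⊗ v ↑ ν ⊗ B ↑ ν) ⊗ t
          ≡⟨ cong (λ r → z ⊗ r ⊗ v ↑ ρ ⊗ (s ⊗ μ ↑ (ν ∸ j) ⊗ (v ⊗ x)) ⊖ z ⊗ (w ↑ ν ⊗ v ↑ ν ⊗ B ↑ ν) ⊗ t)
               (trans (cong (w ↑_) (trans (cong (_∸ suc j) (+-comm (ν + ν) 1)) (+-∸-assoc ν j≤ν))) (↑-+ w ν (ν ∸ j))) ⟩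
        z ⊗ (w ↑ ν ⊗ w ↑ (ν ∸ j)) ⊗ v ↑ ρ ⊗ (s ⊗ μ ↑ (ν ∸ j) ⊗ (v ⊗ x)) ⊖ z ⊗ (w ↑ ν ⊗ (v ⊗ v ↑ ρ) ⊗ B ↑ ν) ⊗ t
          ≡⟨ solve 10 (λ z wν wj vρ s μj v x B t → z :* (wν :* wj) :* vρ :* (s :* μj :* (v :* x)) :- z :* (wν :* (v :* vρ) :* B) :* t
               := z :* wν :* (v :* vρ) :* (s :* (wj :* μj) :* x :- B :* t)) refl z (w ↑ ν) (w ↑ (ν ∸ j)) (v ↑ ρ) s _ v x (B ↑ ν) t ⟩
        z ⊗ w ↑ ν ⊗ v ↑ ν ⊗ (s ⊗ (w ↑ (ν ∸ j) ⊗ μ ↑ (ν ∸ j)) ⊗ x ⊖ B ↑ ν ⊗ t)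
          ≡⟨ cong (λ r → z ⊗ w ↑ ν ⊗ v ↑ ν ⊗ (s ⊗ r ⊗ x ⊖ B ↑ ν ⊗ t)) (trans (sym (↑-⊗ w μ (ν ∸ j))) (cong (_↑ (ν ∸ j)) h)) ⟩
        z ⊗ w ↑ ν ⊗ v ↑ ν ⊗ (s ⊗ (M ⊕ w) ↑ (ν ∸ j) ⊗ x ⊖ B ↑ ν ⊗ t) ∎
        where open ≡-Reasoning

      negl-axis₁ : ∀ j → j ≤ ν → Negligible (Δ 0 (suc j) 0)
      negl-axis₁ j j≤ν = negl-cong (λ L → sym (trans
          (cong₂ (λ s t → 𝟚 ↑ suc j ⊗ a ↑ (T ∸ suc j) ⊗ b ↑ ρ ⊗ (γ ν j ⊗ (b ⊗ c ⊕ 𝟙) ↑ (ν ∸ j) ⊗ (b ⊗ ξ a L)) ⊖ s ⊗ t)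
            (cong₂ _⊗_ (cong (𝟚 ↑_) (+-identityʳ (suc j))) (cong (_⊗ B ↑ ν) (↑-⊗ a b ν)))
            (Ev-cong (λ m → cong (ι (β (suc ν) m) ⊗_) (DD.dd-confluent₁ (suc j) m)) L))
          (axis-scale j j≤ν (solve 3 (λ a b c → a :* (b :* c :+ con (+ 1)) := a :* b :* c :+ a) refl a b c) (γ ν j) _ (𝟚 ↑ suc j))))
        (negl-⊗ (𝟚 ↑ suc j ⊗ a ↑ ν ⊗ b ↑ ν) (negl-confluent ha j j≤ν))

      negl-axis₂ : ∀ j → j ≤ ν → Negligible (Δ 0 0 (suc j))
      negl-axis₂ j j≤ν = negl-cong (λ L → sym (trans
          (cong₂ (λ s t → 𝟚 ↑ suc j ⊗ b ↑ (T ∸ suc j) ⊗ a ↑ ρ ⊗ (γ ν j ⊗ (a ⊗ c ⊕ 𝟙) ↑ (ν ∸ j) ⊗ (a ⊗ ξ b L)) ⊖ s ⊗ t)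
            (cong (𝟚 ↑ suc j ⊗_) (cong (_⊗ B ↑ ν) (trans (↑-⊗ a b ν) (⊗-comm _ _))))
            (Ev-cong (λ m → cong (ι (β (suc ν) m) ⊗_) (DD.dd-confluent₂ (suc j) m)) L))
          (axis-scale j j≤ν (solve 3 (λ a b c → b :* (a :* c :+ con (+ 1)) := a :* b :* c :+ b) refl a b c) (γ ν j) _ (𝟚 ↑ suc j))))
        (negl-⊗ (𝟚 ↑ suc j ⊗ b ↑ ν ⊗ a ↑ ν) (negl-confluent hb j j≤ν))

      -- Both `J∞` and `main` satisfy Newton's recurrences with the same coefficients. Hence their
      -- difference does, and negligibility spreads from the three axes; dividing by a or b is
      -- harmless because the statement allows any constant.
      negl-Δ : ∀ n₀ n₁ n₂ → n₀ ≤ suc ν → n₁ ≤ suc ν → n₂ ≤ suc ν → n₀ + n₁ ≤ T → n₀ + n₂ ≤ T → 1 ≤ n₀ + n₁ + n₂ → Negligible (Δ n₀ n₁ n₂)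
      negl-Δ (suc i) zero zero (s≤s h₀) h₁ h₂ t₁ t₂ h = negl-axis₀ i h₀
      negl-Δ zero (suc j) zero h₀ (s≤s h₁) h₂ t₁ t₂ h = negl-axis₁ j h₁
      negl-Δ zero zero (suc l) h₀ h₁ (s≤s h₂) t₁ t₂ h = negl-axis₂ l h₂
      negl-Δ (suc i) (suc j) zero (s≤s h₀) h₁ h₂ t₁ t₂ h = negl-cancel a>0 (negl-cong
        (λ L → Δ-combination a 𝟚 (Form′.newton₀₁-base (B ↑ L) (b ⊗ ξ a L) (a ⊗ ξ b L) i j t₁) (main₀₁ i j 0 L))
        (negl-⊕ (negl-Δ i (suc j) zero (m≤n⇒m≤1+n h₀) h₁ h₂ (<⇒≤ t₁) (<⇒≤ t₂) (m≤n⇒m≤n+o 0 (m≤n⇒m≤o+n i (s≤s z≤n))))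
          (negl-⊗ (neg 𝟚) (negl-Δ (suc i) j zero (s≤s h₀) (<⇒≤ h₁) h₂ (≤-trans (+-monoʳ-≤ (suc i) (n≤1+n j)) t₁) t₂ (s≤s z≤n)))))
      negl-Δ (suc i) zero (suc l) (s≤s h₀) h₁ h₂ t₁ t₂ h = negl-cancel b>0 (negl-cong
        (λ L → Δ-combination b 𝟚 (Form′.newton₀₂-base (B ↑ L) (b ⊗ ξ a L) (a ⊗ ξ b L) i l h₀ t₂) (main₀₂ i 0 l L))
        (negl-⊕ (negl-Δ i 0 (suc l) (m≤n⇒m≤1+n h₀) h₁ h₂ (<⇒≤ t₁) (<⇒≤ t₂) (m≤n⇒m≤o+n (i + 0) (s≤s z≤n)))
          (negl-⊗ (neg 𝟚) (negl-Δ (suc i) 0 l (s≤s h₀) h₁ (<⇒≤ h₂) t₁ (≤-trans (+-monoʳ-≤ (suc i) (n≤1+n l)) t₂) (s≤s z≤n)))))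
      negl-Δ n₀ (suc j) (suc l) h₀ h₁ h₂ t₁ t₂ h = negl-cong
        (λ L → trans (Δ-combination 𝟙 𝟙 (one (Form′.newton₁₂ (B ↑ L) (b ⊗ ξ a L) (a ⊗ ξ b L) n₀ j l)) (one (main₁₂ n₀ j l L))) (⊗-identityˡ _))
        (negl-⊕ (negl-Δ n₀ j (suc l) h₀ (<⇒≤ h₁) h₂ (≤-trans (+-monoʳ-≤ n₀ (n≤1+n j)) t₁) t₂ (m≤n⇒m≤o+n (n₀ + j) (s≤s z≤n)))
          (negl-⊗ (neg 𝟙) (negl-Δ n₀ (suc j) l h₀ h₁ (<⇒≤ h₂) t₁ (≤-trans (+-monoʳ-≤ n₀ (n≤1+n l)) t₂) (m≤n⇒m≤n+o l (m≤n⇒m≤o+n n₀ (s≤s z≤n))))))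
        where
        one : ∀ {x y z} → x ≡ y ⊕ z → x ≡ 𝟙 ⊗ y ⊕ 𝟙 ⊗ z
        one {x} {y} {z} h = trans h (solve 2 (λ y z → y :+ z := con (+ 1) :* y :+ con (+ 1) :* z) refl y z)

  square-≤ : ∀ {m n} → m * m ≤ n * n → m ≤ n
  square-≤ {m} {n} h with m ≤? n
  ... | yes p = p
  ... | no p = contradiction h (<⇒≱ (*-mono-< (≰⇒> p) (≰⇒> p)))

  -- Linearity of the forms and smallness of the Taylor part

  module Estimate (𝓡 : NormedRing) (a c : NormedRing.Carrier 𝓡) (ρ : ℕ) where
    open Ring 𝓡
    open Forms 𝓡 hiding (b; ν; T)
    open Comparison 𝓡 a c ρ
    open Series 𝓡 M
    open DividedDifferences 𝓡 a b using (dd)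

    -- Serves to split the value at the triple of the solution, times B^L, into z times the value at
    -- the true roots and the value at the errors.
    form-combine : ∀ {u v ζ η₁ η₂ ζ′ η₁′ η₂′ ζ″ η₁″ η₂″} →
      v ⊗ ζ″ ≡ u ⊗ ζ ⊕ ζ′ → v ⊗ η₁″ ≡ u ⊗ η₁ ⊕ η₁′ → v ⊗ η₂″ ≡ u ⊗ η₂ ⊕ η₂′ →
      ∀ n₀ n₁ n₂ → v ⊗ Form′.J ζ″ η₁″ η₂″ n₀ n₁ n₂ ≡ u ⊗ Form′.J ζ η₁ η₂ n₀ n₁ n₂ ⊕ Form′.J ζ′ η₁′ η₂′ n₀ n₁ n₂
    form-combine {u} {v} {ζ} {η₁} {η₂} {ζ′} {η₁′} {η₂′} {ζ″} {η₁″} {η₂″} hζ h₁ h₂ = go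
      where
      combine-⊖ : ∀ {x y z x′ y′ z′} → v ⊗ x ≡ u ⊗ y ⊕ z → v ⊗ x′ ≡ u ⊗ y′ ⊕ z′ → v ⊗ (x ⊖ x′) ≡ u ⊗ (y ⊖ y′) ⊕ (z ⊖ z′)
      combine-⊖ {x} {y} {z} {x′} {y′} {z′} h h′ = trans (solve 3 (λ v x y → v :* (x :- y) := v :* x :- v :* y) refl v x x′)
        (trans (cong₂ _⊖_ h h′) (solve 5 (λ u y z y′ z′ → (u :* y :+ z) :- (u :* y′ :+ z′) := u :* (y :- y′) :+ (z :- z′)) refl u y z y′ z′))
      combine-⊗ : ∀ {x y z} s → v ⊗ x ≡ u ⊗ y ⊕ z → v ⊗ (s ⊗ x) ≡ u ⊗ (s ⊗ y) ⊕ s ⊗ z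
      combine-⊗ {x} {y} {z} s h = trans (solve 3 (λ v s x → v :* (s :* x) := s :* (v :* x)) refl v s x)
        (trans (cong (s ⊗_) h) (solve 4 (λ s u y z → s :* (u :* y :+ z) := u :* (s :* y) :+ s :* z) refl s u y z))
      combine-G : ∀ {μ X Y X′ Y′ X″ Y″} → v ⊗ X″ ≡ u ⊗ X ⊕ X′ → v ⊗ Y″ ≡ u ⊗ Y ⊕ Y′ →
        ∀ i j → v ⊗ G ν μ X″ Y″ i j ≡ u ⊗ G ν μ X Y i j ⊕ G ν μ X′ Y′ i j
      combine-G h h′ zero zero = solve 2 (λ u v → v :* con (+ 0) := u :* con (+ 0) :+ con (+ 0)) refl u v
      combine-G h h′ (suc i) zero = combine-⊗ _ h
      combine-G h h′ zero (suc j) = combine-⊗ _ h′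
      combine-G h h′ (suc i) (suc j) = combine-⊖ (combine-G h h′ i (suc j)) (combine-G h h′ (suc i) j)
      go : ∀ n₀ n₁ n₂ → v ⊗ Form′.J ζ″ η₁″ η₂″ n₀ n₁ n₂ ≡ u ⊗ Form′.J ζ η₁ η₂ n₀ n₁ n₂ ⊕ Form′.J ζ′ η₁′ η₂′ n₀ n₁ n₂
      go n₀ n₁ zero = combine-⊗ _ (combine-G (combine-⊗ b hζ) h₁ n₀ n₁)
      go n₀ zero (suc n₂) = combine-⊗ _ (combine-G (combine-⊗ a hζ) h₂ n₀ (suc n₂))
      go n₀ (suc n₁) (suc n₂) = combine-⊖ (go n₀ n₁ (suc n₂)) (go n₀ (suc n₁) n₂)

    module _ {W} (W>0 : 1 ≤ W) (ha : N a ≤ W) (hb : N b ≤ W) (hW : 256 * W ≤ q) where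

      -- The first s coefficients vanish, so only q^l remains of q^(s + l). This gain of q^s makes
      -- the forms small.
      S-bound : ∀ n₀ n₁ n₂ s → n₀ + n₁ + n₂ ≡ suc s → ∀ l →
        N (S n₀ n₁ n₂ (s + l)) ≤ 4 * (4 ^ suc ν * 16 ^ s * 4 ^ suc s) * q ^ l
      S-bound n₀ n₁ n₂ s h l = ≤-trans
        (≤-reflexive (cong N (Ev-skip _ s (λ m m<s → trans (cong (ι (β (suc ν) m) ⊗_)
          (DD.dd-vanish n₀ n₁ n₂ m (subst (suc m <_) (sym h) (s≤s m<s)))) (⊗-zeroʳ _)) l)))
        (Ev-bound {64 * W} (≤-trans (≤-reflexive (sym (*-assoc 4 64 W))) hW) l {C = 4 ^ suc ν * 16 ^ s * 4 ^ suc s} coefficient)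
        where
        open ≤-Reasoning
        dd′ : ℕ → Carrier
        dd′ i = dd n₀ n₁ n₂ (s + i)
        W≠0 : NonZero (W ^ suc s)
        W≠0 = >-nonZero (≤-trans (≤-reflexive (sym (^-zeroˡ (suc s)))) (^-monoˡ-≤ (suc s) W>0))
        dd-coefficient : ∀ i → N (dd′ i) ≤ 4 ^ suc s * (4 * W) ^ i
        dd-coefficient i = *-cancelʳ-≤ _ _ (W ^ suc s) {{W≠0}} (begin
          N (dd′ i) * W ^ suc s ≡⟨ cong (λ t → N (dd′ i) * W ^ t) (sym h) ⟩
          N (dd′ i) * W ^ (n₀ + n₁ + n₂) ≤⟨ DD.dd-bound W>0 ha hb n₀ n₁ n₂ (s + i) ⟩
          (4 * W) ^ (suc s + i) ≡⟨ ^-distribˡ-+-* (4 * W) (suc s) i ⟩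
          (4 * W) ^ suc s * (4 * W) ^ i ≡⟨ cong (_* (4 * W) ^ i) (*-^ 4 W (suc s)) ⟩
          4 ^ suc s * W ^ suc s * (4 * W) ^ i ≡⟨ lemma (4 ^ suc s) (W ^ suc s) ((4 * W) ^ i) ⟩
          4 ^ suc s * (4 * W) ^ i * W ^ suc s ∎)
          where
          lemma : ∀ x y z → x * y * z ≡ x * z * y
          lemma = solve-∀
        coefficient : ∀ i → N (ι (β (suc ν) (s + i)) ⊗ dd′ i) ≤ 4 ^ suc ν * 16 ^ s * 4 ^ suc s * (64 * W) ^ i
        coefficient i = begin
          N (ι (β (suc ν) (s + i)) ⊗ dd′ i)
            ≤⟨ N⊗≤ (≤-trans (≤-reflexive (N-ι _)) (*-mono-≤ (∣β∣≤ (suc ν) (s + i)) (∣β∣≤ (suc ν) (s + i)))) (dd-coefficient i) ⟩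
          2 ^ suc ν * 4 ^ (s + i) * (2 ^ suc ν * 4 ^ (s + i)) * (4 ^ suc s * (4 * W) ^ i)
            ≡⟨ lemma (2 ^ suc ν) (4 ^ (s + i)) (4 ^ suc s) ((4 * W) ^ i) ⟩
          2 ^ suc ν * 2 ^ suc ν * (4 ^ (s + i) * 4 ^ (s + i)) * 4 ^ suc s * (4 * W) ^ i
            ≡⟨ cong₂ (λ u t → u * t * 4 ^ suc s * (4 * W) ^ i) (sym (*-^ 2 2 (suc ν))) (trans (sym (*-^ 4 4 (s + i))) (^-distribˡ-+-* 16 s i)) ⟩
          4 ^ suc ν * (16 ^ s * 16 ^ i) * 4 ^ suc s * (4 * W) ^ i ≡⟨ lemma₂ (4 ^ suc ν) (16 ^ s) (16 ^ i) (4 ^ suc s) ((4 * W) ^ i) ⟩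
          4 ^ suc ν * 16 ^ s * 4 ^ suc s * (16 ^ i * (4 * W) ^ i)
            ≡⟨ cong (4 ^ suc ν * 16 ^ s * 4 ^ suc s *_) (trans (sym (*-^ 16 (4 * W) i)) (cong (_^ i) (sym (*-assoc 16 4 W)))) ⟩
          4 ^ suc ν * 16 ^ s * 4 ^ suc s * (64 * W) ^ i ∎
          where
          lemma : ∀ x y z w → x * y * (x * y) * (z * w) ≡ x * x * (y * y) * z * w
          lemma = solve-∀
          lemma₂ : ∀ x y z v w → x * (y * z) * v * w ≡ x * y * v * (z * w)
          lemma₂ = solve-∀

  -- How well a solution approximates the square roots

  module RootError (𝓡 : NormedRing) (M : NormedRing.Carrier 𝓡) where
    open Ring 𝓡
    open Series 𝓡 M

    module _ {w v c τ η d z : Carrier} (hM : M ≡ w ⊗ v ⊗ c) (hτ : v ⊗ c ⊕ 𝟙 ≡ τ ⊗ τ) (hη : v ⊗ d ⊕ 𝟙 ≡ η ⊗ η) (hz : c ⊗ d ⊕ 𝟙 ≡ z ⊗ z) where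

      -- Since 1 + w/M = (vc + 1)/(vc), the point is that (vc + 1)(vd + 1) - v²(cd + 1)(1 + w/M)
      -- equals (vc + 1)(c - v)/c, in which d has cancelled. The last term accounts for x/β₀ being
      -- only an approximate root.
      root-identity : ∀ β₀ x → w ⊗ c ⊗ ((β₀ ⊗ (τ ⊗ η) ⊖ z ⊗ (v ⊗ x)) ⊗ (β₀ ⊗ (τ ⊗ η) ⊕ z ⊗ (v ⊗ x)))
        ≡ w ⊗ (τ ⊗ τ) ⊗ (c ⊖ v) ⊗ (β₀ ⊗ β₀) ⊖ z ⊗ z ⊗ v ⊗ (M ⊗ (x ⊗ x) ⊖ (M ⊕ w) ⊗ (β₀ ⊗ β₀))
      root-identity β₀ x = begin
        w ⊗ c ⊗ ((β₀ ⊗ (τ ⊗ η) ⊖ z ⊗ (v ⊗ x)) ⊗ (β₀ ⊗ (τ ⊗ η) ⊕ z ⊗ (v ⊗ x)))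
          ≡⟨ solve 8 (λ w c β τ η z v x → w :* c :* ((β :* (τ :* η) :- z :* (v :* x)) :* (β :* (τ :* η) :+ z :* (v :* x)))
               := w :* (τ :* τ) :* (c :* (η :* η)) :* (β :* β) :- z :* z :* v :* (w :* v :* c :* (x :* x))) refl w c β₀ τ η z v x ⟩
        w ⊗ (τ ⊗ τ) ⊗ (c ⊗ (η ⊗ η)) ⊗ (β₀ ⊗ β₀) ⊖ z ⊗ z ⊗ v ⊗ (w ⊗ v ⊗ c ⊗ (x ⊗ x))
          ≡⟨ cong₂ (λ s t → s ⊖ t) (cong (λ s → w ⊗ (τ ⊗ τ) ⊗ (c ⊗ s) ⊗ (β₀ ⊗ β₀)) (sym hη)) (cong (λ s → z ⊗ z ⊗ v ⊗ (s ⊗ (x ⊗ x))) (sym hM)) ⟩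
        w ⊗ (τ ⊗ τ) ⊗ (c ⊗ (v ⊗ d ⊕ 𝟙)) ⊗ (β₀ ⊗ β₀) ⊖ z ⊗ z ⊗ v ⊗ (M ⊗ (x ⊗ x))
          ≡⟨ solve 9 (λ w T c v d β Z M x → w :* T :* (c :* (v :* d :+ con (+ 1))) :* (β :* β) :- Z :* v :* (M :* (x :* x))
               := w :* T :* (c :- v) :* (β :* β) :+ (w :* T :* v :* (c :* d :+ con (+ 1))) :* (β :* β) :- Z :* v :* (M :* (x :* x)))
               refl w (τ ⊗ τ) c v d β₀ (z ⊗ z) M x ⟩
        w ⊗ (τ ⊗ τ) ⊗ (c ⊖ v) ⊗ (β₀ ⊗ β₀) ⊕ w ⊗ (τ ⊗ τ) ⊗ v ⊗ (c ⊗ d ⊕ 𝟙) ⊗ (β₀ ⊗ β₀) ⊖ z ⊗ z ⊗ v ⊗ (M ⊗ (x ⊗ x))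
          ≡⟨ cong (λ s → w ⊗ (τ ⊗ τ) ⊗ (c ⊖ v) ⊗ (β₀ ⊗ β₀) ⊕ s ⊗ (β₀ ⊗ β₀) ⊖ z ⊗ z ⊗ v ⊗ (M ⊗ (x ⊗ x))) node ⟩
        w ⊗ (τ ⊗ τ) ⊗ (c ⊖ v) ⊗ (β₀ ⊗ β₀) ⊕ z ⊗ z ⊗ v ⊗ (M ⊕ w) ⊗ (β₀ ⊗ β₀) ⊖ z ⊗ z ⊗ v ⊗ (M ⊗ (x ⊗ x))
          ≡⟨ solve 6 (λ X Z M w β x → X :+ Z :* (M :+ w) :* β :- Z :* (M :* x) := X :- Z :* (M :* x :- (M :+ w) :* β))
               refl _ (z ⊗ z ⊗ v) M w (β₀ ⊗ β₀) (x ⊗ x) ⟩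
        w ⊗ (τ ⊗ τ) ⊗ (c ⊖ v) ⊗ (β₀ ⊗ β₀) ⊖ z ⊗ z ⊗ v ⊗ (M ⊗ (x ⊗ x) ⊖ (M ⊕ w) ⊗ (β₀ ⊗ β₀)) ∎
        where
        open ≡-Reasoning
        node : w ⊗ (τ ⊗ τ) ⊗ v ⊗ (c ⊗ d ⊕ 𝟙) ≡ z ⊗ z ⊗ v ⊗ (M ⊕ w)
        node = begin
          w ⊗ (τ ⊗ τ) ⊗ v ⊗ (c ⊗ d ⊕ 𝟙) ≡⟨ cong₂ (λ s t → w ⊗ s ⊗ v ⊗ t) (sym hτ) hz ⟩
          w ⊗ (v ⊗ c ⊕ 𝟙) ⊗ v ⊗ (z ⊗ z) ≡⟨ solve 4 (λ w v c Z → w :* (v :* c :+ con (+ 1)) :* v :* Z := Z :* v :* (w :* v :* c :+ w)) refl w v c (z ⊗ z) ⟩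
          z ⊗ z ⊗ v ⊗ (w ⊗ v ⊗ c ⊕ w) ≡⟨ cong (λ s → z ⊗ z ⊗ v ⊗ (s ⊕ w)) (sym hM) ⟩
          z ⊗ z ⊗ v ⊗ (M ⊕ w) ∎

      module _ (w>0 : 1 ≤ N w) (c>0 : 1 ≤ N c) (τ>0 : 1 ≤ N τ) (q>0 : 1 ≤ q) (v≤c : N v ≤ N c) {L}
        (hω : N (z ⊗ z ⊗ v) * N (M ⊗ (ξ w L ⊗ ξ w L) ⊖ (M ⊕ w) ⊗ (B ↑ L ⊗ B ↑ L)) ≤ q ^ L * q ^ L) where

        X Y : Carrier
        X = B ↑ L ⊗ (τ ⊗ η)
        Y = z ⊗ (v ⊗ ξ w L)

        error-product : N (X ⊖ Y) * N (X ⊕ Y) ≤ 16 * (N τ * N τ) * (q ^ L * q ^ L)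
        error-product = *-cancelˡ-≤ (N w * N c) {{>-nonZero (*-mono-≤ w>0 c>0)}} (begin
          N w * N c * (N (X ⊖ Y) * N (X ⊕ Y)) ≡⟨ sym (trans (N-⊗ (w ⊗ c) _) (cong₂ _*_ (N-⊗ w c) (N-⊗ _ _))) ⟩
          N (w ⊗ c ⊗ ((X ⊖ Y) ⊗ (X ⊕ Y))) ≡⟨ cong N (root-identity (B ↑ L) (ξ w L)) ⟩
          _ ≤⟨ N⊖≤ (N⊗≤ (N⊗≤ (N⊗≤ ≤-refl (N⊗≤ ≤-refl ≤-refl)) c-v) (N⊗≤ (N↑≤ ≤-refl L) (N↑≤ ≤-refl L)))
                   (≤-trans (≤-reflexive (N-⊗ _ _)) hω) ⟩
          2 * (N w * (N τ * N τ) * (4 * N c) * Z + Z) ≡⟨ lemma₁ (N w) (N τ * N τ) (N c) Z ⟩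
          8 * (N w * N c * (N τ * N τ)) * Z + 2 * Z ≤⟨ +-monoʳ-≤ (8 * (N w * N c * (N τ * N τ)) * Z) (*-monoˡ-≤ Z
              (*-mono-≤ {2} {8} (s≤s (s≤s z≤n)) (*-mono-≤ (*-mono-≤ w>0 c>0) (*-mono-≤ τ>0 τ>0)))) ⟩
          8 * (N w * N c * (N τ * N τ)) * Z + 8 * (N w * N c * (N τ * N τ)) * Z ≡⟨ lemma₂ (N w * N c) (N τ * N τ) Z ⟩
          N w * N c * (16 * (N τ * N τ) * Z) ∎)
          where
          open ≤-Reasoning
          Z = q ^ L * q ^ L
          c-v : N (c ⊖ v) ≤ 4 * N c
          c-v = ≤-trans (N⊖≤ ≤-refl v≤c) (≤-reflexive (lemma (N c)))
            where
            lemma : ∀ x → 2 * (x + x) ≡ 4 * x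
            lemma = solve-∀
          lemma₁ : ∀ w t c Z → 2 * (w * t * (4 * c) * Z + Z) ≡ 8 * (w * c * t) * Z + 2 * Z
          lemma₁ = solve-∀
          lemma₂ : ∀ x t Z → 8 * (x * t) * Z + 8 * (x * t) * Z ≡ x * (16 * t * Z)
          lemma₂ = solve-∀

        -- The two factors have sum or difference 2X, so the larger one has norm at least that of X.
        -- Dividing the bound for the product by it leaves the smaller one.
        smaller-factor : ∀ {x y} → x * y ≤ 16 * (N τ * N τ) * (q ^ L * q ^ L) → x ≤ y → N X * 4 ≤ 2 * (x + y) → x * N η ≤ 16 * N τ * q ^ L
        smaller-factor {x} {y} h x≤y g = *-cancelʳ-≤ _ _ (q ^ L * N τ) {{>-nonZero (*-mono-≤ (≤-trans (≤-reflexive (sym (^-zeroˡ L))) (^-monoˡ-≤ L q>0)) τ>0)}} (begin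
          x * N η * (q ^ L * N τ) ≡⟨ lemma₁ x (N η) (q ^ L) (N τ) ⟩
          x * (q ^ L * (N τ * N η)) ≡⟨ cong (x *_) (sym (trans (N-⊗ _ _) (cong₂ _*_ (N-↑ B L) (N-⊗ τ η)))) ⟩
          x * N X ≤⟨ *-monoʳ-≤ x (*-cancelʳ-≤ _ _ 4 (≤-trans g (≤-trans (*-monoʳ-≤ 2 (+-monoˡ-≤ y x≤y)) (≤-reflexive (lemma₂ y))))) ⟩
          x * y ≤⟨ h ⟩
          16 * (N τ * N τ) * (q ^ L * q ^ L) ≡⟨ lemma₃ (N τ) (q ^ L) ⟩
          16 * N τ * q ^ L * (q ^ L * N τ) ∎)
          where
          open ≤-Reasoning
          lemma₁ : ∀ x n p t → x * n * (p * t) ≡ x * (p * (t * n))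
          lemma₁ = solve-∀
          lemma₂ : ∀ y → 2 * (y + y) ≡ y * 4
          lemma₂ = solve-∀
          lemma₃ : ∀ t p → 16 * (t * t) * (p * p) ≡ 16 * t * p * (p * t)
          lemma₃ = solve-∀

        -- Since N (X ⊖ Y) * N (X ⊕ Y) is small, X is close to Y or to - Y; the sign of η decides which.
        root-error : ∃ λ η′ → η′ ⊗ η′ ≡ η ⊗ η × N (B ↑ L ⊗ (τ ⊗ η′) ⊖ Y) * N η ≤ 16 * N τ * q ^ L
        root-error with ≤-total (N (X ⊖ Y)) (N (X ⊕ Y))
        ... | inj₁ h = η , refl , smaller-factor error-product h
              (≤-trans (≤-reflexive double) (N⊕≤ ≤-refl ≤-refl))
          where
          double : N X * 4 ≡ N ((X ⊖ Y) ⊕ (X ⊕ Y))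
          double = trans (*-comm (N X) 4) (trans (sym (trans (N-⊗ 𝟚 X) (cong (_* N X) (N-ι (+ 2)))))
            (cong N (solve 2 (λ x y → con (+ 2) :* x := (x :- y) :+ (x :+ y)) refl X Y)))
        ... | inj₂ h = neg η , solve 1 (λ x → :- x :* :- x := x :* x) refl η ,
              subst (λ t → t * N η ≤ 16 * N τ * q ^ L) flip
                (smaller-factor (≤-trans (≤-reflexive (*-comm (N (X ⊕ Y)) (N (X ⊖ Y)))) error-product) h
                  (≤-trans (≤-reflexive double) (N⊕≤ ≤-refl ≤-refl)))
          where
          double : N X * 4 ≡ N ((X ⊕ Y) ⊕ (X ⊖ Y))
          double = trans (*-comm (N X) 4) (trans (sym (trans (N-⊗ 𝟚 X) (cong (_* N X) (N-ι (+ 2)))))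
            (cong N (solve 2 (λ x y → con (+ 2) :* x := (x :+ y) :+ (x :- y)) refl X Y)))
          flip : N (X ⊕ Y) ≡ N (B ↑ L ⊗ (τ ⊗ neg η) ⊖ Y)
          flip = trans (sym (N-neg _)) (cong N (solve 4 (λ b t e y → :- (b :* (t :* e) :+ y) := b :* (t :* :- e) :- y) refl (B ↑ L) τ η Y))

  -- The contradiction for one value of ν

  module Gap (𝓡 : NormedRing) (a c : NormedRing.Carrier 𝓡) (ρ : ℕ) where
    open Ring 𝓡
    open Comparison 𝓡 a c ρ
    open Estimate 𝓡 a c ρ
    open Series 𝓡 M
    open FormBounds 𝓡 using (J-bound; γ-bound)

    module _ {Q : ℕ} (Q≥16 : 16 ≤ Q) (a≤ : N a ≤ 4 * Q) (b≤ : N b ≤ 4 * Q) (a≥ : Q ≤ 4 * N a) (b≥ : Q ≤ 4 * N b)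
      (c≥ : 64 * (Q * Q * Q) ≤ N c) (c≤ : N c ≤ 1024 * (Q * Q * Q)) where

      f g : ℕ
      f = 4 ^ ν
      g = Q ^ ν

      Q>0 : 1 ≤ Q
      Q>0 = ≤-trans (s≤s z≤n) Q≥16

      q≥ : 64 * (Q * Q * Q * Q * Q) ≤ q
      q≥ = begin
        64 * (Q * Q * Q * Q * Q) ≡⟨ lemma Q ⟩
        Q * Q * (64 * (Q * Q * Q)) ≤⟨ *-mono-≤ (*-mono-≤ a≥ b≥) c≥ ⟩
        4 * N a * (4 * N b) * N c ≡⟨ lemma₂ (N a) (N b) (N c) ⟩
        16 * (N a * N b * N c) ≡⟨ sym (trans (N-⊗ (ι (+ 4)) M) (cong₂ _*_ (N-ι (+ 4)) (trans (N-⊗ (a ⊗ b) c) (cong (_* N c) (N-⊗ a b))))) ⟩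
        q ∎
        where
        open ≤-Reasoning
        lemma : ∀ Q → 64 * (Q * Q * Q * Q * Q) ≡ Q * Q * (64 * (Q * Q * Q))
        lemma = solve-∀
        lemma₂ : ∀ a b c → 4 * a * (4 * b) * c ≡ 16 * (a * b * c)
        lemma₂ = solve-∀

      q-W : 256 * (4 * Q) ≤ q
      q-W = begin
        256 * (4 * Q) ≡⟨ lemma Q ⟩
        64 * (16 * 1 * 1 * 1 * Q) ≤⟨ *-monoʳ-≤ 64 (*-monoˡ-≤ Q (*-mono-≤ (*-mono-≤ (*-mono-≤ Q≥16 Q>0) Q>0) Q>0)) ⟩
        64 * (Q * Q * Q * Q * Q) ≤⟨ q≥ ⟩
        q ∎
        where
        open ≤-Reasoning
        lemma : ∀ Q → 256 * (4 * Q) ≡ 64 * (16 * 1 * 1 * 1 * Q)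
        lemma = solve-∀

      W-128 : 128 * (4 * Q) ≤ q
      W-128 = ≤-trans (*-monoˡ-≤ (4 * Q) (≤ᵇ⇒≤ 128 256 tt)) q-W

      W>0 : 1 ≤ 4 * Q
      W>0 = *-mono-≤ {1} {4} (s≤s z≤n) Q>0

      positive : ∀ {x} → Q ≤ 4 * x → 1 ≤ x
      positive {zero} h = contradiction (≤-trans Q>0 h) λ ()
      positive {suc x} h = s≤s z≤n

      c>0 : 1 ≤ N c
      c>0 = ≤-trans (*-mono-≤ {1} {64} (s≤s z≤n) (*-mono-≤ (*-mono-≤ Q>0 Q>0) Q>0)) c≥

      q≥1 : 1 ≤ q
      q≥1 = ≤-trans (*-mono-≤ {1} {64} (s≤s z≤n) (*-mono-≤ (*-mono-≤ (*-mono-≤ (*-mono-≤ Q>0 Q>0) Q>0) Q>0) Q>0)) q≥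

      -- `unit` contributes g² q^ν and `S-bound` saves q^(3ν), so q^(-2ν) remains against q^L. By q
      -- ≥ 64 Q⁵ this is at most g^(-10), up to powers of f, and g^(-8) is left.
      main-bound : ∀ n₀ n₁ n₂ → n₁ + n₂ ≤ T → n₀ + n₁ + n₂ ≡ suc (ν + ν + ν) → ∀ L → ν + ν + ν ≤ L →
        N (main n₀ n₁ n₂ L) * (g * g * g * g * g * g * g * g) ≤ 256 * (f * f * f * f * f * f * f * f) * q ^ L
      main-bound n₀ n₁ n₂ t h L s≤L = *-cancelʳ-≤ _ _ ((f * f * f * f * f * f) * (g * g) * (qν * qν)) {{>-nonZero pos}} (begin
        N (main n₀ n₁ n₂ L) * (g * g * g * g * g * g * g * g) * ((f * f * f * f * f * f) * (g * g) * (qν * qν)) ≡⟨ lemma₀ (N (main n₀ n₁ n₂ L)) f g qν ⟩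
        N (main n₀ n₁ n₂ L) * (f * f * f * (g * g * g * g * g)) * (f * f * f * (g * g * g * g * g)) * (qν * qν)
          ≤⟨ *-monoˡ-≤ (qν * qν) (*-mono-≤ (*-monoʳ-≤ (N (main n₀ n₁ n₂ L)) q-power) q-power) ⟩
        N (main n₀ n₁ n₂ L) * qν * qν * (qν * qν) ≤⟨ *-monoˡ-≤ (qν * qν) (*-monoˡ-≤ qν (*-monoˡ-≤ qν N-main)) ⟩
        f * f * 4 * (f * f * (g * g) * qν) * (4 * (f * 4 * (f * f * (f * f) * (f * f)) * (f * f * f * 4)) * q ^ l) * qν * qν * (qν * qν)
          ≡⟨ lemma₁ f g qν (q ^ l) ⟩
        256 * (f * f * f * f * f * f * f * f) * (qν * qν * qν * q ^ l) * ((f * f * f * f * f * f) * (g * g) * (qν * qν)) ≡⟨ cong (λ t → 256 * (f * f * f * f * f * f * f * f) * t * ((f * f * f * f * f * f) * (g * g) * (qν * qν))) q-split ⟩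
        256 * (f * f * f * f * f * f * f * f) * q ^ L * ((f * f * f * f * f * f) * (g * g) * (qν * qν)) ∎)
        where
        open ≤-Reasoning
        qν = q ^ ν
        l = L ∸ (ν + ν + ν)
        f>0 : 1 ≤ f
        f>0 = m^n>0 4 ν
        power>0 : ∀ {x} → 1 ≤ x → ∀ n → 1 ≤ x ^ n
        power>0 h n = ≤-trans (≤-reflexive (sym (^-zeroˡ n))) (^-monoˡ-≤ n h)
        g>0 : 1 ≤ g
        g>0 = power>0 Q>0 ν
        pos : 1 ≤ (f * f * f * f * f * f) * (g * g) * (qν * qν)
        pos = *-mono-≤ (*-mono-≤ (*-mono-≤ (*-mono-≤ (*-mono-≤ (*-mono-≤ (*-mono-≤ f>0 f>0) f>0) f>0) f>0) f>0) (*-mono-≤ g>0 g>0)) (*-mono-≤ (power>0 q≥1 ν) (power>0 q≥1 ν))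
        lemma₀ : ∀ n f g q → n * (g * g * g * g * g * g * g * g) * ((f * f * f * f * f * f) * (g * g) * (q * q)) ≡ n * (f * f * f * (g * g * g * g * g)) * (f * f * f * (g * g * g * g * g)) * (q * q)
        lemma₀ = solve-∀
        lemma₁ : ∀ f g q z → f * f * 4 * (f * f * (g * g) * q) * (4 * (f * 4 * (f * f * (f * f) * (f * f)) * (f * f * f * 4)) * z) * q * q * (q * q)
          ≡ 256 * (f * f * f * f * f * f * f * f) * (q * q * q * z) * ((f * f * f * f * f * f) * (g * g) * (q * q))
        lemma₁ = solve-∀
        q-power : f * f * f * (g * g * g * g * g) ≤ qν
        q-power = begin
          f * f * f * (g * g * g * g * g) ≡⟨ cong₂ _*_ (trans (cong (_* f) (sym (*-^ 4 4 ν))) (sym (*-^ 16 4 ν)))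
            (trans (cong (λ t → t * g * g * g) (sym (*-^ Q Q ν))) (trans (cong (λ t → t * g * g) (sym (*-^ (Q * Q) Q ν)))
              (trans (cong (_* g) (sym (*-^ (Q * Q * Q) Q ν))) (sym (*-^ (Q * Q * Q * Q) Q ν))))) ⟩
          64 ^ ν * (Q * Q * Q * Q * Q) ^ ν ≡⟨ sym (*-^ 64 (Q * Q * Q * Q * Q) ν) ⟩
          (64 * (Q * Q * Q * Q * Q)) ^ ν ≤⟨ ^-monoˡ-≤ ν q≥ ⟩
          qν ∎
        q-split : qν * qν * qν * q ^ l ≡ q ^ L
        q-split = trans (cong (λ t → t * qν * q ^ l) (sym (^-distribˡ-+-* q ν ν))) (trans (cong (_* q ^ l) (sym (^-distribˡ-+-* q (ν + ν) ν)))
          (trans (sym (^-distribˡ-+-* q (ν + ν + ν) l)) (cong (q ^_) (m+[n∸m]≡n s≤L))))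
        4^T : 4 ^ T ≡ f * f * 4
        4^T = trans (^-distribˡ-+-* 4 (ν + ν) 1) (cong (_* 4) (^-distribˡ-+-* 4 ν ν))
        unit≤ : N unit ≤ f * f * (g * g) * qν
        unit≤ = begin
          N unit ≤⟨ N⊗≤ (N↑≤ (N⊗≤ a≤ b≤) ν) (N↑≤ ≤-refl ν) ⟩
          (4 * Q * (4 * Q)) ^ ν * qν ≡⟨ cong (_* qν) (trans (*-^ (4 * Q) (4 * Q) ν) (trans (cong (λ t → t * t) (*-^ 4 Q ν)) (lemma f g))) ⟩
          f * f * (g * g) * qν ∎
          where
          lemma : ∀ f g → f * g * (f * g) ≡ f * f * (g * g)
          lemma = solve-∀
        S≤ : N (S n₀ n₁ n₂ L) ≤ 4 * (f * 4 * (f * f * (f * f) * (f * f)) * (f * f * f * 4)) * q ^ l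
        S≤ = begin
          N (S n₀ n₁ n₂ L) ≡⟨ cong (λ t → N (S n₀ n₁ n₂ t)) (sym (m+[n∸m]≡n s≤L)) ⟩
          N (S n₀ n₁ n₂ (ν + ν + ν + l)) ≤⟨ S-bound W>0 a≤ b≤ q-W n₀ n₁ n₂ (ν + ν + ν) h l ⟩
          4 * (4 ^ suc ν * 16 ^ (ν + ν + ν) * 4 ^ suc (ν + ν + ν)) * q ^ l ≡⟨ cong (λ t → 4 * t * q ^ l) (cong₂ _*_ (cong₂ _*_ (*-comm 4 f)
             (trans (^-distribˡ-+-* 16 (ν + ν) ν) (cong₂ _*_ (trans (^-distribˡ-+-* 16 ν ν) (cong (λ t → t * t) (*-^ 4 4 ν))) (*-^ 4 4 ν))))
             (trans (*-comm 4 (4 ^ (ν + ν + ν))) (cong (_* 4) (trans (^-distribˡ-+-* 4 (ν + ν) ν) (cong (_* f) (^-distribˡ-+-* 4 ν ν)))))) ⟩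
          4 * (f * 4 * (f * f * (f * f) * (f * f)) * (f * f * f * 4)) * q ^ l ∎
        N-main : N (main n₀ n₁ n₂ L) ≤ f * f * 4 * (f * f * (g * g) * qν) * (4 * (f * 4 * (f * f * (f * f) * (f * f)) * (f * f * f * 4)) * q ^ l)
        N-main = N⊗≤ (N⊗≤ (≤-trans (≤-trans (N↑≤ (≤-reflexive (N-ι (+ 2))) (n₁ + n₂)) (^-monoʳ-≤ 4 t)) (≤-reflexive 4^T)) unit≤) S≤

      Q⁴ U : ℕ
      Q⁴ = Q * Q * Q * Q
      U = Q⁴ * 16384

      Q⁴>0 : 1 ≤ Q⁴
      Q⁴>0 = *-mono-≤ (*-mono-≤ (*-mono-≤ Q>0 Q>0) Q>0) Q>0

      ⊗c≤ : ∀ {v} → N v ≤ 4 * Q → N (v ⊗ c) ≤ Q⁴ * 4096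
      ⊗c≤ {v} h = ≤-trans (N⊗≤ h c≤) (≤-reflexive (lemma Q))
        where
        lemma : ∀ Q → 4 * Q * (1024 * (Q * Q * Q)) ≡ Q * Q * Q * Q * 4096
        lemma = solve-∀

      ⊗c≤U : ∀ {v} → N v ≤ 4 * Q → N (v ⊗ c) ≤ U
      ⊗c≤U h = ≤-trans (⊗c≤ h) (*-monoʳ-≤ Q⁴ (≤ᵇ⇒≤ 4096 16384 tt))

      ⊗c+1≤U : ∀ {v} → N v ≤ 4 * Q → N (v ⊗ c ⊕ 𝟙) ≤ U
      ⊗c+1≤U h = ≤-trans (N⊕≤ (⊗c≤ h) (≤-trans (≤-reflexive N-𝟙) Q⁴>0)) (≤-trans (≤-reflexive (lemma Q⁴)) (*-monoʳ-≤ Q⁴ (≤ᵇ⇒≤ 8194 16384 tt)))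
        where
        lemma : ∀ x → 2 * (x * 4096 + x) ≡ x * 8194
        lemma = solve-∀

      v≤c : ∀ {v} → N v ≤ 4 * Q → N v ≤ N c
      v≤c {v} h = begin
        N v ≤⟨ h ⟩
        4 * Q ≡⟨ lemma Q ⟩
        4 * (1 * 1 * Q) ≤⟨ *-mono-≤ (≤ᵇ⇒≤ 4 64 tt) (*-monoˡ-≤ Q (*-mono-≤ Q>0 Q>0)) ⟩
        64 * (Q * Q * Q) ≤⟨ c≥ ⟩
        N c ∎
        where
        open ≤-Reasoning
        lemma : ∀ Q → 4 * Q ≡ 4 * (1 * 1 * Q)
        lemma = solve-∀

      module _ {d z : Carrier} (hz : c ⊗ d ⊕ 𝟙 ≡ z ⊗ z) where

        -- If η were 0, then v d = -1 would make v a unit, while N v is at least 4.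
        root>0 : ∀ {v η} → v ⊗ d ⊕ 𝟙 ≡ η ⊗ η → Q ≤ 4 * N v → 1 ≤ N η
        root>0 {v} {η} hη hv with N η in eq
        ... | suc _ = s≤s z≤n
        ... | zero = contradiction (≤-trans Q≥16 (≤-trans hv (≤-reflexive (cong (4 *_) v≡1)))) λ { (s≤s (s≤s (s≤s (s≤s ())))) }
          where
          v≡1 : N v ≡ 1
          v≡1 = m*n≡1⇒m≡1 (N v) (N d) (begin
            N v * N d ≡⟨ sym (N-⊗ v d) ⟩
            N (v ⊗ d) ≡⟨ cong N (solve 1 (λ x → x := x :+ con (+ 1) :- con (+ 1)) refl (v ⊗ d)) ⟩
            N (v ⊗ d ⊕ 𝟙 ⊖ 𝟙) ≡⟨ cong (λ s → N (s ⊖ 𝟙)) (trans hη (cong (λ s → s ⊗ s) (N≡0 eq))) ⟩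
            N (𝟘 ⊗ 𝟘 ⊖ 𝟙) ≡⟨ cong N (solve 0 (con (+ 0) :* con (+ 0) :- con (+ 1) := :- con (+ 1)) refl) ⟩
            N (neg 𝟙) ≡⟨ trans (N-neg 𝟙) N-𝟙 ⟩
            1 ∎)
            where open ≡-Reasoning

        -- Eliminating d gives v z² = c η² - (c - v), and N c / N v has order Q². It allows the
        -- errors, bounded in terms of η, to be measured by z.
        z≤η : ∀ {v η} → v ⊗ d ⊕ 𝟙 ≡ η ⊗ η → Q ≤ 4 * N v → N v ≤ 4 * Q → N z ≤ 256 * Q * N η
        z≤η {v} {η} hη hv hv′ = square-≤ (*-cancelˡ-≤ Q {{>-nonZero Q>0}} (begin
          Q * (N z * N z) ≤⟨ *-monoˡ-≤ (N z * N z) hv ⟩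
          4 * N v * (N z * N z) ≡⟨ *-assoc 4 (N v) _ ⟩
          4 * (N v * (N z * N z)) ≡⟨ cong (4 *_) (sym (trans (N-⊗ v _) (cong (N v *_) (N-⊗ z z)))) ⟩
          4 * N (v ⊗ (z ⊗ z)) ≡⟨ cong (λ s → 4 * N s) identity ⟩
          4 * N (c ⊗ (η ⊗ η) ⊖ (c ⊖ v)) ≤⟨ *-monoʳ-≤ 4 (N⊖≤ (N⊗≤ ≤-refl (N⊗≤ ≤-refl ≤-refl)) (N⊖≤ ≤-refl (v≤c hv′))) ⟩
          4 * (2 * (N c * (N η * N η) + 2 * (N c + N c))) ≡⟨ lemma₁ (N c) (N η * N η) ⟩
          N c * (8 * (N η * N η) + 32 * (1 * 1)) ≤⟨ *-mono-≤ c≤ (+-monoʳ-≤ (8 * (N η * N η)) (*-monoʳ-≤ 32 (*-mono-≤ η>0 η>0))) ⟩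
          1024 * (Q * Q * Q) * (8 * (N η * N η) + 32 * (N η * N η)) ≡⟨ lemma₂ Q (N η) ⟩
          Q * (Q * N η * (Q * N η)) * 40960 ≤⟨ *-monoʳ-≤ (Q * (Q * N η * (Q * N η))) (≤ᵇ⇒≤ 40960 65536 tt) ⟩
          Q * (Q * N η * (Q * N η)) * 65536 ≡⟨ lemma₃ Q (N η) ⟩
          Q * (256 * Q * N η * (256 * Q * N η)) ∎))
          where
          open ≤-Reasoning
          η>0 : 1 ≤ N η
          η>0 = root>0 hη hv
          lemma₁ : ∀ c y → 4 * (2 * (c * y + 2 * (c + c))) ≡ c * (8 * y + 32 * (1 * 1))
          lemma₁ = solve-∀
          lemma₂ : ∀ Q y → 1024 * (Q * Q * Q) * (8 * (y * y) + 32 * (y * y)) ≡ Q * (Q * y * (Q * y)) * 40960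
          lemma₂ = solve-∀
          lemma₃ : ∀ Q y → Q * (Q * y * (Q * y)) * 65536 ≡ Q * (256 * Q * y * (256 * Q * y))
          lemma₃ = solve-∀
          identity : v ⊗ (z ⊗ z) ≡ c ⊗ (η ⊗ η) ⊖ (c ⊖ v)
          identity = trans (cong (v ⊗_) (sym hz)) (trans (solve 3 (λ v c d → v :* (c :* d :+ con (+ 1))
                := c :* (v :* d :+ con (+ 1)) :- (c :- v)) refl v c d)
              (cong (λ s → c ⊗ s ⊖ (c ⊖ v)) hη))

        error-Z : ∀ {v η τ e} L → v ⊗ d ⊕ 𝟙 ≡ η ⊗ η → Q ≤ 4 * N v → N v ≤ 4 * Q → N τ ≤ 64 * (Q * Q) →
          e * N η ≤ 16 * N τ * q ^ L → e * N z ≤ Q * Q * Q * q ^ L * 262144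
        error-Z {v} {η} {τ} {e} L hη hv hv′ hτ h = begin
          e * N z ≤⟨ *-monoʳ-≤ e (z≤η hη hv hv′) ⟩
          e * (256 * Q * N η) ≡⟨ lemma₁ e Q (N η) ⟩
          256 * Q * (e * N η) ≤⟨ *-monoʳ-≤ (256 * Q) (≤-trans h (*-monoˡ-≤ (q ^ L) (*-monoʳ-≤ 16 hτ))) ⟩
          256 * Q * (16 * (64 * (Q * Q)) * q ^ L) ≡⟨ lemma₂ Q (q ^ L) ⟩
          Q * Q * Q * q ^ L * 262144 ∎
          where
          open ≤-Reasoning
          lemma₁ : ∀ e Q y → e * (256 * Q * y) ≡ 256 * Q * (e * y)
          lemma₁ = solve-∀
          lemma₂ : ∀ Q y → 256 * Q * (16 * (64 * (Q * Q)) * y) ≡ Q * Q * Q * y * 262144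
          lemma₂ = solve-∀

        f16 g6 : ℕ
        f16 = f * f * (f * f) * (f * f) * (f * f) * (f * f) * (f * f) * (f * f) * (f * f)
        g6 = g * g * (g * g) * (g * g)

        -- Lower end of the window: the error of the approximation, inversely proportional to N z,
        -- must outweigh the coefficients of the form. The last factor is 4^13.
        module _ (H₂ : f16 * g6 * (Q * Q) * 67108864 ≤ N z) where

          f>0 : 1 ≤ f
          f>0 = m^n>0 4 ν
          g>0 : 1 ≤ g
          g>0 = ≤-trans (≤-reflexive (sym (^-zeroˡ ν))) (^-monoˡ-≤ ν Q>0)
          ff>0 : 1 ≤ f * f
          ff>0 = *-mono-≤ f>0 f>0
          gg>0 : 1 ≤ g * g
          gg>0 = *-mono-≤ g>0 g>0

          z>0 : 1 ≤ N z
          z>0 = ≤-trans (*-mono-≤ (*-mono-≤ (*-mono-≤ f16>0 (*-mono-≤ (*-mono-≤ gg>0 gg>0) gg>0)) (*-mono-≤ Q>0 Q>0)) (≤ᵇ⇒≤ 1 67108864 tt)) H₂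
            where
            f16>0 : 1 ≤ f16
            f16>0 = *-mono-≤ (*-mono-≤ (*-mono-≤ (*-mono-≤ (*-mono-≤ (*-mono-≤ (*-mono-≤ ff>0 ff>0) ff>0) ff>0) ff>0) ff>0) ff>0) ff>0

          error-bound : ∀ {e₁ e₂} L → N e₁ * N z ≤ Q * Q * Q * q ^ L * 262144 → N e₂ * N z ≤ Q * Q * Q * q ^ L * 262144 →
            ∀ n₀ n₁ n₂ → ν ≤ n₀ → n₀ ≤ suc ν → n₁ ≤ suc ν → n₂ ≤ suc ν → n₀ + n₁ ≤ T → n₀ + n₂ ≤ T → 1 ≤ n₁ + n₂ → n₁ + n₂ ≤ T →
            -- The factor 4Q completes the power with exponent ρ to exponent ν, and N z turns e₁ and
            -- e₂ into the bounded products of the hypotheses.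
            8 * N (Form′.J 𝟘 e₁ e₂ n₀ n₁ n₂) ≤ q ^ L
          error-bound {e₁} {e₂} L h₁ h₂ n₀ n₁ n₂ k₀ k₁ k₂ k₃ k₄ k₅ k₆ k₇ = *-cancelʳ-≤ _ _ (4 * Q * N z) {{>-nonZero (*-mono-≤ W>0 z>0)}} (begin
            8 * N J′ * (4 * Q * N z) ≤⟨ *-monoˡ-≤ (4 * Q * N z) (*-monoʳ-≤ 8 (J-bound a c ρ 𝟘 e₁ e₂ W>0 U>0 a≤ b≤ (⊗c≤U b≤) (⊗c+1≤U b≤) (⊗c≤U a≤) (⊗c+1≤U a≤)
               zero≤ zero≤ (m≤m⊔n (N e₁) (N e₂)) (m≤n⊔m (N e₁) (N e₂)) n₀ n₁ n₂ k₀ k₁ k₂ k₃ k₄ k₅ k₆)) ⟩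
            8 * (4 ^ (n₁ + n₂) * (A′ ^ ν * A′ ^ ρ * (4 ^ T * (16 ^ ν * (4 * f) * U ^ ν * E)))) * (4 * Q * N z)
              ≤⟨ *-monoˡ-≤ (4 * Q * N z) (*-monoʳ-≤ 8 (*-monoˡ-≤ _ (^-monoʳ-≤ 4 k₇))) ⟩
            8 * (4 ^ T * (A′ ^ ν * A′ ^ ρ * (4 ^ T * (16 ^ ν * (4 * f) * U ^ ν * E)))) * (4 * Q * N z)
              ≡⟨ lemma₁ (4 ^ T) (A′ ^ ν) (A′ ^ ρ) (16 ^ ν) f (U ^ ν) E (4 * Q) (N z) ⟩
            32 * (4 ^ T * 4 ^ T) * (A′ ^ ν * (4 * Q * A′ ^ ρ)) * (16 ^ ν) * f * U ^ ν * (E * N z)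
              ≤⟨ *-monoʳ-≤ (32 * (4 ^ T * 4 ^ T) * (A′ ^ ν * A′ ^ ν) * (16 ^ ν) * f * U ^ ν) (E-bound (⊔-sel (N e₁) (N e₂))) ⟩
            32 * (4 ^ T * 4 ^ T) * (A′ ^ ν * A′ ^ ν) * (16 ^ ν) * f * U ^ ν * (Q * Q * Q * q ^ L * 262144)
              ≡⟨ cong₂ (λ s t → s * t * (Q * Q * Q * q ^ L * 262144)) (cong₂ (λ s t → 32 * (s * s) * (t * t) * (16 ^ ν) * f) 4^T (*-^ 4 Q ν)) U^ν ⟩
            32 * (f * f * 4 * (f * f * 4)) * (f * g * (f * g)) * 16 ^ ν * f * (f * f * f * f * f * f * f * (g * g * g * g)) * (Q * Q * Q * q ^ L * 262144)
              ≡⟨ cong (λ s → 32 * (f * f * 4 * (f * f * 4)) * (f * g * (f * g)) * s * f * (f * f * f * f * f * f * f * (g * g * g * g)) * (Q * Q * Q * q ^ L * 262144)) (*-^ 4 4 ν) ⟩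
            32 * (f * f * 4 * (f * f * 4)) * (f * g * (f * g)) * (f * f) * f * (f * f * f * f * f * f * f * (g * g * g * g)) * (Q * Q * Q * q ^ L * 262144)
              ≡⟨ lemma₂ f g Q (q ^ L) 262144 ⟩
            f16 * g6 * (Q * Q) * Q * q ^ L * (512 * 262144) ≤⟨ *-monoʳ-≤ (f16 * g6 * (Q * Q) * Q * q ^ L) (≤ᵇ⇒≤ (512 * 262144) (4 * 67108864) tt) ⟩
            f16 * g6 * (Q * Q) * Q * q ^ L * (4 * 67108864) ≡⟨ lemma₃ 67108864 (f16 * g6 * (Q * Q)) Q (q ^ L) ⟩
            f16 * g6 * (Q * Q) * 67108864 * (4 * Q * q ^ L) ≤⟨ *-monoˡ-≤ (4 * Q * q ^ L) H₂ ⟩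
            N z * (4 * Q * q ^ L) ≡⟨ lemma₄ (N z) (4 * Q) (q ^ L) ⟩
            q ^ L * (4 * Q * N z) ∎)
            where
            open ≤-Reasoning
            J′ = Form′.J 𝟘 e₁ e₂ n₀ n₁ n₂
            A′ = 4 * Q
            E = N e₁ ⊔ N e₂
            U>0 : 1 ≤ U
            U>0 = *-mono-≤ Q⁴>0 (≤ᵇ⇒≤ 1 16384 tt)
            zero≤ : ∀ {v} → N (v ⊗ 𝟘) ≤ E
            zero≤ {v} = ≤-trans (≤-reflexive (trans (cong N (⊗-zeroʳ v)) N-𝟘)) z≤n
            E-bound : E ≡ N e₁ ⊎ E ≡ N e₂ → E * N z ≤ Q * Q * Q * q ^ L * 262144
            E-bound (inj₁ p) = subst (λ t → t * N z ≤ Q * Q * Q * q ^ L * 262144) (sym p) h₁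
            E-bound (inj₂ p) = subst (λ t → t * N z ≤ Q * Q * Q * q ^ L * 262144) (sym p) h₂
            4^T : 4 ^ T ≡ f * f * 4
            4^T = trans (^-distribˡ-+-* 4 (ν + ν) 1) (cong (_* 4) (^-distribˡ-+-* 4 ν ν))
            4^7 : 16384 ^ ν ≡ f * f * f * f * f * f * f
            4^7 = trans (*-^ 4096 4 ν) (cong (_* f) (trans (*-^ 1024 4 ν) (cong (_* f) (trans (*-^ 256 4 ν) (cong (_* f)
              (trans (*-^ 64 4 ν) (cong (_* f) (trans (*-^ 16 4 ν) (cong (_* f) (*-^ 4 4 ν))))))))))
            U^ν : U ^ ν ≡ f * f * f * f * f * f * f * (g * g * g * g)
            U^ν = trans (*-^ Q⁴ 16384 ν) (trans (*-comm (Q⁴ ^ ν) (16384 ^ ν)) (cong₂ _*_ 4^7 (trans (*-^ (Q * Q * Q) Q ν) (cong (_* g) (trans (*-^ (Q * Q) Q ν) (cong (_* g) (*-^ Q Q ν)))))))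
            lemma₁ : ∀ t a r s f u e w z → 8 * (t * (a * r * (t * (s * (4 * f) * u * e)))) * (w * z) ≡ 32 * (t * t) * (a * (w * r)) * s * f * u * (e * z)
            lemma₁ = solve-∀
            lemma₂ : ∀ f g Q y n → 32 * (f * f * 4 * (f * f * 4)) * (f * g * (f * g)) * (f * f) * f * (f * f * f * f * f * f * f * (g * g * g * g)) * (Q * Q * Q * y * n)
              ≡ (f * f * (f * f) * (f * f) * (f * f) * (f * f) * (f * f) * (f * f) * (f * f) * (g * g * (g * g) * (g * g)) * (Q * Q) * Q * y) * (512 * n)
            lemma₂ = solve-∀
            lemma₃ : ∀ n x Q y → x * Q * y * (4 * n) ≡ x * n * (4 * Q * y)
            lemma₃ = solve-∀
            lemma₄ : ∀ z w y → z * (w * y) ≡ y * (w * z)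
            lemma₄ = solve-∀

          -- Upper end of the window: z times the value of the form at the true roots must remain
          -- below a fraction of 1. Here 4096 is 16 · 256, from the weight 16 in the final sum and
          -- the constant of `main-bound`.
          module _ (H₁ : (f * f * f * f * f * f * f * f) * N z * 4096 ≤ (g * g * g * g * g * g * g * g)) where

            main-small : ∀ n₀ n₁ n₂ → n₁ + n₂ ≤ T → n₀ + n₁ + n₂ ≡ suc (ν + ν + ν) → ∀ L → ν + ν + ν ≤ L →
              16 * N z * N (main n₀ n₁ n₂ L) ≤ q ^ L
            main-small n₀ n₁ n₂ t h L s≤L = *-cancelʳ-≤ _ _ g8 {{>-nonZero g8>0}} (begin
              16 * N z * N (main n₀ n₁ n₂ L) * g8 ≡⟨ *-assoc (16 * N z) _ g8 ⟩
              16 * N z * (N (main n₀ n₁ n₂ L) * g8) ≤⟨ *-monoʳ-≤ (16 * N z) (main-bound n₀ n₁ n₂ t h L s≤L) ⟩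
              16 * N z * (256 * f8 * q ^ L) ≡⟨ lemma (N z) f8 (q ^ L) ⟩
              f8 * N z * 4096 * q ^ L ≤⟨ *-monoˡ-≤ (q ^ L) H₁ ⟩
              g8 * q ^ L ≡⟨ *-comm g8 (q ^ L) ⟩
              q ^ L * g8 ∎)
              where
              open ≤-Reasoning
              f8 = f * f * f * f * f * f * f * f
              g8 = g * g * g * g * g * g * g * g
              g8>0 : 1 ≤ g8
              g8>0 = *-mono-≤ (*-mono-≤ (*-mono-≤ (*-mono-≤ (*-mono-≤ (*-mono-≤ gg>0 g>0) g>0) g>0) g>0) g>0) g>0
              lemma : ∀ z x y → 16 * z * (256 * x * y) ≡ x * z * 4096 * y
              lemma = solve-∀

            -- Four times the norm of B^L times the form is at least 4 q^L if the form is nonzero.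
            -- It is also bounded by three contributions of at most q^L each: from `main`, from `Δ`,
            -- and from the errors of the two approximations.
            form-nonzero-⊥ : ∀ {θ₁ θ₂} L → ν + ν + ν ≤ L →
              N (B ↑ L ⊗ θ₁ ⊖ z ⊗ (b ⊗ ξ a L)) * N z ≤ Q * Q * Q * q ^ L * 262144 →
              N (B ↑ L ⊗ θ₂ ⊖ z ⊗ (a ⊗ ξ b L)) * N z ≤ Q * Q * Q * q ^ L * 262144 →
              ∀ n₀ n₁ n₂ → ν ≤ n₀ → n₀ ≤ suc ν → n₁ ≤ suc ν → n₂ ≤ suc ν → n₀ + n₁ ≤ T → n₀ + n₂ ≤ T → 1 ≤ n₁ + n₂ → n₁ + n₂ ≤ T →
              n₀ + n₁ + n₂ ≡ suc (ν + ν + ν) → 16 * N z * N (Δ n₀ n₁ n₂ L) ≤ q ^ L → ¬ 1 ≤ N (Form′.J z θ₁ θ₂ n₀ n₁ n₂)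
            form-nonzero-⊥ {θ₁} {θ₂} L s≤L h₁ h₂ n₀ n₁ n₂ k₀ k₁ k₂ k₃ k₄ k₅ k₆ k₇ k₈ hΔ J>0 =
              contradiction (+-cancelʳ-≤ (q ^ L + (q ^ L + q ^ L)) (q ^ L) 0 (begin
                q ^ L + (q ^ L + (q ^ L + q ^ L)) ≡⟨ lemma₁ (q ^ L) ⟩
                4 * (q ^ L * 1) ≤⟨ *-monoʳ-≤ 4 (*-monoʳ-≤ (q ^ L) J>0) ⟩
                4 * (q ^ L * N J₀) ≡⟨ cong (4 *_) (sym (trans (N-⊗ _ _) (cong (_* N J₀) (N-↑ B L)))) ⟩
                4 * N (B ↑ L ⊗ J₀) ≡⟨ cong (λ t → 4 * N t) (form-combine split₀ split₁ split₂ n₀ n₁ n₂) ⟩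
                4 * N (z ⊗ J∞ n₀ n₁ n₂ L ⊕ J₂) ≤⟨ *-monoʳ-≤ 4 (N⊕≤ (N⊗≤ ≤-refl J∞≤) ≤-refl) ⟩
                4 * (2 * (N z * (2 * (N (main n₀ n₁ n₂ L) + N (Δ n₀ n₁ n₂ L))) + N J₂)) ≡⟨ lemma₂ (N z) (N (main n₀ n₁ n₂ L)) (N (Δ n₀ n₁ n₂ L)) (N J₂) ⟩
                16 * N z * N (main n₀ n₁ n₂ L) + (16 * N z * N (Δ n₀ n₁ n₂ L) + 8 * N J₂)
                  ≤⟨ +-mono-≤ (main-small n₀ n₁ n₂ k₇ k₈ L s≤L) (+-mono-≤ hΔ (error-bound L h₁ h₂ n₀ n₁ n₂ k₀ k₁ k₂ k₃ k₄ k₅ k₆ k₇)) ⟩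
                q ^ L + (q ^ L + q ^ L) ∎)) (<⇒≱ q^L>0)
              where
              open ≤-Reasoning
              e₁ = B ↑ L ⊗ θ₁ ⊖ z ⊗ (b ⊗ ξ a L)
              e₂ = B ↑ L ⊗ θ₂ ⊖ z ⊗ (a ⊗ ξ b L)
              J₀ = Form′.J z θ₁ θ₂ n₀ n₁ n₂
              J₂ = Form′.J 𝟘 e₁ e₂ n₀ n₁ n₂
              q^L>0 : 1 ≤ q ^ L
              q^L>0 = ≤-trans (≤-reflexive (sym (^-zeroˡ L))) (^-monoˡ-≤ L q≥1)
              split₀ : B ↑ L ⊗ z ≡ z ⊗ B ↑ L ⊕ 𝟘
              split₀ = solve 2 (λ x y → x :* y := y :* x :+ con (+ 0)) refl (B ↑ L) z
              split₁ : B ↑ L ⊗ θ₁ ≡ z ⊗ (b ⊗ ξ a L) ⊕ e₁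
              split₁ = solve 2 (λ x y → x := y :+ (x :- y)) refl (B ↑ L ⊗ θ₁) (z ⊗ (b ⊗ ξ a L))
              split₂ : B ↑ L ⊗ θ₂ ≡ z ⊗ (a ⊗ ξ b L) ⊕ e₂
              split₂ = solve 2 (λ x y → x := y :+ (x :- y)) refl (B ↑ L ⊗ θ₂) (z ⊗ (a ⊗ ξ b L))
              J∞≤ : N (J∞ n₀ n₁ n₂ L) ≤ 2 * (N (main n₀ n₁ n₂ L) + N (Δ n₀ n₁ n₂ L))
              J∞≤ = ≤-trans (≤-reflexive (cong N (solve 2 (λ x y → x := y :+ (x :- y)) refl (J∞ n₀ n₁ n₂ L) (main n₀ n₁ n₂ L)))) (N-⊕ _ _)
              lemma₁ : ∀ x → x + (x + (x + x)) ≡ 4 * (x * 1)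
              lemma₁ = solve-∀
              lemma₂ : ∀ z m d j → 4 * (2 * (z * (2 * (m + d)) + j)) ≡ 16 * z * m + (16 * z * d + 8 * j)
              lemma₂ = solve-∀

            zero? : ∀ {u} → ¬ 1 ≤ N u → u ≡ 𝟘
            zero? {u} h with N u in eq
            ... | zero = N≡0 eq
            ... | suc _ = contradiction (s≤s z≤n) h

            νν : suc ν + ν ≤ T
            νν = ≤-reflexive (+-comm 1 (ν + ν))

            νν′ : ν + suc ν ≤ T
            νν′ = ≤-trans (≤-reflexive (+-suc ν ν)) νν

            ν+ν≤T : ν + ν ≤ T
            ν+ν≤T = m≤m+n (ν + ν) 1

            module _ {s t x y} (hs : a ⊗ c ⊕ 𝟙 ≡ s ⊗ s) (ht : b ⊗ c ⊕ 𝟙 ≡ t ⊗ t) (hx : a ⊗ d ⊕ 𝟙 ≡ x ⊗ x) (hy : b ⊗ d ⊕ 𝟙 ≡ y ⊗ y)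
              (s≤ : N s ≤ 64 * (Q * Q)) (t≤ : N t ≤ 64 * (Q * Q)) (s>0 : 1 ≤ N s) (t>0 : 1 ≤ N t) where

              M-swap : M ≡ b ⊗ a ⊗ c
              M-swap = cong (_⊗ c) (⊗-comm a b)

              -- The signs chosen for x and y by `root-error` may depend on L. Therefore all three
              -- forms are evaluated at one L, with the same signs, before nonvanishing is applied.
              gap-at : ∀ L → ν + ν + ν ≤ L →
                16 * N z * N (Δ (suc ν) ν ν L) ≤ q ^ L → 16 * N z * N (Δ ν (suc ν) ν L) ≤ q ^ L → 16 * N z * N (Δ ν ν (suc ν) L) ≤ q ^ L →
                (∃ λ y′ → y′ ⊗ y′ ≡ y ⊗ y × N (B ↑ L ⊗ (t ⊗ y′) ⊖ z ⊗ (b ⊗ ξ a L)) * N y ≤ 16 * N t * q ^ L) →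
                (∃ λ x′ → x′ ⊗ x′ ≡ x ⊗ x × N (B ↑ L ⊗ (s ⊗ x′) ⊖ z ⊗ (a ⊗ ξ b L)) * N x ≤ 16 * N s * q ^ L) → ⊥
              gap-at L sL d₀ d₁ d₂ (y′ , _ , ey) (x′ , _ , ex) =
                Form′.Nonzero.nonvanishing z (t ⊗ y′) (s ⊗ x′) (positive a≥) (positive b≥) c>0 z>0
                  ( zero? (form-nonzero-⊥ L sL E₁ E₂ (suc ν) ν ν (n≤1+n ν) ≤-refl (n≤1+n ν) (n≤1+n ν) νν νν (s≤s z≤n) ν+ν≤T refl d₀)
                  , zero? (form-nonzero-⊥ L sL E₁ E₂ ν (suc ν) ν ≤-refl (n≤1+n ν) ≤-refl (n≤1+n ν) νν′ ν+ν≤T (s≤s z≤n) νν (cong (_+ ν) (+-suc ν ν)) d₁)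
                  , zero? (form-nonzero-⊥ L sL E₁ E₂ ν ν (suc ν) ≤-refl (n≤1+n ν) (n≤1+n ν) ≤-refl ν+ν≤T νν′ (s≤s z≤n) νν′ (+-suc (ν + ν) ν) d₂) )
                where
                E₁ : N (B ↑ L ⊗ (t ⊗ y′) ⊖ z ⊗ (b ⊗ ξ a L)) * N z ≤ Q * Q * Q * q ^ L * 262144
                E₁ = error-Z {e = N (B ↑ L ⊗ (t ⊗ y′) ⊖ z ⊗ (b ⊗ ξ a L))} L hy b≥ b≤ t≤ ey
                E₂ : N (B ↑ L ⊗ (s ⊗ x′) ⊖ z ⊗ (a ⊗ ξ b L)) * N z ≤ Q * Q * Q * q ^ L * 262144
                E₂ = error-Z {e = N (B ↑ L ⊗ (s ⊗ x′) ⊖ z ⊗ (a ⊗ ξ b L))} L hx a≥ a≤ s≤ ex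

              Eventually : (ℕ → Set) → Set
              Eventually R = ∃ λ L₀ → ∀ L → L₀ ≤ L → R L

              gap-eventually :
                Eventually (λ L → 16 * N z * N (Δ (suc ν) ν ν L) ≤ q ^ L) →
                Eventually (λ L → 16 * N z * N (Δ ν (suc ν) ν L) ≤ q ^ L) →
                Eventually (λ L → 16 * N z * N (Δ ν ν (suc ν) L) ≤ q ^ L) →
                Eventually (λ L → N (z ⊗ z ⊗ b) * N (M ⊗ (ξ a L ⊗ ξ a L) ⊖ (M ⊕ a) ⊗ (B ↑ L ⊗ B ↑ L)) ≤ q ^ L * q ^ L) →
                Eventually (λ L → N (z ⊗ z ⊗ a) * N (M ⊗ (ξ b L ⊗ ξ b L) ⊖ (M ⊕ b) ⊗ (B ↑ L ⊗ B ↑ L)) ≤ q ^ L * q ^ L) → ⊥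
              gap-eventually (l₀ , d₀) (l₁ , d₁) (l₂ , d₂) (la , ωa) (lb , ωb) = gap-at L
                (m≤n⇒m≤o+n l₀ (m≤n⇒m≤o+n l₁ (m≤n⇒m≤o+n l₂ (m≤n⇒m≤o+n la (m≤n⇒m≤o+n lb ≤-refl)))))
                (d₀ L (m≤m+n _ _)) (d₁ L (m≤n⇒m≤o+n l₀ (m≤m+n _ _))) (d₂ L (m≤n⇒m≤o+n l₀ (m≤n⇒m≤o+n l₁ (m≤m+n _ _))))
                (RootError.root-error 𝓡 M refl ht hy hz (positive a≥) c>0 t>0 q≥1 (v≤c b≤) {L}
                  (ωa L (m≤n⇒m≤o+n l₀ (m≤n⇒m≤o+n l₁ (m≤n⇒m≤o+n l₂ (m≤m+n _ _))))))
                (RootError.root-error 𝓡 M M-swap hs hx hz (positive b≥) c>0 s>0 q≥1 (v≤c a≤) {L}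
                  (ωb L (m≤n⇒m≤o+n l₀ (m≤n⇒m≤o+n l₁ (m≤n⇒m≤o+n l₂ (m≤n⇒m≤o+n la (m≤m+n _ _)))))))
                where
                L = l₀ + (l₁ + (l₂ + (la + (lb + (ν + ν + ν)))))

              gap-⊥ : ⊥
              gap-⊥ = gap-eventually
                (negl-Δ W>0 a≤ b≤ W-128 (positive a≥) (positive b≥) (suc ν) ν ν ≤-refl (n≤1+n ν) (n≤1+n ν) νν νν (s≤s z≤n) (16 * N z))
                (negl-Δ W>0 a≤ b≤ W-128 (positive a≥) (positive b≥) ν (suc ν) ν (n≤1+n ν) ≤-refl (n≤1+n ν) νν′ ν+ν≤T (s≤s z≤n) (16 * N z))
                (negl-Δ W>0 a≤ b≤ W-128 (positive a≥) (positive b≥) ν ν (suc ν) (n≤1+n ν) (n≤1+n ν) ≤-refl ν+ν≤T νν′ (s≤s z≤n) (16 * N z))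
                (ξ-square a W>0 a≤ W-128 (N (z ⊗ z ⊗ b)))
                (ξ-square b W>0 b≤ W-128 (N (z ⊗ z ⊗ a)))

  -- Choice of ν: the windows cover all large z

  module Thresholds {Q : ℕ} (Q≥ : 4 ^ 125 ≤ Q) where

    -- The lower end of the window for ν = n, in the form of a product of powers of Q and of 4.
    threshold : ℕ → ℕ
    threshold n = Q ^ (n * 6 + 2) * 4 ^ (n * 16 + 13)

    Q>0 : 1 ≤ Q
    Q>0 = ≤-trans (m^n>0 4 125) Q≥

    instance
      Q≠0 : NonZero Q
      Q≠0 = >-nonZero Q>0

    n≤threshold : ∀ n → n ≤ threshold n
    n≤threshold n = begin
      n ≤⟨ n≤2^n n ⟩
      2 ^ n ≤⟨ ^-monoˡ-≤ n {2} {4} (s≤s (s≤s z≤n)) ⟩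
      4 ^ n ≤⟨ ^-monoʳ-≤ 4 (≤-trans (m≤m*n n 16) (m≤m+n (n * 16) 13)) ⟩
      4 ^ (n * 16 + 13) ≡⟨ sym (*-identityˡ _) ⟩
      1 * 4 ^ (n * 16 + 13) ≤⟨ *-monoˡ-≤ (4 ^ (n * 16 + 13)) (m^n>0 Q (n * 6 + 2)) ⟩
      threshold n ∎
      where open ≤-Reasoning

    threshold-5 : ∀ {Z} → Q ^ 33 ≤ Z → threshold 5 ≤ Z
    threshold-5 {Z} h = ≤-trans (product 32 93 33 (≤-trans (^-monoʳ-≤ 4 {93} {125} (m≤m+n 93 32)) Q≥) refl) h
      where
      product : ∀ e d e′ → 4 ^ d ≤ Q → suc e ≡ e′ → Q ^ e * 4 ^ d ≤ Q ^ e′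
      product e d e′ h refl = ≤-trans (*-monoʳ-≤ (Q ^ e) h) (≤-reflexive (*-comm (Q ^ e) Q))

    -- The thresholds outgrow their index, so the search ends; when the fuel is used up, m + 1
    -- exceeds Z and so does its threshold.
    bracket : ∀ {Z} n → threshold n ≤ Z → ∃ λ m → n ≤ m × threshold m ≤ Z × Z < threshold (suc m)
    bracket {Z} n h = search Z n ≤-refl h (m≤m+n (suc Z) n)
      where
      search : ∀ fuel m → n ≤ m → threshold m ≤ Z → Z < suc fuel + m → ∃ λ m → n ≤ m × threshold m ≤ Z × Z < threshold (suc m)
      search zero m n≤m h k = m , n≤m , h , <-≤-trans k (n≤threshold (suc m))
      search (suc fuel) m n≤m h k = step (threshold (suc m) ≤? Z)
        where
        step : Dec (threshold (suc m) ≤ Z) → ∃ λ m → n ≤ m × threshold m ≤ Z × Z < threshold (suc m)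
        step (yes p) = search fuel (suc m) (m≤n⇒m≤1+n n≤m) p (subst (Z <_) (cong suc (sym (+-suc fuel m))) k)
        step (no p) = m , n≤m , h , ≰⇒> p

    upper-bound : ∀ {Z} e d e′ d′ w → Z < Q ^ e * 4 ^ d → d′ + d ≤ 125 * w → e + w ≡ e′ → 4 ^ d′ * Z ≤ Q ^ e′
    upper-bound {Z} e d e′ d′ w h hd he = begin
      4 ^ d′ * Z ≤⟨ *-monoʳ-≤ (4 ^ d′) (<⇒≤ h) ⟩
      4 ^ d′ * (Q ^ e * 4 ^ d) ≡⟨ lemma (4 ^ d′) (Q ^ e) (4 ^ d) ⟩
      Q ^ e * (4 ^ d′ * 4 ^ d) ≡⟨ cong (Q ^ e *_) (sym (^-distribˡ-+-* 4 d′ d)) ⟩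
      Q ^ e * 4 ^ (d′ + d) ≤⟨ *-monoʳ-≤ (Q ^ e) (^-monoʳ-≤ 4 hd) ⟩
      Q ^ e * 4 ^ (125 * w) ≡⟨ cong (Q ^ e *_) (sym (^-*-assoc 4 125 w)) ⟩
      Q ^ e * (4 ^ 125) ^ w ≤⟨ *-monoʳ-≤ (Q ^ e) (^-monoˡ-≤ w Q≥) ⟩
      Q ^ e * Q ^ w ≡⟨ sym (^-distribˡ-+-* Q e w) ⟩
      Q ^ (e + w) ≡⟨ cong (Q ^_) he ⟩
      Q ^ e′ ∎
      where
      open ≤-Reasoning
      lemma : ∀ x y z → x * (y * z) ≡ y * (x * z)
      lemma = solve-∀

    -- The windows of n and n + 1 overlap: this needs 4^(24n + 35) ≤ Q^(2n - 8). For n = 5 + j the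
    -- exponents are 155 + 24j and 2 + 2j, and Q ≥ 4^125 suffices. At n = 4 no power of Q would be
    -- left.
    upper : ∀ {Z} n → 5 ≤ n → Z < threshold (suc n) → 4 ^ (n * 8 + 6) * Z ≤ Q ^ (n * 8)
    upper {Z} n n≥5 h = upper-bound (suc n * 6 + 2) (suc n * 16 + 13) (n * 8) (n * 8 + 6) (2 + 2 * j) h
      (subst (λ n → n * 8 + 6 + (suc n * 16 + 13) ≤ 125 * (2 + 2 * j)) n≡ (begin
        (5 + j) * 8 + 6 + (suc (5 + j) * 16 + 13) ≡⟨ exponent₁ j ⟩
        155 + j * 24 ≤⟨ +-mono-≤ (m≤m+n 155 95) (*-monoʳ-≤ j (m≤m+n 24 226)) ⟩
        250 + j * 250 ≡⟨ exponent₂ j ⟩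
        125 * (2 + 2 * j) ∎))
      (subst (λ n → suc n * 6 + 2 + (2 + 2 * j) ≡ n * 8) n≡ (exponent₃ j))
      where
      open ≤-Reasoning
      j = n ∸ 5
      n≡ : 5 + j ≡ n
      n≡ = m+[n∸m]≡n n≥5
      exponent₁ : ∀ j → (5 + j) * 8 + 6 + ((1 + (5 + j)) * 16 + 13) ≡ 155 + j * 24
      exponent₁ = solve-∀
      exponent₂ : ∀ j → 250 + j * 250 ≡ 125 * (2 + 2 * j)
      exponent₂ = solve-∀
      exponent₃ : ∀ j → (1 + (5 + j)) * 6 + 2 + (2 + 2 * j) ≡ (5 + j) * 8
      exponent₃ = solve-∀

    power-8 : ∀ x n → x ^ n * x ^ n * x ^ n * x ^ n * x ^ n * x ^ n * x ^ n * x ^ n ≡ x ^ (n * 8)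
    power-8 x n = trans (solve 1 (λ y → y :* y :* y :* y :* y :* y :* y :* y := y :^ 8) refl (x ^ n)) (^-*-assoc x n 8)
      where open +-*-Solver

    power-6 : ∀ x n → x ^ n * x ^ n * (x ^ n * x ^ n) * (x ^ n * x ^ n) ≡ x ^ (n * 6)
    power-6 x n = trans (solve 1 (λ y → y :* y :* (y :* y) :* (y :* y) := y :^ 6) refl (x ^ n)) (^-*-assoc x n 6)
      where open +-*-Solver

    power-16 : ∀ x n → let y = x ^ n in y * y * (y * y) * (y * y) * (y * y) * (y * y) * (y * y) * (y * y) * (y * y) ≡ x ^ (n * 16)
    power-16 x n = trans (solve 1 (λ y → y :* y :* (y :* y) :* (y :* y) :* (y :* y) :* (y :* y) :* (y :* y) :* (y :* y) :* (y :* y) := y :^ 16) refl (x ^ n)) (^-*-assoc x n 16)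
      where open +-*-Solver

  module LargeSolutions (𝓡 : NormedRing) where
    open Ring 𝓡

    no-large-solution : ∀ {Q} → 4 ^ 125 ≤ Q → ∀ {a c d s t x y z} → let b = a ⊕ 𝟚 in
      N a ≤ 4 * Q → N b ≤ 4 * Q → Q ≤ 4 * N a → Q ≤ 4 * N b → 64 * (Q * Q * Q) ≤ N c → N c ≤ 1024 * (Q * Q * Q) →
      N s ≤ 64 * (Q * Q) → N t ≤ 64 * (Q * Q) → 1 ≤ N s → 1 ≤ N t →
      a ⊗ c ⊕ 𝟙 ≡ s ⊗ s → b ⊗ c ⊕ 𝟙 ≡ t ⊗ t → a ⊗ d ⊕ 𝟙 ≡ x ⊗ x → b ⊗ d ⊕ 𝟙 ≡ y ⊗ y → c ⊗ d ⊕ 𝟙 ≡ z ⊗ z →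
      ¬ Q ^ 33 ≤ N z
    no-large-solution {Q} Q≥ {a} {c} {d} {z = z} a≤ b≤ a≥ b≥ c≥ c≤ s≤ t≤ s>0 t>0 hs ht hx hy hz large
      = conclude (bracket 5 (threshold-5 large))
      where
      open Thresholds Q≥
      Q≥16 : 16 ≤ Q
      Q≥16 = ≤-trans (^-monoʳ-≤ 4 {2} {125} (s≤s (s≤s z≤n))) Q≥
      lower : ∀ n {f g} → threshold n ≤ N z → f ≡ 4 ^ (n * 16) → g ≡ Q ^ (n * 6) → f * g * (Q * Q) * 67108864 ≤ N z
      lower n {f} {g} lo refl refl = ≤-trans (≤-reflexive (begin
        f * g * (Q * Q) * 67108864 ≡⟨ lemma f g (Q * Q) 67108864 ⟩
        g * (Q * Q) * (f * 67108864) ≡⟨ cong₂ _*_ (trans (cong (λ t → g * (Q * t)) (sym (*-identityʳ Q))) (sym (^-distribˡ-+-* Q (n * 6) 2)))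
            (sym (^-distribˡ-+-* 4 (n * 16) 13)) ⟩
        threshold n ∎)) lo
        where
        open ≡-Reasoning
        lemma : ∀ x y z w → x * y * z * w ≡ y * z * (x * w)
        lemma = solve-∀
      upper′ : ∀ n {f g} → 5 ≤ n → N z < threshold (suc n) → f ≡ 4 ^ (n * 8) → g ≡ Q ^ (n * 8) → f * N z * 4096 ≤ g
      upper′ n {f} {g} n≥5 hi refl refl = ≤-trans (≤-reflexive (begin
        f * N z * 4096 ≡⟨ lemma f (N z) 4096 ⟩
        f * 4096 * N z ≡⟨ cong (_* N z) (sym (^-distribˡ-+-* 4 (n * 8) 6)) ⟩
        4 ^ (n * 8 + 6) * N z ∎)) (upper n n≥5 hi)
        where
        open ≡-Reasoning
        lemma : ∀ x y z → x * y * z ≡ x * z * y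
        lemma = solve-∀
      conclude : (∃ λ m → 5 ≤ m × threshold m ≤ N z × N z < threshold (suc m)) → ⊥
      conclude (suc ρ , n≥5 , lo , hi) = Gap.gap-⊥ 𝓡 a c ρ Q≥16 a≤ b≤ a≥ b≥ c≥ c≤ hz
        (lower (suc ρ) lo (power-16 4 (suc ρ)) (power-6 Q (suc ρ)))
        (upper′ (suc ρ) n≥5 hi (power-8 4 (suc ρ)) (power-8 Q (suc ρ))) hs ht hx hy s≤ t≤ s>0 t>0

  -- The Pellian equation and the sequence of extensions

  module Pell (𝓡 : NormedRing) (k : NormedRing.Carrier 𝓡) where
    open Ring 𝓡

    a b : Carrier
    a = k ⊖ 𝟙
    b = k ⊕ 𝟙

    integral : ∀ {x y} → x ⊗ y ≡ 𝟘 → x ≡ 𝟘 ⊎ y ≡ 𝟘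
    integral {x} {y} h with N x in eq
    ... | zero = inj₁ (N≡0 eq)
    ... | suc _ = inj₂ (⊗-cancel (subst (1 ≤_) (sym eq) (s≤s z≤n)) h)

    infix 4 _≡±_
    _≡±_ : Carrier → Carrier → Set
    x ≡± y = x ≡ y ⊎ x ≡ neg y

    square≡ : ∀ {x y} → x ⊗ x ≡ y ⊗ y → x ≡± y
    square≡ {x} {y} h with integral {x ⊖ y} {x ⊕ y} (begin
        (x ⊖ y) ⊗ (x ⊕ y) ≡⟨ solve 2 (λ x y → (x :- y) :* (x :+ y) := x :* x :- y :* y) refl x y ⟩
        x ⊗ x ⊖ y ⊗ y ≡⟨ cong (_⊖ y ⊗ y) h ⟩
        y ⊗ y ⊖ y ⊗ y ≡⟨ ⊖-inverse (y ⊗ y) ⟩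
        𝟘 ∎)
      where open ≡-Reasoning
    ... | inj₁ p = inj₁ (⊖≡𝟘 p)
    ... | inj₂ p = inj₂ (⊖≡𝟘 (trans (solve 2 (λ x y → x :- :- y := x :+ y) refl x y) p))

    ±-square : ∀ {x y} → x ≡± y → x ⊗ x ≡ y ⊗ y
    ±-square (inj₁ refl) = refl
    ±-square {y = y} (inj₂ refl) = solve 1 (λ y → :- y :* :- y := y :* y) refl y

    ±-neg : ∀ {x y} → x ≡± y → neg x ≡± y
    ±-neg (inj₁ refl) = inj₂ refl
    ±-neg {y = y} (inj₂ refl) = inj₁ (solve 1 (λ y → :- :- y := y) refl y)

    -- V m √b + W m √a = (√b + √a)(k + √(ab))^m, where k + √(ab) is a unit because ab = k² - 1.
    V W : ℕ → Carrier
    V zero = 𝟙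
    V (suc m) = k ⊗ V m ⊕ a ⊗ W m
    W zero = 𝟙
    W (suc m) = k ⊗ W m ⊕ b ⊗ V m

    V-back : ∀ m → k ⊗ V (suc m) ⊖ a ⊗ W (suc m) ≡ V m
    V-back m = solve 3 (λ k v w → k :* (k :* v :+ (k :- con (+ 1)) :* w) :- (k :- con (+ 1)) :* (k :* w :+ (k :+ con (+ 1)) :* v) := v) refl k (V m) (W m)

    W-back : ∀ m → k ⊗ W (suc m) ⊖ b ⊗ V (suc m) ≡ W m
    W-back m = solve 3 (λ k v w → k :* (k :* w :+ (k :+ con (+ 1)) :* v) :- (k :+ con (+ 1)) :* (k :* v :+ (k :- con (+ 1)) :* w) := w) refl k (V m) (W m)

    Reach : Carrier → Carrier → Set
    Reach x y = ∃ λ m → x ≡± V m × y ≡± W m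

    reach-negʳ : ∀ {x y} → Reach x y → Reach x (neg y)
    reach-negʳ (m , p , q) = m , p , ±-neg q

    -- Equal signs raise the index. Opposite signs amount to conjugation, for which the same map is
    -- the inverse step and lowers the index; at index 0 it changes the sign of the second entry
    -- only.
    reach-step : ∀ {x y} → Reach x y → Reach (k ⊗ x ⊕ a ⊗ y) (k ⊗ y ⊕ b ⊗ x)
    reach-step (m , inj₁ refl , inj₁ refl) = suc m , inj₁ refl , inj₁ refl
    reach-step (m , inj₂ refl , inj₂ refl) = suc m
      , inj₂ (solve 4 (λ k a v w → k :* :- v :+ a :* :- w := :- (k :* v :+ a :* w)) refl k a (V m) (W m))
      , inj₂ (solve 4 (λ k a v w → k :* :- v :+ a :* :- w := :- (k :* v :+ a :* w)) refl k b (W m) (V m))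
    reach-step (zero , inj₁ refl , inj₂ refl) = 0
      , inj₁ (solve 1 (λ k → k :* con (+ 1) :+ (k :- con (+ 1)) :* :- con (+ 1) := con (+ 1)) refl k)
      , inj₁ (solve 1 (λ k → k :* :- con (+ 1) :+ (k :+ con (+ 1)) :* con (+ 1) := con (+ 1)) refl k)
    reach-step (zero , inj₂ refl , inj₁ refl) = 0
      , inj₂ (solve 1 (λ k → k :* :- con (+ 1) :+ (k :- con (+ 1)) :* con (+ 1) := :- con (+ 1)) refl k)
      , inj₂ (solve 1 (λ k → k :* con (+ 1) :+ (k :+ con (+ 1)) :* :- con (+ 1) := :- con (+ 1)) refl k)
    reach-step (suc m , inj₁ refl , inj₂ refl) = m
      , inj₁ (trans (solve 4 (λ k a v w → k :* v :+ a :* :- w := k :* v :- a :* w) refl k a (V (suc m)) (W (suc m))) (V-back m))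
      , inj₂ (trans (solve 4 (λ k a v w → k :* :- v :+ a :* w := :- (k :* v :- a :* w)) refl k b (W (suc m)) (V (suc m))) (cong neg (W-back m)))
    reach-step (suc m , inj₂ refl , inj₁ refl) = m
      , inj₂ (trans (solve 4 (λ k a v w → k :* :- v :+ a :* w := :- (k :* v :- a :* w)) refl k a (V (suc m)) (W (suc m))) (cong neg (V-back m)))
      , inj₁ (trans (solve 4 (λ k a v w → k :* v :+ a :* :- w := k :* v :- a :* w) refl k b (W (suc m)) (V (suc m))) (W-back m))

    Pellian : Carrier → Carrier → Set
    Pellian x y = b ⊗ (x ⊗ x) ⊖ a ⊗ (y ⊗ y) ≡ 𝟚

    pellian-step : ∀ {x y} → Pellian x y → Pellian (k ⊗ x ⊕ a ⊗ y) (k ⊗ y ⊕ b ⊗ x)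
    pellian-step {x} {y} h = trans (solve 3 (λ k x y →
        (k :+ con (+ 1)) :* ((k :* x :+ (k :- con (+ 1)) :* y) :* (k :* x :+ (k :- con (+ 1)) :* y))
          :- (k :- con (+ 1)) :* ((k :* y :+ (k :+ con (+ 1)) :* x) :* (k :* y :+ (k :+ con (+ 1)) :* x))
        := (k :+ con (+ 1)) :* (x :* x) :- (k :- con (+ 1)) :* (y :* y)) refl k x y) h

    pellian-negʳ : ∀ {x y} → Pellian x y → Pellian x (neg y)
    pellian-negʳ {x} {y} h = trans (solve 4 (λ a b x y → b :* (x :* x) :- a :* (:- y :* :- y) := b :* (x :* x) :- a :* (y :* y)) refl a b x y) h

    pellian-V : ∀ m → Pellian (V m) (W m)
    pellian-V zero = solve 1 (λ k → (k :+ con (+ 1)) :* (con (+ 1) :* con (+ 1)) :- (k :- con (+ 1)) :* (con (+ 1) :* con (+ 1)) := con (+ 2)) refl k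
    pellian-V (suc m) = pellian-step (pellian-V m)

    -- The extensions D m of {k − 1, k + 1}: D 2 = 16k³ − 4k.
    D : ℕ → Carrier
    D zero = 𝟘
    D (suc zero) = ι (+ 4) ⊗ k
    D (suc (suc m)) = (ι (+ 4) ⊗ k ⊗ k ⊖ 𝟚) ⊗ D (suc m) ⊖ D m ⊕ ι (+ 4) ⊗ k

    module _ {Q : ℕ} (hQ : N k ≡ Q) (Q≥ : 4096 ≤ Q) where

      a≤ : N a ≤ 4 * Q
      a≤ = ≤-trans (N⊖≤ (≤-reflexive hQ) (≤-reflexive N-𝟙)) (≤-trans (*-monoʳ-≤ 2 (+-monoʳ-≤ Q (≤-trans (≤ᵇ⇒≤ 1 4096 tt) Q≥))) (≤-reflexive (lemma Q)))
        where
        lemma : ∀ Q → 2 * (Q + Q) ≡ 4 * Q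
        lemma = solve-∀

      b≤ : N b ≤ 4 * Q
      b≤ = ≤-trans (N⊕≤ (≤-reflexive hQ) (≤-reflexive N-𝟙)) (≤-trans (*-monoʳ-≤ 2 (+-monoʳ-≤ Q (≤-trans (≤ᵇ⇒≤ 1 4096 tt) Q≥))) (≤-reflexive (lemma Q)))
        where
        lemma : ∀ Q → 2 * (Q + Q) ≡ 4 * Q
        lemma = solve-∀

      shifted : ∀ {n} → Q ≤ 2 * (n + 1) → Q ≤ 4 * n
      shifted {zero} h = contradiction (≤-trans Q≥ h) λ { (s≤s (s≤s ())) }
      shifted {suc n} h = ≤-trans h (≤-trans (≤-reflexive (lemma₁ n)) (≤-trans (m≤m+n _ (2 * n)) (≤-reflexive (lemma₂ n))))
        where
        lemma₁ : ∀ n → 2 * ((1 + n) + 1) ≡ 4 + 2 * n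
        lemma₁ = solve-∀
        lemma₂ : ∀ n → 4 + 2 * n + 2 * n ≡ 4 * (1 + n)
        lemma₂ = solve-∀

      a≥ : Q ≤ 4 * N a
      a≥ = shifted {N a} (begin
        Q ≡⟨ sym hQ ⟩
        N k ≡⟨ cong N (solve 1 (λ k → k := (k :- con (+ 1)) :+ con (+ 1)) refl k) ⟩
        N (a ⊕ 𝟙) ≤⟨ N⊕≤ ≤-refl (≤-reflexive N-𝟙) ⟩
        2 * (N a + 1) ∎)
        where open ≤-Reasoning

      b≥ : Q ≤ 4 * N b
      b≥ = shifted {N b} (begin
        Q ≡⟨ sym hQ ⟩
        N k ≡⟨ cong N (solve 1 (λ k → k := (k :+ con (+ 1)) :- con (+ 1)) refl k) ⟩
        N (b ⊖ 𝟙) ≤⟨ N⊖≤ ≤-refl (≤-reflexive N-𝟙) ⟩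
        2 * (N b + 1) ∎)
        where open ≤-Reasoning

      a>0 : 1 ≤ N a
      a>0 with N a in eq
      ... | suc _ = s≤s z≤n
      ... | zero = contradiction (≤-trans (≤-trans (≤ᵇ⇒≤ 1 4096 tt) Q≥) (≤-trans a≥ (≤-reflexive (cong (4 *_) eq)))) λ ()

      -- The equation reads a(y² - x²) = 2(x² - 1). For small x the right side has norm below that
      -- of a, so both sides are 0 and x² = y² = 1.
      pellian-small : ∀ {x y} → Pellian x y → N x ≤ 8 → Reach x y
      pellian-small {x} {y} h x≤8 = 0 , square≡ x²≡1 , square≡ (trans (sym x²≡y²) x²≡1)
        where
        relation : a ⊗ (y ⊗ y ⊖ x ⊗ x) ≡ 𝟚 ⊗ (x ⊗ x ⊖ 𝟙)
        relation = trans (solve 3 (λ k x y → (k :- con (+ 1)) :* (y :* y :- x :* x)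
              := con (+ 2) :* (x :* x) :- ((k :+ con (+ 1)) :* (x :* x) :- (k :- con (+ 1)) :* (y :* y))) refl k x y)
          (trans (cong (𝟚 ⊗ (x ⊗ x) ⊖_) h) (solve 1 (λ x → con (+ 2) :* x :- con (+ 2) := con (+ 2) :* (x :- con (+ 1))) refl (x ⊗ x)))
        difference≡0 : N (y ⊗ y ⊖ x ⊗ x) ≡ 0
        difference≡0 with N (y ⊗ y ⊖ x ⊗ x) in eq
        ... | zero = refl
        ... | suc n = contradiction (begin
          4096 ≤⟨ Q≥ ⟩
          Q ≤⟨ a≥ ⟩
          4 * N a ≤⟨ *-monoʳ-≤ 4 (m≤m*n (N a) (suc n)) ⟩
          4 * (N a * suc n) ≡⟨ cong (λ t → 4 * (N a * t)) (sym eq) ⟩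
          4 * (N a * N (y ⊗ y ⊖ x ⊗ x)) ≡⟨ cong (4 *_) (trans (sym (N-⊗ a _)) (cong N relation)) ⟩
          4 * N (𝟚 ⊗ (x ⊗ x ⊖ 𝟙)) ≤⟨ *-monoʳ-≤ 4 (N⊗≤ (≤-reflexive (N-ι (+ 2))) (N⊖≤ (N⊗≤ x≤8 x≤8) (≤-reflexive N-𝟙))) ⟩
          2080 ∎) (<⇒≱ (≤ᵇ⇒≤ 2081 4096 tt))
          where open ≤-Reasoning
        x²≡y² : x ⊗ x ≡ y ⊗ y
        x²≡y² = sym (⊖≡𝟘 (N≡0 difference≡0))
        x²≡1 : x ⊗ x ≡ 𝟙 ⊗ 𝟙
        x²≡1 = trans (⊖≡𝟘 (⊗-cancel {𝟚} (≤-trans (s≤s z≤n) (≤-reflexive (sym (N-ι (+ 2))))) (begin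
          𝟚 ⊗ (x ⊗ x ⊖ 𝟙) ≡⟨ sym relation ⟩
          a ⊗ (y ⊗ y ⊖ x ⊗ x) ≡⟨ cong (a ⊗_) (N≡0 difference≡0) ⟩
          a ⊗ 𝟘 ≡⟨ ⊗-zeroʳ a ⟩
          𝟘 ∎))) (sym (⊗-identityˡ 𝟙))
          where open ≡-Reasoning

      -- The two candidates k x ∓ a y have product x² + 2a and sum 2k x, so one of them is large and the other is smaller than x.
      descent-size : ∀ {n p r} → 9 ≤ n → p * r ≤ 2 * (n * n + 16 * Q) → 4 * Q * n ≤ 2 * (p + r) → p ≤ r → p < n
      descent-size {n} {p} {r} n≥9 hpr hsum p≤r with suc p ≤? n
      ... | yes h = h
      ... | no h = contradiction (*-cancelˡ-≤ Q {{>-nonZero (≤-trans (≤ᵇ⇒≤ 1 4096 tt) Q≥)}} bound) (<⇒≱ (≤-trans (≤ᵇ⇒≤ 513 1134 tt) (*-monoʳ-≤ 14 (*-mono-≤ n≥9 n≥9))))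
        where
        open ≤-Reasoning
        n≤p : n ≤ p
        n≤p = ≮⇒≥ h
        Qn≤r : Q * n ≤ r
        Qn≤r = *-cancelˡ-≤ 4 (begin
          4 * (Q * n) ≡⟨ sym (*-assoc 4 Q n) ⟩
          4 * Q * n ≤⟨ hsum ⟩
          2 * (p + r) ≤⟨ *-monoʳ-≤ 2 (+-monoˡ-≤ r p≤r) ⟩
          2 * (r + r) ≡⟨ lemma r ⟩
          4 * r ∎)
          where
          lemma : ∀ r → 2 * (r + r) ≡ 4 * r
          lemma = solve-∀
        bound : Q * (14 * (n * n)) ≤ Q * 512
        bound = +-cancelˡ-≤ (2 * Q * (n * n)) _ _ (begin
          2 * Q * (n * n) + Q * (14 * (n * n)) ≡⟨ lemma₁ Q n ⟩
          16 * (n * (Q * n)) ≤⟨ *-monoʳ-≤ 16 (≤-trans (*-mono-≤ n≤p Qn≤r) hpr) ⟩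
          16 * (2 * (n * n + 16 * Q)) ≡⟨ lemma₂ Q (n * n) ⟩
          2 * 16 * (n * n) + Q * 512 ≤⟨ +-monoˡ-≤ (Q * 512) (*-monoˡ-≤ (n * n) (*-monoʳ-≤ 2 (≤-trans (≤ᵇ⇒≤ 16 4096 tt) Q≥))) ⟩
          2 * Q * (n * n) + Q * 512 ∎)
          where
          lemma₁ : ∀ Q n → 2 * Q * (n * n) + Q * (14 * (n * n)) ≡ 16 * (n * (Q * n))
          lemma₁ = solve-∀
          lemma₂ : ∀ Q n → 16 * (2 * (n + 16 * Q)) ≡ 2 * 16 * n + Q * 512
          lemma₂ = solve-∀

      descent-product : ∀ {x y} → Pellian x y → N (k ⊗ x ⊕ a ⊗ neg y) * N (k ⊗ x ⊕ a ⊗ y) ≤ 2 * (N x * N x + 16 * Q)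
      descent-product {x} {y} h = begin
        N (k ⊗ x ⊕ a ⊗ neg y) * N (k ⊗ x ⊕ a ⊗ y) ≡⟨ sym (N-⊗ _ _) ⟩
        N ((k ⊗ x ⊕ a ⊗ neg y) ⊗ (k ⊗ x ⊕ a ⊗ y)) ≡⟨ cong N (solve 3 (λ k x y →
            (k :* x :+ (k :- con (+ 1)) :* :- y) :* (k :* x :+ (k :- con (+ 1)) :* y)
            := x :* x :+ (k :- con (+ 1)) :* ((k :+ con (+ 1)) :* (x :* x) :- (k :- con (+ 1)) :* (y :* y))) refl k x y) ⟩
        N (x ⊗ x ⊕ a ⊗ (b ⊗ (x ⊗ x) ⊖ a ⊗ (y ⊗ y))) ≤⟨ N⊕≤ (N⊗≤ ≤-refl ≤-refl) (N⊗≤ a≤ (≤-reflexive (trans (cong N h) (N-ι (+ 2))))) ⟩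
        2 * (N x * N x + 4 * Q * 4) ≡⟨ cong (λ t → 2 * (N x * N x + t)) (lemma Q) ⟩
        2 * (N x * N x + 16 * Q) ∎
        where
        open ≤-Reasoning
        lemma : ∀ Q → 4 * Q * 4 ≡ 16 * Q
        lemma = solve-∀

      descent-sum : ∀ x y → 4 * Q * N x ≤ 2 * (N (k ⊗ x ⊕ a ⊗ neg y) + N (k ⊗ x ⊕ a ⊗ y))
      descent-sum x y = begin
        4 * Q * N x ≡⟨ cong (λ t → 4 * t * N x) (sym hQ) ⟩
        4 * N k * N x ≡⟨ sym (trans (N-⊗ (𝟚 ⊗ k) x) (cong (_* N x) (trans (N-⊗ 𝟚 k) (cong (_* N k) (N-ι (+ 2)))))) ⟩
        N (𝟚 ⊗ k ⊗ x) ≡⟨ cong N (solve 4 (λ k a x y → con (+ 2) :* k :* x := (k :* x :+ a :* :- y) :+ (k :* x :+ a :* y)) refl k a x y) ⟩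
        N ((k ⊗ x ⊕ a ⊗ neg y) ⊕ (k ⊗ x ⊕ a ⊗ y)) ≤⟨ N-⊕ _ _ ⟩
        2 * (N (k ⊗ x ⊕ a ⊗ neg y) + N (k ⊗ x ⊕ a ⊗ y)) ∎
        where open ≤-Reasoning

      -- The step followed by a change of sign of the second entry is an involution.
      reach-back : ∀ {x y} → Reach (k ⊗ x ⊕ a ⊗ y) (k ⊗ y ⊕ b ⊗ x) → Reach x (neg y)
      reach-back {x} {y} r = subst₂ Reach
        (solve 3 (λ k x y → k :* (k :* x :+ (k :- con (+ 1)) :* y) :+ (k :- con (+ 1)) :* :- (k :* y :+ (k :+ con (+ 1)) :* x) := x) refl k x y)
        (solve 3 (λ k x y → k :* :- (k :* y :+ (k :+ con (+ 1)) :* x) :+ (k :+ con (+ 1)) :* (k :* x :+ (k :- con (+ 1)) :* y) := :- y) refl k x y)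
        (reach-step (reach-negʳ r))

      neg-neg : ∀ y → neg (neg y) ≡ y
      neg-neg y = solve 1 (λ y → :- :- y := y) refl y

      pellian-reach : ∀ {x y} → Pellian x y → Reach x y
      pellian-reach {x} {y} h = go x y h (<-wellFounded (N x))
        where
        go : ∀ x y → Pellian x y → Acc _<_ (N x) → Reach x y
        go x y h (acc rec) with N x ≤? 8
        ... | yes p = pellian-small h p
        ... | no p with ≤-total (N (k ⊗ x ⊕ a ⊗ neg y)) (N (k ⊗ x ⊕ a ⊗ y))
        ... | inj₁ le = subst (Reach x) (neg-neg y) (reach-back (go _ _ (pellian-step (pellian-negʳ h))
                (rec (descent-size (≰⇒> p) (descent-product h) (descent-sum x y) le))))
        ... | inj₂ le = subst (Reach x) (neg-neg y) (reach-negʳ (reach-back (go _ _ (pellian-step h)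
                (rec (descent-size (≰⇒> p) (≤-trans (≤-reflexive (*-comm (N (k ⊗ x ⊕ a ⊗ y)) _)) (descent-product h))
                  (≤-trans (descent-sum x y) (≤-reflexive (cong (2 *_) (+-comm (N (k ⊗ x ⊕ a ⊗ neg y)) _)))) le)))))

      V-recurrence : ∀ m → V (suc (suc m)) ≡ 𝟚 ⊗ k ⊗ V (suc m) ⊖ V m
      V-recurrence m = solve 3 (λ k v w → let V′ = k :* v :+ (k :- con (+ 1)) :* w in
        k :* V′ :+ (k :- con (+ 1)) :* (k :* w :+ (k :+ con (+ 1)) :* v) := con (+ 2) :* k :* V′ :- v) refl k (V m) (W m)

      -- In 2k V (m + 1) = V (m + 2) + V m the left side has norm 4Q N (V (m + 1)), and the last
      -- term is no larger than V (m + 1) by induction.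
      N-V-growth : ∀ m → N (V m) ≤ N (V (suc m)) × Q * N (V m) ≤ N (V (suc m))
      N-V-growth m = ≤-trans (≤-trans (≤-reflexive (sym (*-identityˡ _))) (*-monoˡ-≤ (N (V m)) Q>0)) (growth m) , growth m
        where
        Q>0 : 1 ≤ Q
        Q>0 = ≤-trans (≤ᵇ⇒≤ 1 4096 tt) Q≥
        step : ∀ {u v w} → 𝟚 ⊗ k ⊗ v ≡ w ⊕ u → N u ≤ N v → Q * N v ≤ N w
        step {u} {v} {w} h le = *-cancelˡ-≤ 2 (+-cancelʳ-≤ (2 * N v) _ _ (begin
          2 * (Q * N v) + 2 * N v ≤⟨ +-monoʳ-≤ (2 * (Q * N v)) (*-monoʳ-≤ 2 (≤-trans (≤-reflexive (sym (*-identityˡ _))) (*-monoˡ-≤ (N v) Q>0))) ⟩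
          2 * (Q * N v) + 2 * (Q * N v) ≡⟨ lemma Q (N v) ⟩
          4 * Q * N v ≡⟨ cong (λ t → 4 * t * N v) (sym hQ) ⟩
          4 * N k * N v ≡⟨ sym (trans (N-⊗ (𝟚 ⊗ k) v) (cong (_* N v) (trans (N-⊗ 𝟚 k) (cong (_* N k) (N-ι (+ 2)))))) ⟩
          N (𝟚 ⊗ k ⊗ v) ≡⟨ cong N h ⟩
          N (w ⊕ u) ≤⟨ N-⊕ w u ⟩
          2 * (N w + N u) ≤⟨ *-monoʳ-≤ 2 (+-monoʳ-≤ (N w) le) ⟩
          2 * (N w + N v) ≡⟨ *-distribˡ-+ 2 (N w) (N v) ⟩
          2 * N w + 2 * N v ∎))
          where
          open ≤-Reasoning
          lemma : ∀ Q v → 2 * (Q * v) + 2 * (Q * v) ≡ 4 * Q * v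
          lemma = solve-∀
        growth : ∀ m → Q * N (V m) ≤ N (V (suc m))
        growth zero = step (solve 1 (λ k → con (+ 2) :* k :* con (+ 1) := (k :* con (+ 1) :+ (k :- con (+ 1)) :* con (+ 1)) :+ con (+ 1)) refl k) ≤-refl
        growth (suc m) = step (trans (solve 2 (λ x u → x := (x :- u) :+ u) refl (𝟚 ⊗ k ⊗ V (suc m)) (V m)) (cong (_⊕ V m) (sym (V-recurrence m))))
          (≤-trans (≤-trans (≤-reflexive (sym (*-identityˡ _))) (*-monoˡ-≤ (N (V m)) Q>0)) (growth m))

      N-V : ∀ m → Q ^ m ≤ N (V m)
      N-V zero = ≤-reflexive (sym N-𝟙)
      N-V (suc m) = ≤-trans (*-monoʳ-≤ Q (N-V m)) (proj₂ (N-V-growth m))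

      -- The Pellian equation with `W` eliminated. It replaces the mixed product in the square of
      -- the recurrence of `V` and so yields the linear recurrence of `D`.
      V²-V : ∀ m → V (suc m) ⊗ V (suc m) ⊕ V m ⊗ V m ⊕ 𝟚 ⊗ a ≡ 𝟚 ⊗ k ⊗ V (suc m) ⊗ V m
      V²-V m = trans (solve 3 (λ k v w → let a = k :- con (+ 1); b = k :+ con (+ 1); V′ = k :* v :+ a :* w in
          V′ :* V′ :+ v :* v :+ con (+ 2) :* a := con (+ 2) :* k :* V′ :* v :+ a :* (con (+ 2) :- (b :* (v :* v) :- a :* (w :* w)))) refl k (V m) (W m))
        (trans (cong (λ t → 𝟚 ⊗ k ⊗ V (suc m) ⊗ V m ⊕ a ⊗ (𝟚 ⊖ t)) (pellian-V m))
          (solve 2 (λ x a → x :+ a :* (con (+ 2) :- con (+ 2)) := x) refl _ a))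

      D-V : ∀ m → a ⊗ D m ≡ V m ⊗ V m ⊖ 𝟙
      D-V zero = solve 1 (λ a → a :* con (+ 0) := con (+ 1) :* con (+ 1) :- con (+ 1)) refl a
      D-V (suc zero) = solve 1 (λ k → let V′ = k :* con (+ 1) :+ (k :- con (+ 1)) :* con (+ 1) in
        (k :- con (+ 1)) :* (con (+ 4) :* k) := V′ :* V′ :- con (+ 1)) refl k
      D-V (suc (suc m)) = begin
        a ⊗ ((ι (+ 4) ⊗ k ⊗ k ⊖ 𝟚) ⊗ D (suc m) ⊖ D m ⊕ ι (+ 4) ⊗ k)
          ≡⟨ solve 4 (λ a k x y → a :* ((con (+ 4) :* k :* k :- con (+ 2)) :* x :- y :+ con (+ 4) :* k)
               := (con (+ 4) :* k :* k :- con (+ 2)) :* (a :* x) :- a :* y :+ con (+ 4) :* k :* a) refl a k (D (suc m)) (D m) ⟩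
        (ι (+ 4) ⊗ k ⊗ k ⊖ 𝟚) ⊗ (a ⊗ D (suc m)) ⊖ a ⊗ D m ⊕ ι (+ 4) ⊗ k ⊗ a
          ≡⟨ cong₂ (λ s t → (ι (+ 4) ⊗ k ⊗ k ⊖ 𝟚) ⊗ s ⊖ t ⊕ ι (+ 4) ⊗ k ⊗ a) (D-V (suc m)) (D-V m) ⟩
        (ι (+ 4) ⊗ k ⊗ k ⊖ 𝟚) ⊗ (v ⊗ v ⊖ 𝟙) ⊖ (u ⊗ u ⊖ 𝟙) ⊕ ι (+ 4) ⊗ k ⊗ a
          ≡⟨ solve 3 (λ k v u → (con (+ 4) :* k :* k :- con (+ 2)) :* (v :* v :- con (+ 1)) :- (u :* u :- con (+ 1)) :+ con (+ 4) :* k :* (k :- con (+ 1))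
               := (con (+ 4) :* k :* k) :* (v :* v) :+ u :* u :- con (+ 1) :- con (+ 2) :* (v :* v :+ u :* u :+ con (+ 2) :* (k :- con (+ 1)))) refl k v u ⟩
        (ι (+ 4) ⊗ k ⊗ k) ⊗ (v ⊗ v) ⊕ u ⊗ u ⊖ 𝟙 ⊖ 𝟚 ⊗ (v ⊗ v ⊕ u ⊗ u ⊕ 𝟚 ⊗ a)
          ≡⟨ cong (λ t → (ι (+ 4) ⊗ k ⊗ k) ⊗ (v ⊗ v) ⊕ u ⊗ u ⊖ 𝟙 ⊖ 𝟚 ⊗ t) (V²-V m) ⟩
        (ι (+ 4) ⊗ k ⊗ k) ⊗ (v ⊗ v) ⊕ u ⊗ u ⊖ 𝟙 ⊖ 𝟚 ⊗ (𝟚 ⊗ k ⊗ v ⊗ u)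
          ≡⟨ solve 3 (λ k v u → (con (+ 4) :* k :* k) :* (v :* v) :+ u :* u :- con (+ 1) :- con (+ 2) :* (con (+ 2) :* k :* v :* u)
               := (con (+ 2) :* k :* v :- u) :* (con (+ 2) :* k :* v :- u) :- con (+ 1)) refl k v u ⟩
        (𝟚 ⊗ k ⊗ v ⊖ u) ⊗ (𝟚 ⊗ k ⊗ v ⊖ u) ⊖ 𝟙 ≡⟨ cong (λ t → t ⊗ t ⊖ 𝟙) (sym (V-recurrence m)) ⟩
        V (suc (suc m)) ⊗ V (suc (suc m)) ⊖ 𝟙 ∎
        where
        open ≡-Reasoning
        v = V (suc m)
        u = V m

      -- Eliminating d gives b x² - a y² = b - a = 2. The norm of x is kept because it carries the
      -- growth in m.
      extension : ∀ {d x y} → a ⊗ d ⊕ 𝟙 ≡ x ⊗ x → b ⊗ d ⊕ 𝟙 ≡ y ⊗ y → ∃ λ m → d ≡ D m × N x ≡ N (V m)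
      extension {d} {x} {y} hx hy with pellian-reach {x} {y} (begin
          b ⊗ (x ⊗ x) ⊖ a ⊗ (y ⊗ y) ≡⟨ cong₂ (λ s t → b ⊗ s ⊖ a ⊗ t) (sym hx) (sym hy) ⟩
          b ⊗ (a ⊗ d ⊕ 𝟙) ⊖ a ⊗ (b ⊗ d ⊕ 𝟙) ≡⟨ solve 2 (λ k d → let a = k :- con (+ 1); b = k :+ con (+ 1) in
              b :* (a :* d :+ con (+ 1)) :- a :* (b :* d :+ con (+ 1)) := con (+ 2)) refl k d ⟩
          𝟚 ∎)
        where open ≡-Reasoning
      ... | m , p , _ = m , ⊗-cancelˡ a>0 (begin
          a ⊗ d ≡⟨ solve 1 (λ x → x := x :+ con (+ 1) :- con (+ 1)) refl (a ⊗ d) ⟩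
          a ⊗ d ⊕ 𝟙 ⊖ 𝟙 ≡⟨ cong (_⊖ 𝟙) (trans hx (±-square p)) ⟩
          V m ⊗ V m ⊖ 𝟙 ≡⟨ sym (D-V m) ⟩
          a ⊗ D m ∎) , norm p
        where
        open ≡-Reasoning
        norm : ∀ {v} → x ≡± v → N x ≡ N v
        norm (inj₁ refl) = refl
        norm (inj₂ refl) = N-neg _

  -- Runge's method for the indices 4 to 31

  open import Data.Bool using (Bool; true; false; _∧_; T)
  open import Data.List using (List; []; _∷_; [_]; _++_; reverse; length; map)
  open import Data.List.Properties using (unfold-reverse; length-reverse; reverse-involutive)

  Poly : Set
  Poly = List ℤ

  infixl 6 _⊞_
  _⊞_ : Poly → Poly → Poly
  [] ⊞ q = q
  (c ∷ p) ⊞ [] = c ∷ p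
  (c ∷ p) ⊞ (d ∷ q) = (c ℤ.+ d) ∷ (p ⊞ q)

  infixr 7 _⊡_
  _⊡_ : ℤ → Poly → Poly
  c ⊡ p = map (c ℤ.*_) p

  infixl 7 _⊠_
  _⊠_ : Poly → Poly → Poly
  [] ⊠ q = []
  (c ∷ p) ⊠ q = c ⊡ q ⊞ (+ 0 ∷ p ⊠ q)

  snip : ℤ → Poly → Poly
  snip (+ 0) [] = []
  snip c p = c ∷ p

  -- Without zeros at the top, the length of the list gives the degree; the certificates compare
  -- degrees in this way.
  trim : Poly → Poly
  trim [] = []
  trim (c ∷ p) = snip c (trim p)

  dot : Poly → Poly → ℤ
  dot (c ∷ p) (d ∷ q) = c ℤ.* d ℤ.+ dot p q
  dot _ _ = + 0

  -- The leading n + 1 coefficients of the square root of a monic polynomial with coefficients 1 ∷ h (from the top);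
  -- the list found holds the previous ones, latest first, without the leading 1.
  sqrt-loop : ℕ → Poly → Poly → Poly
  sqrt-loop (suc n) (c ∷ h) found = sqrt-loop n h ((c ℤ.- dot found (reverse found)) ℤ./ℕ 2 ∷ found)
  sqrt-loop _ _ found = found

  sqrt : ℕ → Poly → Poly
  sqrt n p with reverse p
  ... | [] = []
  ... | _ ∷ h = sqrt-loop n h [] ++ [ + 1 ]

  -- 4^(m - 1) D m and 4^m D (m + 1) as polynomials in ω = 4k.
  D̂-pair : ℕ → Poly × Poly
  D̂-step : ℕ → Poly × Poly → Poly × Poly
  D̂-step m (p , q) = q , (+ 0 ∷ + 0 ∷ q) ⊞ (ℤ.- (+ 8)) ⊡ q ⊞ (ℤ.- (+ 16)) ⊡ p ⊞ (+ 0 ∷ + (4 ^ suc m) ∷ [])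
  D̂-pair zero = [] , (+ 0 ∷ + 1 ∷ [])
  D̂-pair (suc m) = D̂-step m (D̂-pair m)

  D̂ : ℕ → Poly
  D̂ m = proj₁ (D̂-pair m)

  -- In ω = 4k the element c is (ω³ - 4ω)/4, so this is 4^m (c D m + 1). The factor 4^m = (2^m)²
  -- makes the coefficients integral without affecting squares, and the degree is 2m + 2.
  P̂ : ℕ → Poly
  P̂ m = trim ((+ 0 ∷ ℤ.- (+ 4) ∷ + 0 ∷ + 1 ∷ []) ⊠ D̂ m ⊞ [ + (4 ^ m) ])

  -- Any number serves that exceeds the coefficients of all roots and remainders while its square
  -- stays below 4^125, hence below N k.
  bound : ℕ
  bound = 2 ^ 100

  bounded : Poly → Bool
  bounded [] = true
  bounded (c ∷ p) = (∣ c ∣ ≤ᵇ bound) ∧ bounded p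

  -- Applied to reversed lists: the head is the leading coefficient and must be nonzero, so that it
  -- dominates the bounded others at ω.
  proper : Poly → Bool
  proper [] = false
  proper (c ∷ p) = (1 ≤ᵇ ∣ c ∣) ∧ bounded p

  certificate : ℕ → Poly → Poly → Bool
  certificate m s r = proper (reverse s) ∧ (length s ≤ᵇ suc (suc m)) ∧ (suc (suc m) ≤ᵇ length s) ∧ bounded (reverse r) ∧ proper (reverse r) ∧ (length r ≤ᵇ suc m)

  -- Nothing is proved about `sqrt`. For any choice of root the polynomial is root² + remainder; an
  -- inexact halving or a wrong root would show as a remainder of too large a degree, which `check`
  -- rejects.
  root remainder : ℕ → Poly
  root m = sqrt (suc m) (P̂ m)
  remainder m = trim (P̂ m ⊞ (ℤ.- (+ 1)) ⊡ (root m ⊠ root m))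

  check : ℕ → Bool
  check m = certificate m (root m) (remainder m)

  check-below : ℕ → ℕ → Bool
  check-below m zero = true
  check-below m (suc n) = check m ∧ check-below (suc m) n

  checked : T (check-below 4 28)
  checked = tt

  ∧-split : ∀ {x y} → T (x ∧ y) → T x × T y
  ∧-split {true} h = tt , h

  check-all : ∀ n m → T (check-below m n) → ∀ i → i < n → T (check (m + i))
  check-all (suc n) m h zero _ = subst (λ t → T (check t)) (sym (+-identityʳ m)) (proj₁ (∧-split {check m} h))
  check-all (suc n) m h (suc i) (s≤s i<n) = subst (λ t → T (check t)) (sym (+-suc m i)) (check-all n (suc m) (proj₂ (∧-split {check m} h)) i i<n)

  module Evaluation (𝓡 : NormedRing) (ω : NormedRing.Carrier 𝓡) where
    open Ring 𝓡

    eval : Poly → Carrier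
    eval [] = 𝟘
    eval (c ∷ p) = ι c ⊕ ω ⊗ eval p

    eval-⊞ : ∀ p q → eval (p ⊞ q) ≡ eval p ⊕ eval q
    eval-⊞ [] q = sym (⊕-identityˡ _)
    eval-⊞ (c ∷ p) [] = sym (⊕-identityʳ _)
    eval-⊞ (c ∷ p) (d ∷ q) = trans (cong₂ (λ s t → s ⊕ ω ⊗ t) (ι-+ c d) (eval-⊞ p q))
      (solve 5 (λ c d w p q → c :+ d :+ w :* (p :+ q) := (c :+ w :* p) :+ (d :+ w :* q)) refl (ι c) (ι d) ω (eval p) (eval q))

    eval-⊡ : ∀ c p → eval (c ⊡ p) ≡ ι c ⊗ eval p
    eval-⊡ c [] = solve 1 (λ c → con (+ 0) := c :* con (+ 0)) refl (ι c)
    eval-⊡ c (d ∷ p) = trans (cong₂ (λ s t → s ⊕ ω ⊗ t) (ι-* c d) (eval-⊡ c p))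
      (solve 4 (λ c d w p → c :* d :+ w :* (c :* p) := c :* (d :+ w :* p)) refl (ι c) (ι d) ω (eval p))

    eval-⊠ : ∀ p q → eval (p ⊠ q) ≡ eval p ⊗ eval q
    eval-⊠ [] q = solve 1 (λ q → con (+ 0) := con (+ 0) :* q) refl (eval q)
    eval-⊠ (c ∷ p) q = trans (eval-⊞ (c ⊡ q) (+ 0 ∷ p ⊠ q)) (trans (cong₂ (λ s t → s ⊕ (𝟘 ⊕ ω ⊗ t)) (eval-⊡ c q) (eval-⊠ p q))
      (solve 4 (λ c w p q → c :* q :+ (con (+ 0) :+ w :* (p :* q)) := (c :+ w :* p) :* q) refl (ι c) ω (eval p) (eval q)))

    eval-snip : ∀ c p → eval (snip c p) ≡ eval (c ∷ p)
    eval-snip (+ 0) [] = solve 1 (λ w → con (+ 0) := con (+ 0) :+ w :* con (+ 0)) refl ω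
    eval-snip (+ 0) (x ∷ p) = refl
    eval-snip (+ suc n) p = refl
    eval-snip -[1+ n ] p = refl

    eval-trim : ∀ p → eval (trim p) ≡ eval p
    eval-trim [] = refl
    eval-trim (c ∷ p) = trans (eval-snip c (trim p)) (cong (λ t → ι c ⊕ ω ⊗ t) (eval-trim p))

    eval-snoc : ∀ p c → eval (p ++ [ c ]) ≡ ι c ⊗ ω ↑ length p ⊕ eval p
    eval-snoc [] c = solve 2 (λ c w → c :+ w :* con (+ 0) := c :* con (+ 1) :+ con (+ 0)) refl (ι c) ω
    eval-snoc (d ∷ p) c = trans (cong (λ t → ι d ⊕ ω ⊗ t) (eval-snoc p c))
      (solve 5 (λ d w c v p → d :+ w :* (c :* v :+ p) := c :* (w :* v) :+ (d :+ w :* p)) refl (ι d) ω (ι c) (ω ↑ length p) (eval p))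

    eval-top : ∀ c h → eval (reverse (c ∷ h)) ≡ ι c ⊗ ω ↑ length h ⊕ eval (reverse h)
    eval-top c h = trans (cong eval (unfold-reverse c h)) (trans (eval-snoc (reverse h) c)
      (cong (λ t → ι c ⊗ ω ↑ t ⊕ eval (reverse h)) (length-reverse h)))

    module _ {C} (hC : 16 * (C * C) < N ω) (hbound : ∀ c → T (∣ c ∣ ≤ᵇ bound) → ∣ c ∣ ≤ C) where

      4≤N : ∀ x → 1 ≤ C → x * 4 ≤ x * N ω
      4≤N x C>0 = *-monoʳ-≤ x (≤-trans (≤-trans (≤ᵇ⇒≤ 4 16 tt) (*-monoʳ-≤ 16 {1} (*-mono-≤ C>0 C>0))) (<⇒≤ hC))

      -- The factor N ω on the left makes up for the degree being one less than the length, and lets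
      -- the induction start at the empty list.
      N-eval : 1 ≤ C → ∀ h → T (bounded h) → N (eval (reverse h)) * N ω ≤ 4 * (C * C) * N ω ^ length h
      N-eval C>0 [] _ = ≤-trans (≤-reflexive (cong (_* N ω) N-𝟘)) z≤n
      N-eval C>0 (c ∷ h) hb = begin
        N (eval (reverse (c ∷ h))) * N ω ≡⟨ cong (λ t → N t * N ω) (eval-top c h) ⟩
        N (ι c ⊗ ω ↑ length h ⊕ eval (reverse h)) * N ω ≤⟨ *-monoˡ-≤ (N ω) (N⊕≤ (N⊗≤ (≤-trans (≤-reflexive (N-ι c)) (*-mono-≤ c≤ c≤)) (N↑≤ ≤-refl (length h))) ≤-refl) ⟩
        2 * (C * C * X + Y) * N ω ≡⟨ lemma₁ (C * C) X Y (N ω) ⟩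
        2 * (C * C * (N ω * X)) + 2 * (Y * N ω) ≤⟨ +-monoʳ-≤ (2 * (C * C * (N ω * X))) (*-monoʳ-≤ 2 (N-eval C>0 h (proj₂ (∧-split hb)))) ⟩
        2 * (C * C * (N ω * X)) + 2 * (4 * (C * C) * X) ≡⟨ lemma₂ (C * C) X (N ω * X) ⟩
        2 * (C * C * (N ω * X)) + 2 * (C * C * (X * 4)) ≤⟨ +-monoʳ-≤ (2 * (C * C * (N ω * X))) (*-monoʳ-≤ 2 (*-monoʳ-≤ (C * C) (4≤N X C>0))) ⟩
        2 * (C * C * (N ω * X)) + 2 * (C * C * (X * N ω)) ≡⟨ lemma₃ (C * C) X (N ω) ⟩
        4 * (C * C) * (N ω * X) ∎
        where
        open ≤-Reasoning
        X = N ω ^ length h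
        Y = N (eval (reverse h))
        c≤ : ∣ c ∣ ≤ C
        c≤ = hbound c (proj₁ (∧-split hb))
        lemma₁ : ∀ c x y w → 2 * (c * x + y) * w ≡ 2 * (c * (w * x)) + 2 * (y * w)
        lemma₁ = solve-∀
        lemma₂ : ∀ c x y → 2 * (c * y) + 2 * (4 * c * x) ≡ 2 * (c * y) + 2 * (c * (x * 4))
        lemma₂ = solve-∀
        lemma₃ : ∀ c x w → 2 * (c * (w * x)) + 2 * (c * (x * w)) ≡ 4 * c * (w * x)
        lemma₃ = solve-∀

      -- The leading term has norm at least that of its power of ω, and by `N-eval` together with
      -- 16C² < N ω the remaining terms cancel at most half of the estimate.
      eval-N : 1 ≤ C → ∀ h → T (proper h) → N ω ^ length h ≤ 4 * (N (eval (reverse h)) * N ω)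
      eval-N C>0 (c ∷ h) hp = +-cancelʳ-≤ (N ω * X) _ _ (begin
        N ω * X + N ω * X ≡⟨ cong (λ t → N ω * X + t) (sym (*-identityˡ _)) ⟩
        N ω * X + 1 * (N ω * X) ≡⟨ lemma₀ (N ω * X) ⟩
        2 * (1 * (N ω * X)) ≤⟨ *-monoʳ-≤ 2 (*-monoˡ-≤ (N ω * X) (*-mono-≤ c≥ c≥)) ⟩
        2 * (∣ c ∣ * ∣ c ∣ * (N ω * X)) ≡⟨ lemma₁ (∣ c ∣ * ∣ c ∣) (N ω) X ⟩
        2 * (∣ c ∣ * ∣ c ∣ * X * N ω) ≡⟨ cong (λ t → 2 * (t * N ω)) (sym (trans (N-⊗ _ _) (cong₂ _*_ (N-ι c) (N-↑ ω (length h))))) ⟩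
        2 * (N (ι c ⊗ ω ↑ length h) * N ω) ≤⟨ *-monoʳ-≤ 2 (*-monoˡ-≤ (N ω) top≤) ⟩
        2 * (2 * (E + Y) * N ω) ≡⟨ lemma₂ E Y (N ω) ⟩
        4 * (E * N ω) + 4 * (Y * N ω) ≤⟨ +-monoʳ-≤ (4 * (E * N ω)) (*-monoʳ-≤ 4 (N-eval C>0 h (proj₂ (∧-split hp)))) ⟩
        4 * (E * N ω) + 4 * (4 * (C * C) * X) ≡⟨ cong (λ t → 4 * (E * N ω) + t) (lemma₃ (C * C) X) ⟩
        4 * (E * N ω) + 16 * (C * C) * X ≤⟨ +-monoʳ-≤ (4 * (E * N ω)) (*-monoˡ-≤ X (<⇒≤ hC)) ⟩
        4 * (E * N ω) + N ω * X ∎)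
        where
        open ≤-Reasoning
        X = N ω ^ length h
        Y = N (eval (reverse h))
        E = N (eval (reverse (c ∷ h)))
        c≥ : 1 ≤ ∣ c ∣
        c≥ = ≤ᵇ⇒≤ 1 ∣ c ∣ (proj₁ (∧-split hp))
        top≤ : N (ι c ⊗ ω ↑ length h) ≤ 2 * (E + Y)
        top≤ = ≤-trans (≤-reflexive (cong N (trans (solve 2 (λ x y → x := x :+ y :- y) refl _ (eval (reverse h))) (cong (_⊖ eval (reverse h)) (sym (eval-top c h))))))
          (N-⊖ _ _)
        lemma₀ : ∀ x → x + 1 * x ≡ 2 * (1 * x)
        lemma₀ = solve-∀
        lemma₁ : ∀ c w x → 2 * (c * (w * x)) ≡ 2 * (c * x * w)
        lemma₁ = solve-∀
        lemma₂ : ∀ p y w → 2 * (2 * (p + y) * w) ≡ 4 * (p * w) + 4 * (y * w)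
        lemma₂ = solve-∀
        lemma₃ : ∀ c x → 4 * (4 * c * x) ≡ 16 * c * x
        lemma₃ = solve-∀

      -- Runge's argument: if u² = s(ω)² + r(ω) with r of lower degree than s, then one of u ∓ s(ω) is too small to be nonzero.
      runge : 1 ≤ C → ∀ m s r {u} → T (certificate m s r) → ¬ u ⊗ u ≡ eval s ⊗ eval s ⊕ eval r
      runge C>0 m s r {u} cert hu
        with ∧-split {proper (reverse s)} cert
      ... | ps , c₁ with ∧-split {length s ≤ᵇ suc (suc m)} c₁
      ... | _ , c₂ with ∧-split {suc (suc m) ≤ᵇ length s} c₂
      ... | ls , c₃ with ∧-split {bounded (reverse r)} c₃
      ... | br , c₄ with ∧-split {proper (reverse r)} c₄
      ... | pr , lr = <⇒≱ hC too-small
        where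
        open ≤-Reasoning
        S = N (eval s)
        R = N (eval r)
        ω>0 : 1 ≤ N ω
        ω>0 = ≤-trans (s≤s z≤n) hC
        instance
          ω≠0 : NonZero (N ω)
          ω≠0 = >-nonZero ω>0
        power>0 : ∀ n → 1 ≤ N ω ^ n
        power>0 n = m^n>0 (N ω) n
        R>0 : 1 ≤ R
        R>0 with R in eq
        ... | suc _ = s≤s z≤n
        ... | zero = contradiction (≤-trans (power>0 (length (reverse r))) (≤-trans (eval-N C>0 (reverse r) pr)
                (≤-reflexive (cong (λ t → 4 * (t * N ω)) (trans (cong (λ t → N (eval t)) (reverse-involutive r)) eq))))) λ ()
        S-lower : N ω ^ suc m * N ω ≤ 4 * (S * N ω)
        S-lower = begin
          N ω ^ suc m * N ω ≡⟨ *-comm _ (N ω) ⟩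
          N ω ^ suc (suc m) ≤⟨ ^-monoʳ-≤ (N ω) (≤-trans (≤ᵇ⇒≤ (suc (suc m)) (length s) ls) (≤-reflexive (sym (length-reverse s)))) ⟩
          N ω ^ length (reverse s) ≤⟨ eval-N C>0 (reverse s) ps ⟩
          4 * (N (eval (reverse (reverse s))) * N ω) ≡⟨ cong (λ t → 4 * (N (eval t) * N ω)) (reverse-involutive s) ⟩
          4 * (S * N ω) ∎
        R-upper : R * N ω ≤ 4 * (C * C) * N ω ^ suc m
        R-upper = begin
          R * N ω ≡⟨ cong (λ t → N (eval t) * N ω) (sym (reverse-involutive r)) ⟩
          N (eval (reverse (reverse r))) * N ω ≤⟨ N-eval C>0 (reverse r) br ⟩
          4 * (C * C) * N ω ^ length (reverse r) ≤⟨ *-monoʳ-≤ (4 * (C * C)) (^-monoʳ-≤ (N ω) (≤-trans (≤-reflexive (length-reverse r)) (≤ᵇ⇒≤ (length r) (suc m) lr))) ⟩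
          4 * (C * C) * N ω ^ suc m ∎
        factors : (u ⊖ eval s) ⊗ (u ⊕ eval s) ≡ eval r
        factors = trans (solve 2 (λ u s → (u :- s) :* (u :+ s) := u :* u :- s :* s) refl u (eval s))
          (trans (cong (_⊖ eval s ⊗ eval s) hu) (solve 2 (λ x r → x :+ r :- x := r) refl (eval s ⊗ eval s) (eval r)))
        p = N (u ⊖ eval s)
        v = N (u ⊕ eval s)
        pv≡R : p * v ≡ R
        pv≡R = trans (sym (N-⊗ _ _)) (cong N factors)
        p>0 : 1 ≤ p
        p>0 with p in eq
        ... | suc _ = s≤s z≤n
        ... | zero = contradiction (subst (1 ≤_) (trans (sym pv≡R) (cong (_* v) eq)) R>0) λ ()
        v>0 : 1 ≤ v
        v>0 with v in eq
        ... | suc _ = s≤s z≤n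
        ... | zero = contradiction (subst (1 ≤_) (trans (sym pv≡R) (trans (cong (p *_) eq) (*-zeroʳ p))) R>0) λ ()
        sum : 4 * S ≤ 2 * (p + v)
        sum = begin
          4 * S ≡⟨ sym (trans (N-⊗ 𝟚 (eval s)) (cong (_* S) (N-ι (+ 2)))) ⟩
          N (𝟚 ⊗ eval s) ≡⟨ cong N (solve 2 (λ u s → con (+ 2) :* s := (u :+ s) :- (u :- s)) refl u (eval s)) ⟩
          N ((u ⊕ eval s) ⊖ (u ⊖ eval s)) ≤⟨ N-⊖ _ _ ⟩
          2 * (v + p) ≡⟨ cong (2 *_) (+-comm v p) ⟩
          2 * (p + v) ∎
        S≤R : S ≤ R
        S≤R = *-cancelˡ-≤ 4 (begin
          4 * S ≤⟨ sum ⟩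
          2 * (p + v) ≤⟨ *-monoʳ-≤ 2 (+-mono-≤ (≤-trans (≤-reflexive (sym (*-identityʳ p))) (*-monoʳ-≤ p v>0)) (≤-trans (≤-reflexive (sym (*-identityˡ v))) (*-monoˡ-≤ v p>0))) ⟩
          2 * (p * v + p * v) ≡⟨ cong (λ t → 2 * (t + t)) pv≡R ⟩
          2 * (R + R) ≡⟨ lemma R ⟩
          4 * R ∎)
          where
          lemma : ∀ R → 2 * (R + R) ≡ 4 * R
          lemma = solve-∀
        too-small : N ω ≤ 16 * (C * C)
        too-small = *-cancelʳ-≤ (N ω) (16 * (C * C)) (N ω ^ suc m * N ω) {{>-nonZero (*-mono-≤ (power>0 (suc m)) ω>0)}} (begin
          N ω * (N ω ^ suc m * N ω) ≤⟨ *-monoʳ-≤ (N ω) S-lower ⟩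
          N ω * (4 * (S * N ω)) ≤⟨ *-monoʳ-≤ (N ω) (*-monoʳ-≤ 4 (*-monoˡ-≤ (N ω) S≤R)) ⟩
          N ω * (4 * (R * N ω)) ≤⟨ *-monoʳ-≤ (N ω) (*-monoʳ-≤ 4 R-upper) ⟩
          N ω * (4 * (4 * (C * C) * N ω ^ suc m)) ≡⟨ lemma (N ω) (C * C) (N ω ^ suc m) ⟩
          16 * (C * C) * (N ω ^ suc m * N ω) ∎)
          where
          lemma : ∀ w c x → w * (4 * (4 * c * x)) ≡ 16 * c * (x * w)
          lemma = solve-∀

  module SmallIndices (𝓡 : NormedRing) (k : NormedRing.Carrier 𝓡) where
    open Ring 𝓡
    open Pell 𝓡 k using (D)
    open Evaluation 𝓡 (ι (+ 4) ⊗ k)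

    c : Carrier
    c = ι (+ 16) ⊗ k ⊗ k ⊗ k ⊖ ι (+ 4) ⊗ k

    ι-4^ : ∀ m → ι (+ (4 ^ m)) ≡ ι (+ 4) ↑ m
    ι-4^ zero = refl
    ι-4^ (suc m) = trans (cong ι (ℤ.pos-* 4 (4 ^ m))) (trans (ι-* (+ 4) (+ (4 ^ m))) (cong (ι (+ 4) ⊗_) (ι-4^ m)))

    eval-D̂-pair : ∀ m → ι (+ 4) ⊗ eval (proj₁ (D̂-pair m)) ≡ ι (+ 4) ↑ m ⊗ D m ×
      ι (+ 4) ⊗ eval (proj₂ (D̂-pair m)) ≡ ι (+ 4) ↑ suc m ⊗ D (suc m)
    eval-D̂-pair zero = solve 0 (con (+ 4) :* con (+ 0) := con (+ 1) :* con (+ 0)) refl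
      , solve 1 (λ k → con (+ 4) :* (con (+ 0) :+ con (+ 4) :* k :* (con (+ 1) :+ con (+ 4) :* k :* con (+ 0))) := con (+ 4) :* con (+ 1) :* (con (+ 4) :* k)) refl k
    eval-D̂-pair (suc m) = proj₂ (eval-D̂-pair m) , (begin
      ι (+ 4) ⊗ eval (proj₂ (D̂-pair (suc m)))
        ≡⟨ cong (ι (+ 4) ⊗_) (trans (eval-⊞ (((+ 0 ∷ + 0 ∷ q) ⊞ (ℤ.- (+ 8)) ⊡ q) ⊞ (ℤ.- (+ 16)) ⊡ p) (+ 0 ∷ + (4 ^ suc m) ∷ []))
             (cong (_⊕ eval (+ 0 ∷ + (4 ^ suc m) ∷ [])) (trans (eval-⊞ ((+ 0 ∷ + 0 ∷ q) ⊞ (ℤ.- (+ 8)) ⊡ q) ((ℤ.- (+ 16)) ⊡ p))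
               (cong₂ _⊕_ (trans (eval-⊞ (+ 0 ∷ + 0 ∷ q) ((ℤ.- (+ 8)) ⊡ q)) (cong (eval (+ 0 ∷ + 0 ∷ q) ⊕_) (eval-⊡ (ℤ.- (+ 8)) q))) (eval-⊡ (ℤ.- (+ 16)) p))))) ⟩
      ι (+ 4) ⊗ (𝟘 ⊕ ω ⊗ (𝟘 ⊕ ω ⊗ eval q) ⊕ ι (ℤ.- (+ 8)) ⊗ eval q ⊕ ι (ℤ.- (+ 16)) ⊗ eval p ⊕ (𝟘 ⊕ ω ⊗ (ι (+ (4 ^ suc m)) ⊕ ω ⊗ 𝟘)))
        ≡⟨ cong (λ t → ι (+ 4) ⊗ (𝟘 ⊕ ω ⊗ (𝟘 ⊕ ω ⊗ eval q) ⊕ ι (ℤ.- (+ 8)) ⊗ eval q ⊕ ι (ℤ.- (+ 16)) ⊗ eval p ⊕ (𝟘 ⊕ ω ⊗ (t ⊕ ω ⊗ 𝟘)))) (ι-4^ (suc m)) ⟩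
      ι (+ 4) ⊗ (𝟘 ⊕ ω ⊗ (𝟘 ⊕ ω ⊗ eval q) ⊕ ι (ℤ.- (+ 8)) ⊗ eval q ⊕ ι (ℤ.- (+ 16)) ⊗ eval p ⊕ (𝟘 ⊕ ω ⊗ (ι (+ 4) ⊗ f ⊕ ω ⊗ 𝟘)))
        ≡⟨ solve 4 (λ k p q f → let w = con (+ 4) :* k in
             con (+ 4) :* (con (+ 0) :+ w :* (con (+ 0) :+ w :* q) :+ con (ℤ.- (+ 8)) :* q :+ con (ℤ.- (+ 16)) :* p :+ (con (+ 0) :+ w :* (con (+ 4) :* f :+ w :* con (+ 0))))
             := (con (+ 16) :* k :* k :- con (+ 8)) :* (con (+ 4) :* q) :- con (+ 16) :* (con (+ 4) :* p) :+ con (+ 64) :* k :* f) refl k (eval p) (eval q) f ⟩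
      (ι (+ 16) ⊗ k ⊗ k ⊖ ι (+ 8)) ⊗ (ι (+ 4) ⊗ eval q) ⊖ ι (+ 16) ⊗ (ι (+ 4) ⊗ eval p) ⊕ ι (+ 64) ⊗ k ⊗ f
        ≡⟨ cong₂ (λ s t → (ι (+ 16) ⊗ k ⊗ k ⊖ ι (+ 8)) ⊗ s ⊖ ι (+ 16) ⊗ t ⊕ ι (+ 64) ⊗ k ⊗ f) (proj₂ (eval-D̂-pair m)) (proj₁ (eval-D̂-pair m)) ⟩
      (ι (+ 16) ⊗ k ⊗ k ⊖ ι (+ 8)) ⊗ (ι (+ 4) ⊗ f ⊗ D (suc m)) ⊖ ι (+ 16) ⊗ (f ⊗ D m) ⊕ ι (+ 64) ⊗ k ⊗ f
        ≡⟨ solve 4 (λ k f x y → (con (+ 16) :* k :* k :- con (+ 8)) :* (con (+ 4) :* f :* x) :- con (+ 16) :* (f :* y) :+ con (+ 64) :* k :* f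
             := con (+ 4) :* (con (+ 4) :* f) :* ((con (+ 4) :* k :* k :- con (+ 2)) :* x :- y :+ con (+ 4) :* k)) refl k f (D (suc m)) (D m) ⟩
      ι (+ 4) ⊗ (ι (+ 4) ⊗ f) ⊗ D (suc (suc m)) ∎)
      where
      open ≡-Reasoning
      p = proj₁ (D̂-pair m)
      q = proj₂ (D̂-pair m)
      f = ι (+ 4) ↑ m
      ω = ι (+ 4) ⊗ k

    eval-P̂ : ∀ m → eval (P̂ m) ≡ ι (+ 4) ↑ m ⊗ (c ⊗ D m ⊕ 𝟙)
    eval-P̂ m = begin
      eval (P̂ m) ≡⟨ eval-trim (cubic ⊠ D̂ m ⊞ [ + (4 ^ m) ]) ⟩
      eval (cubic ⊠ D̂ m ⊞ [ + (4 ^ m) ]) ≡⟨ eval-⊞ (cubic ⊠ D̂ m) [ + (4 ^ m) ] ⟩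
      eval (cubic ⊠ D̂ m) ⊕ (ι (+ (4 ^ m)) ⊕ ω ⊗ 𝟘) ≡⟨ cong₂ (λ s t → s ⊕ (t ⊕ ω ⊗ 𝟘)) (eval-⊠ cubic (D̂ m)) (ι-4^ m) ⟩
      eval cubic ⊗ eval (D̂ m) ⊕ (f ⊕ ω ⊗ 𝟘)
        ≡⟨ solve 3 (λ k x f → let w = con (+ 4) :* k in
             (con (+ 0) :+ w :* (con (ℤ.- (+ 4)) :+ w :* (con (+ 0) :+ w :* (con (+ 1) :+ w :* con (+ 0))))) :* x :+ (f :+ w :* con (+ 0))
             := (con (+ 16) :* k :* k :* k :- con (+ 4) :* k) :* (con (+ 4) :* x) :+ f) refl k (eval (D̂ m)) f ⟩
      c ⊗ (ι (+ 4) ⊗ eval (D̂ m)) ⊕ f ≡⟨ cong (λ t → c ⊗ t ⊕ f) (proj₁ (eval-D̂-pair m)) ⟩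
      c ⊗ (f ⊗ D m) ⊕ f ≡⟨ solve 3 (λ c f x → c :* (f :* x) :+ f := f :* (c :* x :+ con (+ 1))) refl c f (D m) ⟩
      f ⊗ (c ⊗ D m ⊕ 𝟙) ∎
      where
      open ≡-Reasoning
      cubic = + 0 ∷ ℤ.- (+ 4) ∷ + 0 ∷ + 1 ∷ []
      f = ι (+ 4) ↑ m
      ω = ι (+ 4) ⊗ k

    -- If z existed, 2^m z would be a square root of the polynomial value, contrary to Runge's
    -- argument with the computed certificate.
    not-square : 4 ^ 125 ≤ N k → ∀ i → i < 28 → ∀ {z} → ¬ c ⊗ D (4 + i) ⊕ 𝟙 ≡ z ⊗ z
    not-square hk i i<28 {z} hz = runge {bound} hC (λ e → ≤ᵇ⇒≤ ∣ e ∣ bound) (≤ᵇ⇒≤ 1 bound tt) m (root m) (remainder m)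
      {𝟚 ↑ m ⊗ z} (check-all 28 4 checked i i<28) (begin
        𝟚 ↑ m ⊗ z ⊗ (𝟚 ↑ m ⊗ z) ≡⟨ solve 2 (λ x z → x :* z :* (x :* z) := x :* x :* (z :* z)) refl (𝟚 ↑ m) z ⟩
        𝟚 ↑ m ⊗ 𝟚 ↑ m ⊗ (z ⊗ z) ≡⟨ cong₂ _⊗_ (trans (sym (↑-⊗ 𝟚 𝟚 m)) (cong (_↑ m) (sym (ι-* (+ 2) (+ 2))))) (sym hz) ⟩
        ι (+ 4) ↑ m ⊗ (c ⊗ D m ⊕ 𝟙) ≡⟨ sym (eval-P̂ m) ⟩
        eval (P̂ m) ≡⟨ solve 2 (λ p s → p := s :+ (p :+ con (ℤ.- (+ 1)) :* s)) refl (eval (P̂ m)) (eval (root m) ⊗ eval (root m)) ⟩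
        s² ⊕ (eval (P̂ m) ⊕ ι (ℤ.- (+ 1)) ⊗ s²) ≡⟨ cong (s² ⊕_) (sym (begin
          eval (remainder m) ≡⟨ eval-trim (P̂ m ⊞ (ℤ.- (+ 1)) ⊡ (root m ⊠ root m)) ⟩
          eval (P̂ m ⊞ (ℤ.- (+ 1)) ⊡ (root m ⊠ root m)) ≡⟨ eval-⊞ (P̂ m) ((ℤ.- (+ 1)) ⊡ (root m ⊠ root m)) ⟩
          eval (P̂ m) ⊕ eval ((ℤ.- (+ 1)) ⊡ (root m ⊠ root m))
            ≡⟨ cong (eval (P̂ m) ⊕_) (trans (eval-⊡ (ℤ.- (+ 1)) (root m ⊠ root m)) (cong (ι (ℤ.- (+ 1)) ⊗_) (eval-⊠ (root m) (root m)))) ⟩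
          eval (P̂ m) ⊕ ι (ℤ.- (+ 1)) ⊗ s² ∎)) ⟩
        s² ⊕ eval (remainder m) ∎)
      where
      open ≡-Reasoning
      m = 4 + i
      s² = eval (root m) ⊗ eval (root m)
      hC : 16 * (bound * bound) < N (ι (+ 4) ⊗ k)
      hC = <-≤-trans (*-monoʳ-< 16 (≤ᵇ⇒≤ (suc (bound * bound)) (4 ^ 125) tt)) (≤-trans (*-monoʳ-≤ 16 hk) (≤-reflexive (sym (trans (N-⊗ _ k) (cong (_* N k) (N-ι (+ 4)))))))

  -- Sizes of a, b, c, s, t, and the classification of d

  module Extensions (𝓡 : NormedRing) (k : NormedRing.Carrier 𝓡) (k≥ : 4 ^ 125 ≤ NormedRing.N 𝓡 k) where
    open Ring 𝓡
    open Pell 𝓡 k hiding (a≤; b≤; a≥; b≥)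
    open SmallIndices 𝓡 k using (c; not-square)

    Q : ℕ
    Q = N k

    Q≥4096 : 4096 ≤ Q
    Q≥4096 = ≤-trans (≤ᵇ⇒≤ 4096 (4 ^ 125) tt) k≥

    Q>0 : 1 ≤ Q
    Q>0 = ≤-trans (≤ᵇ⇒≤ 1 4096 tt) Q≥4096

    QQ>0 : 1 ≤ Q * Q
    QQ>0 = *-mono-≤ Q>0 Q>0

    module PQ = Pell 𝓡 k

    a≤ : N a ≤ 4 * Q
    a≤ = PQ.a≤ refl Q≥4096
    a≥ : Q ≤ 4 * N a
    a≥ = PQ.a≥ refl Q≥4096
    b≤ : N b ≤ 4 * Q
    b≤ = PQ.b≤ refl Q≥4096
    b≥ : Q ≤ 4 * N b
    b≥ = PQ.b≥ refl Q≥4096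

    a+2≡b : a ⊕ 𝟚 ≡ b
    a+2≡b = solve 1 (λ k → k :- con (+ 1) :+ con (+ 2) := k :+ con (+ 1)) refl k

    quadratic : Carrier
    quadratic = ι (+ 4) ⊗ (k ⊗ k)

    N-quadratic : N quadratic ≡ 16 * (Q * Q)
    N-quadratic = trans (N-⊗ (ι (+ 4)) (k ⊗ k)) (cong₂ _*_ (N-ι (+ 4)) (N-⊗ k k))

    N-c : N c ≡ 16 * Q * N (quadratic ⊖ 𝟙)
    N-c = trans (cong N (solve 1 (λ k → con (+ 16) :* k :* k :* k :- con (+ 4) :* k := con (+ 4) :* k :* (con (+ 4) :* (k :* k) :- con (+ 1))) refl k))
      (trans (N-⊗ _ _) (cong (_* N (quadratic ⊖ 𝟙)) (trans (N-⊗ (ι (+ 4)) k) (cong (_* N k) (N-ι (+ 4))))))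

    c≤ : N c ≤ 1024 * (Q * Q * Q)
    c≤ = begin
      N c ≡⟨ N-c ⟩
      16 * Q * N (quadratic ⊖ 𝟙) ≤⟨ *-monoʳ-≤ (16 * Q) (N⊖≤ (≤-reflexive N-quadratic) (≤-trans (≤-reflexive N-𝟙) (*-mono-≤ {1} {16} (s≤s z≤n) QQ>0))) ⟩
      16 * Q * (2 * (16 * (Q * Q) + 16 * (Q * Q))) ≡⟨ lemma Q ⟩
      1024 * (Q * Q * Q) ∎
      where
      open ≤-Reasoning
      lemma : ∀ Q → 16 * Q * (2 * (16 * (Q * Q) + 16 * (Q * Q))) ≡ 1024 * (Q * Q * Q)
      lemma = solve-∀

    c≥ : 64 * (Q * Q * Q) ≤ N c
    c≥ = begin
      64 * (Q * Q * Q) ≡⟨ lemma Q ⟩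
      16 * Q * (4 * (Q * Q)) ≤⟨ *-monoʳ-≤ (16 * Q) lower ⟩
      16 * Q * N (quadratic ⊖ 𝟙) ≡⟨ sym N-c ⟩
      N c ∎
      where
      open ≤-Reasoning
      lemma : ∀ Q → 64 * (Q * Q * Q) ≡ 16 * Q * (4 * (Q * Q))
      lemma = solve-∀
      lemma₁ : ∀ x → 8 * x + 8 * x ≡ 16 * x
      lemma₁ = solve-∀
      lower : 4 * (Q * Q) ≤ N (quadratic ⊖ 𝟙)
      lower = *-cancelˡ-≤ 2 (+-cancelʳ-≤ (8 * (Q * Q)) _ _ (begin
        2 * (4 * (Q * Q)) + 8 * (Q * Q) ≡⟨ cong (_+ 8 * (Q * Q)) (sym (*-assoc 2 4 (Q * Q))) ⟩
        8 * (Q * Q) + 8 * (Q * Q) ≡⟨ lemma₁ (Q * Q) ⟩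
        16 * (Q * Q) ≡⟨ sym N-quadratic ⟩
        N quadratic ≡⟨ cong N (solve 1 (λ x → x := (x :- con (+ 1)) :+ con (+ 1)) refl quadratic) ⟩
        N (quadratic ⊖ 𝟙 ⊕ 𝟙) ≤⟨ N-⊕ _ _ ⟩
        2 * (N (quadratic ⊖ 𝟙) + N 𝟙) ≡⟨ *-distribˡ-+ 2 (N (quadratic ⊖ 𝟙)) (N 𝟙) ⟩
        2 * N (quadratic ⊖ 𝟙) + 2 * N 𝟙 ≤⟨ +-monoʳ-≤ (2 * N (quadratic ⊖ 𝟙)) (≤-trans (≤-reflexive (cong (2 *_) N-𝟙)) (*-mono-≤ {2} {8} (≤ᵇ⇒≤ 2 8 tt) QQ>0)) ⟩
        2 * N (quadratic ⊖ 𝟙) + 8 * (Q * Q) ∎))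

    s t : Carrier
    s = quadratic ⊖ (𝟚 ⊗ k ⊕ 𝟙)
    t = quadratic ⊕ (𝟚 ⊗ k ⊖ 𝟙)

    ac+1 : a ⊗ c ⊕ 𝟙 ≡ s ⊗ s
    ac+1 = solve 1 (λ k → let s = con (+ 4) :* (k :* k) :- (con (+ 2) :* k :+ con (+ 1)) in
      (k :- con (+ 1)) :* (con (+ 16) :* k :* k :* k :- con (+ 4) :* k) :+ con (+ 1) := s :* s) refl k

    bc+1 : b ⊗ c ⊕ 𝟙 ≡ t ⊗ t
    bc+1 = solve 1 (λ k → let t = con (+ 4) :* (k :* k) :+ (con (+ 2) :* k :- con (+ 1)) in
      (k :+ con (+ 1)) :* (con (+ 16) :* k :* k :* k :- con (+ 4) :* k) :+ con (+ 1) := t :* t) refl k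

    root-size : ∀ {n} → n ≤ 2 * (4 * Q + 1) → 2 * (16 * (Q * Q) + n) ≤ 64 * (Q * Q)
    root-size {n} h = begin
      2 * (16 * (Q * Q) + n) ≤⟨ *-monoʳ-≤ 2 (+-monoʳ-≤ (16 * (Q * Q)) h) ⟩
      2 * (16 * (Q * Q) + 2 * (4 * Q + 1)) ≡⟨ lemma₁ Q ⟩
      32 * (Q * Q) + (16 * (Q * 1) + 4 * (1 * 1)) ≤⟨ +-monoʳ-≤ (32 * (Q * Q)) (+-mono-≤ (*-monoʳ-≤ 16 (*-monoʳ-≤ Q Q>0)) (*-monoʳ-≤ 4 QQ>0)) ⟩
      32 * (Q * Q) + (16 * (Q * Q) + 4 * (Q * Q)) ≡⟨ lemma₂ (Q * Q) ⟩
      52 * (Q * Q) ≤⟨ *-monoˡ-≤ (Q * Q) (≤ᵇ⇒≤ 52 64 tt) ⟩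
      64 * (Q * Q) ∎
      where
      open ≤-Reasoning
      lemma₁ : ∀ Q → 2 * (16 * (Q * Q) + 2 * (4 * Q + 1)) ≡ 32 * (Q * Q) + (16 * (Q * 1) + 4 * (1 * 1))
      lemma₁ = solve-∀
      lemma₂ : ∀ x → 32 * x + (16 * x + 4 * x) ≡ 52 * x
      lemma₂ = solve-∀

    N-2k : N (𝟚 ⊗ k) ≡ 4 * Q
    N-2k = trans (N-⊗ 𝟚 k) (cong (_* N k) (N-ι (+ 2)))

    s≤ : N s ≤ 64 * (Q * Q)
    s≤ = ≤-trans (N⊖≤ (≤-reflexive N-quadratic) ≤-refl) (root-size (N⊕≤ (≤-reflexive N-2k) (≤-reflexive N-𝟙)))

    t≤ : N t ≤ 64 * (Q * Q)
    t≤ = ≤-trans (N⊕≤ (≤-reflexive N-quadratic) ≤-refl) (root-size (N⊖≤ (≤-reflexive N-2k) (≤-reflexive N-𝟙)))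

    -- From 2x = 1 the norms would give 4 N x = 1. Both s and t have the form 2x - 1.
    even⊖1>0 : ∀ x → 1 ≤ N (𝟚 ⊗ x ⊖ 𝟙)
    even⊖1>0 x = N>0 λ h → four≢1 (N x) (begin
      4 * N x ≡⟨ sym (trans (N-⊗ 𝟚 x) (cong (_* N x) (N-ι (+ 2)))) ⟩
      N (𝟚 ⊗ x) ≡⟨ cong N (⊖≡𝟘 h) ⟩
      N 𝟙 ≡⟨ N-𝟙 ⟩
      1 ∎)
      where
      open ≡-Reasoning
      four≢1 : ∀ n → ¬ 4 * n ≡ 1
      four≢1 (suc n) h = contradiction (trans (sym (+-suc n _)) (suc-injective h)) λ ()

    s>0 : 1 ≤ N s
    s>0 = subst (λ u → 1 ≤ N u) (solve 1 (λ k → con (+ 2) :* (con (+ 2) :* (k :* k) :- k) :- con (+ 1) := con (+ 4) :* (k :* k) :- (con (+ 2) :* k :+ con (+ 1))) refl k)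
      (even⊖1>0 (𝟚 ⊗ (k ⊗ k) ⊖ k))

    t>0 : 1 ≤ N t
    t>0 = subst (λ u → 1 ≤ N u) (solve 1 (λ k → con (+ 2) :* (con (+ 2) :* (k :* k) :+ k) :- con (+ 1) := con (+ 4) :* (k :* k) :+ (con (+ 2) :* k :- con (+ 1))) refl k)
      (even⊖1>0 (𝟚 ⊗ (k ⊗ k) ⊕ k))

    module _ {d x y z : Carrier} (hx : a ⊗ d ⊕ 𝟙 ≡ x ⊗ x) (hy : b ⊗ d ⊕ 𝟙 ≡ y ⊗ y) (hz : c ⊗ d ⊕ 𝟙 ≡ z ⊗ z) where

      -- Eliminating d gives c x² = a z² + (c - a). Here N c / N a has order Q², and N x ≥ 4 lets
      -- the left side absorb c - a. This one factor Q raises the exponent from 32 for x to 33 for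
      -- z.
      z-large : 4 ≤ N x → Q * N x ≤ N z
      z-large x≥4 = square-≤ (*-cancelˡ-≤ (64 * Q) {{>-nonZero (*-mono-≤ {1} {64} (s≤s z≤n) Q>0)}} (begin
        64 * Q * (Q * N x * (Q * N x)) ≡⟨ lemma₁ Q (N x) ⟩
        64 * (Q * Q * Q) * (N x * N x) ≤⟨ *-monoˡ-≤ (N x * N x) c≥ ⟩
        N c * (N x * N x) ≤⟨ +-cancelʳ-≤ (N c * (N x * N x)) _ _ (begin
          N c * (N x * N x) + N c * (N x * N x) ≡⟨ lemma₂ (N c * (N x * N x)) ⟩
          2 * (N c * (N x * N x)) ≡⟨ cong (2 *_) (sym (trans (N-⊗ c _) (cong (N c *_) (N-⊗ x x)))) ⟩
          2 * N (c ⊗ (x ⊗ x)) ≡⟨ cong (λ u → 2 * N u) identity ⟩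
          2 * N (a ⊗ (z ⊗ z) ⊕ (c ⊖ a)) ≤⟨ *-monoʳ-≤ 2 (N⊕≤ (N⊗≤ a≤ (≤-reflexive (N-⊗ z z))) (N⊖≤ ≤-refl a≤c)) ⟩
          2 * (2 * (4 * Q * (N z * N z) + 2 * (N c + N c))) ≡⟨ lemma₃ Q (N z * N z) (N c) ⟩
          16 * Q * (N z * N z) + N c * (4 * 4) ≤⟨ +-monoʳ-≤ (16 * Q * (N z * N z)) (*-monoʳ-≤ (N c) (*-mono-≤ x≥4 x≥4)) ⟩
          16 * Q * (N z * N z) + N c * (N x * N x) ∎) ⟩
        16 * Q * (N z * N z) ≤⟨ *-monoˡ-≤ (N z * N z) (*-monoˡ-≤ Q (≤ᵇ⇒≤ 16 64 tt)) ⟩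
        64 * Q * (N z * N z) ∎))
        where
        open ≤-Reasoning
        identity : c ⊗ (x ⊗ x) ≡ a ⊗ (z ⊗ z) ⊕ (c ⊖ a)
        identity = trans (cong (c ⊗_) (sym hx)) (trans (solve 3 (λ a c d → c :* (a :* d :+ con (+ 1)) := a :* (c :* d :+ con (+ 1)) :+ (c :- a)) refl a c d)
          (cong (λ u → a ⊗ u ⊕ (c ⊖ a)) hz))
        a≤c : N a ≤ N c
        a≤c = begin
          N a ≤⟨ a≤ ⟩
          4 * Q ≡⟨ cong (4 *_) (sym (*-identityˡ Q)) ⟩
          4 * (1 * Q) ≤⟨ *-mono-≤ (≤ᵇ⇒≤ 4 64 tt) (*-monoˡ-≤ Q QQ>0) ⟩
          64 * (Q * Q * Q) ≤⟨ c≥ ⟩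
          N c ∎
        lemma₁ : ∀ Q x → 64 * Q * (Q * x * (Q * x)) ≡ 64 * (Q * Q * Q) * (x * x)
        lemma₁ = solve-∀
        lemma₂ : ∀ x → x + x ≡ 2 * x
        lemma₂ = solve-∀
        lemma₃ : ∀ Q z c → 2 * (2 * (4 * Q * z + 2 * (c + c))) ≡ 16 * Q * z + c * (4 * 4)
        lemma₃ = solve-∀

      not-large : ∀ {m} → 32 ≤ m → ¬ Q ^ m ≤ N x
      not-large {m} m≥32 large = LargeSolutions.no-large-solution 𝓡 k≥ {a} {c} {d} {s} {t} {x} {y} {z}
        a≤ (subst (λ u → N u ≤ 4 * Q) (sym a+2≡b) b≤) a≥ (subst (λ u → Q ≤ 4 * N u) (sym a+2≡b) b≥) c≥ c≤ s≤ t≤ s>0 t>0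
        ac+1 (subst (λ u → u ⊗ c ⊕ 𝟙 ≡ t ⊗ t) (sym a+2≡b) bc+1) hx (subst (λ u → u ⊗ d ⊕ 𝟙 ≡ y ⊗ y) (sym a+2≡b) hy) hz
        (≤-trans (*-monoʳ-≤ Q x≥) (z-large (≤-trans (≤-trans (≤ᵇ⇒≤ 4 4096 tt) (≤-trans Q≥4096 (m≤m*n Q (Q ^ 31)))) x≥)))
        where
        instance
          Q≠0 : NonZero Q
          Q≠0 = >-nonZero Q>0
          Q³¹≠0 : NonZero (Q ^ 31)
          Q³¹≠0 = m^n≢0 Q 31
        x≥ : Q ^ 32 ≤ N x
        x≥ = ≤-trans (^-monoʳ-≤ Q m≥32) large

      unique-extension : ¬ d ≡ 𝟘 → ¬ c ≡ d →
        d ≡ ι (+ 4) ⊗ k ⊎ d ≡ ι (+ 64) ⊗ k ⊗ k ⊗ k ⊗ k ⊗ k ⊖ ι (+ 48) ⊗ k ⊗ k ⊗ k ⊕ ι (+ 8) ⊗ k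
      unique-extension d≢0 c≢d = classify (extension refl Q≥4096 hx hy)
        where
        Conclusion : Set
        Conclusion = d ≡ ι (+ 4) ⊗ k ⊎ d ≡ ι (+ 64) ⊗ k ⊗ k ⊗ k ⊗ k ⊗ k ⊖ ι (+ 48) ⊗ k ⊗ k ⊗ k ⊕ ι (+ 8) ⊗ k
        high : ∀ i → d ≡ D (4 + i) → N x ≡ N (V (4 + i)) → Dec (i < 28) → Conclusion
        high i e n (yes i<28) = contradiction (subst (λ u → c ⊗ u ⊕ 𝟙 ≡ z ⊗ z) e hz) (not-square k≥ i i<28)
        high i e n (no i≮28) = contradiction (subst (Q ^ (4 + i) ≤_) (sym n) (PQ.N-V refl Q≥4096 (4 + i))) (not-large (+-monoʳ-≤ 4 (≮⇒≥ i≮28)))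
        classify : (∃ λ m → d ≡ D m × N x ≡ N (V m)) → Conclusion
        classify (0 , e , _) = contradiction e d≢0
        classify (1 , e , _) = inj₁ e
        -- `D 2` is c itself, which the distinctness of the quadruple excludes, just as index 0 is
        -- excluded by d being nonzero.
        classify (2 , e , _) = contradiction (trans (solve 1 (λ k → con (+ 16) :* k :* k :* k :- con (+ 4) :* k
          := (con (+ 4) :* k :* k :- con (+ 2)) :* (con (+ 4) :* k) :- con (+ 0) :+ con (+ 4) :* k) refl k) (sym e)) c≢d
        classify (3 , e , _) = inj₂ (trans e (solve 1 (λ k → let w = con (+ 4) :* k :* k :- con (+ 2) in
          w :* (w :* (con (+ 4) :* k) :- con (+ 0) :+ con (+ 4) :* k) :- con (+ 4) :* k :+ con (+ 4) :* k
          := con (+ 64) :* k :* k :* k :* k :* k :- con (+ 48) :* k :* k :* k :+ con (+ 8) :* k) refl k))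
        classify (suc (suc (suc (suc i))) , e , n) = high i e n (suc i ≤? 28)

  -- The Gaussian integers as a normed ring, and the theorem

  square-pos : ∀ n → n ℤ.* n ≡ + (∣ n ∣ * ∣ n ∣)
  square-pos (+ n) = sym (ℤ.pos-* n n)
  square-pos -[1+ n ] = refl

  sum-zero : ∀ m n → m * m + n * n ≡ 0 → m ≡ 0 × n ≡ 0
  sum-zero zero zero _ = refl , refl

  open import Defs

  N[i] : ℤ[i] → ℕ
  N[i] x = ∣ re x ∣ * ∣ re x ∣ + ∣ im x ∣ * ∣ im x ∣

  norm≡N[i] : ∀ x → norm x ≡ + N[i] x
  norm≡N[i] x = cong₂ ℤ._+_ (square-pos (re x)) (square-pos (im x))

  module _ where
    open ℤS.+-*-Solver

    norm-* : ∀ x y → norm (x *ᵍ y) ≡ norm x ℤ.* norm y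
    norm-* x y = solve 4 (λ a b c d → (a :* c :- b :* d) :* (a :* c :- b :* d) :+ (a :* d :+ b :* c) :* (a :* d :+ b :* c)
      := (a :* a :+ b :* b) :* (c :* c :+ d :* d)) refl (re x) (im x) (re y) (im y)

    parallelogram : ∀ x y → norm (x +ᵍ y) ℤ.+ norm (x -ᵍ y) ≡ + 2 ℤ.* (norm x ℤ.+ norm y)
    parallelogram x y = solve 4 (λ a b c d → ((a :+ c) :* (a :+ c) :+ (b :+ d) :* (b :+ d)) :+ ((a :- c) :* (a :- c) :+ (b :- d) :* (b :- d))
      := con (+ 2) :* ((a :* a :+ b :* b) :+ (c :* c :+ d :* d))) refl (re x) (im x) (re y) (im y)

  N[i]-* : ∀ x y → N[i] (x *ᵍ y) ≡ N[i] x * N[i] y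
  N[i]-* x y = ℤ.+-injective (begin
    + N[i] (x *ᵍ y) ≡⟨ sym (norm≡N[i] (x *ᵍ y)) ⟩
    norm (x *ᵍ y) ≡⟨ norm-* x y ⟩
    norm x ℤ.* norm y ≡⟨ cong₂ ℤ._*_ (norm≡N[i] x) (norm≡N[i] y) ⟩
    + N[i] x ℤ.* + N[i] y ≡⟨ sym (ℤ.pos-* (N[i] x) (N[i] y)) ⟩
    + (N[i] x * N[i] y) ∎)
    where open ≡-Reasoning

  -- The parallelogram law with the norm of the difference left out.
  N[i]-+ : ∀ x y → N[i] (x +ᵍ y) ≤ 2 * (N[i] x + N[i] y)
  N[i]-+ x y = ≤-trans (m≤m+n (N[i] (x +ᵍ y)) (N[i] (x -ᵍ y))) (≤-reflexive (ℤ.+-injective (begin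
    + N[i] (x +ᵍ y) ℤ.+ + N[i] (x -ᵍ y) ≡⟨ cong₂ ℤ._+_ (sym (norm≡N[i] (x +ᵍ y))) (sym (norm≡N[i] (x -ᵍ y))) ⟩
    norm (x +ᵍ y) ℤ.+ norm (x -ᵍ y) ≡⟨ parallelogram x y ⟩
    + 2 ℤ.* (norm x ℤ.+ norm y) ≡⟨ cong (+ 2 ℤ.*_) (cong₂ ℤ._+_ (norm≡N[i] x) (norm≡N[i] y)) ⟩
    + 2 ℤ.* (+ (N[i] x + N[i] y)) ≡⟨ sym (ℤ.pos-* 2 (N[i] x + N[i] y)) ⟩
    + (2 * (N[i] x + N[i] y)) ∎)))
    where open ≡-Reasoning

  N[i]≡0 : ∀ {x} → N[i] x ≡ 0 → x ≡ 0ᵍ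
  N[i]≡0 {x} h with sum-zero ∣ re x ∣ ∣ im x ∣ h
  ... | p , q = cong₂ _+_i (ℤ.∣i∣≡0⇒i≡0 p) (ℤ.∣i∣≡0⇒i≡0 q)

  isCommutativeRing[i] : IsCommutativeRing _≡_ _+ᵍ_ _*ᵍ_ (λ x → -ᵍ x) 0ᵍ 1ᵍ
  isCommutativeRing[i] = record
    { isRing = record
      { +-isAbelianGroup = record
        { isGroup = record
          { isMonoid = record
            { isSemigroup = record
              { isMagma = record { isEquivalence = isEquivalence ; ∙-cong = cong₂ _+ᵍ_ }
              ; assoc = λ x y z → cong₂ _+_i (ℤ.+-assoc (re x) (re y) (re z)) (ℤ.+-assoc (im x) (im y) (im z)) }
            ; identity = (λ x → cong₂ _+_i (ℤ.+-identityˡ (re x)) (ℤ.+-identityˡ (im x))) , (λ x → cong₂ _+_i (ℤ.+-identityʳ (re x)) (ℤ.+-identityʳ (im x))) }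
          ; inverse = (λ x → cong₂ _+_i (ℤ.+-inverseˡ (re x)) (ℤ.+-inverseˡ (im x))) , (λ x → cong₂ _+_i (ℤ.+-inverseʳ (re x)) (ℤ.+-inverseʳ (im x)))
          ; ⁻¹-cong = cong (λ x → -ᵍ x) }
        ; comm = λ x y → cong₂ _+_i (ℤ.+-comm (re x) (re y)) (ℤ.+-comm (im x) (im y)) }
      ; *-cong = cong₂ _*ᵍ_
      ; *-assoc = λ x y z → cong₂ _+_i
          (solve 6 (λ a b c d e f → (a :* c :- b :* d) :* e :- (a :* d :+ b :* c) :* f := a :* (c :* e :- d :* f) :- b :* (c :* f :+ d :* e)) refl (re x) (im x) (re y) (im y) (re z) (im z))
          (solve 6 (λ a b c d e f → (a :* c :- b :* d) :* f :+ (a :* d :+ b :* c) :* e := a :* (c :* f :+ d :* e) :+ b :* (c :* e :- d :* f)) refl (re x) (im x) (re y) (im y) (re z) (im z))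
      ; *-identity = (λ x → cong₂ _+_i (one-re x) (one-im x)) , (λ x → cong₂ _+_i (re-one x) (im-one x))
      ; distrib = (λ x y z → cong₂ _+_i
            (solve 6 (λ a b c d e f → a :* (c :+ e) :- b :* (d :+ f) := (a :* c :- b :* d) :+ (a :* e :- b :* f)) refl (re x) (im x) (re y) (im y) (re z) (im z))
            (solve 6 (λ a b c d e f → a :* (d :+ f) :+ b :* (c :+ e) := (a :* d :+ b :* c) :+ (a :* f :+ b :* e)) refl (re x) (im x) (re y) (im y) (re z) (im z)))
        , (λ z x y → cong₂ _+_i
            (solve 6 (λ a b c d e f → (c :+ e) :* a :- (d :+ f) :* b := (c :* a :- d :* b) :+ (e :* a :- f :* b)) refl (re z) (im z) (re x) (im x) (re y) (im y))
            (solve 6 (λ a b c d e f → (c :+ e) :* b :+ (d :+ f) :* a := (c :* b :+ d :* a) :+ (e :* b :+ f :* a)) refl (re z) (im z) (re x) (im x) (re y) (im y))) }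
    ; *-comm = λ x y → cong₂ _+_i
        (solve 4 (λ a b c d → a :* c :- b :* d := c :* a :- d :* b) refl (re x) (im x) (re y) (im y))
        (solve 4 (λ a b c d → a :* d :+ b :* c := c :* b :+ d :* a) refl (re x) (im x) (re y) (im y)) }
    where
    open ℤS.+-*-Solver
    one-re : ∀ x → re (1ᵍ *ᵍ x) ≡ re x
    one-re x = solve 2 (λ a b → con (+ 1) :* a :- con (+ 0) :* b := a) refl (re x) (im x)
    one-im : ∀ x → im (1ᵍ *ᵍ x) ≡ im x
    one-im x = solve 2 (λ a b → con (+ 1) :* b :+ con (+ 0) :* a := b) refl (re x) (im x)
    re-one : ∀ x → re (x *ᵍ 1ᵍ) ≡ re x
    re-one x = solve 2 (λ a b → a :* con (+ 1) :- b :* con (+ 0) := a) refl (re x) (im x)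
    im-one : ∀ x → im (x *ᵍ 1ᵍ) ≡ im x
    im-one x = solve 2 (λ a b → a :* con (+ 0) :+ b :* con (+ 1) := b) refl (re x) (im x)

  gaussian : NormedRing
  gaussian = record
    { Carrier = ℤ[i] ; _⊕_ = _+ᵍ_ ; _⊗_ = _*ᵍ_ ; neg = λ x → -ᵍ x ; ι = ι
    ; isCommutativeRing = isCommutativeRing[i]
    ; ι-+ = λ m n → refl
    ; ι-* = λ m n → cong₂ _+_i
        (solve 2 (λ m n → m :* n := m :* n :- con (+ 0) :* con (+ 0)) refl m n)
        (solve 2 (λ m n → con (+ 0) := m :* con (+ 0) :+ con (+ 0) :* n) refl m n)
    ; ι-neg = λ m → refl
    ; N = N[i] ; N-⊗ = N[i]-* ; N-⊕ = N[i]-+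
    ; N-ι = λ n → +-identityʳ _
    ; N≡0 = N[i]≡0 }
    where open ℤS.+-*-Solver

  large-unique-extension : ∀ k d → + (25 * 10 ^ 74) ℤ.≤ norm k →
    DiophantineQuadruple (k -ᵍ 1ᵍ) (k +ᵍ 1ᵍ) (ι (+ 16) *ᵍ k *ᵍ k *ᵍ k -ᵍ ι (+ 4) *ᵍ k) d →
    d ≡ ι (+ 4) *ᵍ k ⊎ d ≡ ι (+ 64) *ᵍ k *ᵍ k *ᵍ k *ᵍ k *ᵍ k -ᵍ ι (+ 48) *ᵍ k *ᵍ k *ᵍ k +ᵍ ι (+ 8) *ᵍ k
  large-unique-extension k d k-large ((_ , _ , _ , d≢0) , (_ , _ , _ , _ , _ , c≢d) , _ , _ , (x , hx) , _ , (y , hy) , (z , hz)) =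
    Extensions.unique-extension gaussian k k≥ {d} {x} {y} {z} (sym hx) (sym hy) (sym hz) d≢0 c≢d
    where
    -- 4^125 = 2^250 is about 1.81 · 10^75, and 25 · 10^74 = 2.5 · 10^75.
    k≥ : 4 ^ 125 ≤ N[i] k
    k≥ = ≤-trans (≤ᵇ⇒≤ (4 ^ 125) (25 * 10 ^ 74) tt) (ℤ.drop‿+≤+ (subst (+ (25 * 10 ^ 74) ℤ.≤_) (norm≡N[i] k) k-large))

open import Defs
open import Data.Integer using (ℤ; +_; _≤_; _*_; _^_)
open import Data.Sum using (_⊎_)
open import Relation.Binary.PropositionalEquality using (_≡_)
open import Relation.Nullary using (¬_)

theorem7p7 : (k d : ℤ[i]) → ¬ re k ≡ + 0
    → (+ 25) * (+ 10) ^ 74 ≤ norm k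
    → DiophantineQuadruple (k -ᵍ 1ᵍ) (k +ᵍ 1ᵍ)
    (ι (+ 16) *ᵍ k *ᵍ k *ᵍ k -ᵍ ι (+ 4) *ᵍ k) d
    → d ≡ ι (+ 4) *ᵍ k
    ⊎ d ≡ ι (+ 64) *ᵍ k *ᵍ k *ᵍ k *ᵍ k *ᵍ k -ᵍ ι (+ 48) *ᵍ k *ᵍ k *ᵍ k +ᵍ ι (+ 8) *ᵍ k
theorem7p7 k d _ = Development.large-unique-extension k d
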